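{- Let $S_2=\{(2,-1,-1),(3,-1,0)\}$. If $(t_2,t_3,t_4)\in S_2$, then for all integers $n\geq 0$, $$a_{2^{t_2}3^{t_3}4^{t_4}}(3n)>0,\qquad a_{2^{t_2}3^{t_3}4^{t_4}}(3n+1)=0,\qquad a_{2^{t_2}3^{t_3}4^{t_4}}(3n+2)<0.$$
   Context: For $|q|<1$ (or as formal power series in $q$) let $f_j:=(q^j;q^j)_\infty=\prod_{k\ge 1}(1-q^{jk})$ for each positive integer $j$. For a positive integer $m$ and integers $t_1,\dots,t_m$ (possibly zero or negative), the integers $a_{1^{t_1}2^{t_2}\cdots m^{t_m}}(n)$, $n\ge 0$, are defined by $\sum_{n=0}^\infty a_{1^{t_1}2^{t_2}\cdots m^{t_m}}(n)q^n=f_1^{t_1}f_2^{t_2}\cdots f_m^{t_m}$. Factors with exponent $0$ may be omitted from the notation; so $\sum_{n\ge0} a_{2^{t_2}3^{t_3}4^{t_4}}(n)q^n=f_2^{t_2}f_3^{t_3}f_4^{t_4}$. -}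

module Defs where

open import Data.Nat.Base as ℕ using (ℕ; zero; suc; NonZero; _∸_; s≤s)
import Data.Nat.Properties as ℕ
open import Data.Integer.Base using (ℤ; +_; -[1+_]; 0ℤ; 1ℤ; _+_; _*_; -_; _-_)
open import Data.Integer.Properties using
  (+-*-semiring; *-identityˡ; *-zeroˡ; +-identityʳ; +-inverseˡ; *-identityʳ)
open import Data.Fin.Base using (Fin; zero; suc; toℕ)
open import Data.Fin.Properties using (toℕ<n)
open import Data.List.Base using (List; []; _∷_)
open import Data.Product.Base using (_×_; _,_)
open import Data.Vec.Base as Vec using (Vec; []; _∷_; lookup)
open import Algebra.Properties.Semiring.Sum +-*-semiring
  using (sum; sum-syntax; sum⁺-syntax; sum-cong-≗; sum-replicate-zero)
open import Function.Base using (_∘_)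
open import Relation.Nullary.Decidable using (yes; no)
open import Relation.Nullary.Negation using (contradiction)
open import Relation.Binary.PropositionalEquality
  using (_≡_; _≢_; _≗_; refl; sym; trans; cong; cong₂; module ≡-Reasoning)

-- Formal power series over ℤ: s n is the coefficient of qⁿ.  Two series are
-- identified when they are pointwise equal (_≗_).
Series : Set
Series = ℕ → ℤ

infixl 7 _⊛_
infixr 8 _^ℕ_ _^ℤ_

q^_ : ℕ → Series
(q^ m) n with m ℕ.≟ n
... | yes _ = 1ℤ
... | no  _ = 0ℤ

one : Series
one = q^ 0

_⊖_ : Series → Series → Series
(s ⊖ t) n = s n - t n

_⊛_ : Series → Series → Series
(s ⊛ t) n = ∑[ i ≤ n ] (s (toℕ i) * t (n ∸ toℕ i))

-- Coefficients n, n-1, …, 0 (in that order) of 1/s, for s with constant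
-- term 1, determined by  u₀ = 1  and  uₙ₊₁ = - Σ_{i ≤ n} sᵢ₊₁ uₙ₋ᵢ.
recipCoeffs : Series → (n : ℕ) → Vec ℤ (suc n)
recipCoeffs s zero    = 1ℤ ∷ []
recipCoeffs s (suc n) =
  - (∑[ i ≤ n ] (s (suc (toℕ i)) * lookup (recipCoeffs s n) i))
    ∷ recipCoeffs s n

-- The multiplicative inverse of s, by ⊛-recip; only meaningful when
-- s 0 ≡ 1ℤ, a condition that f j satisfies by computation.
recip : Series → Series
recip s n = Vec.head (recipCoeffs s n)

_^ℕ_ : Series → ℕ → Series
s ^ℕ zero  = one
s ^ℕ suc n = s ⊛ (s ^ℕ n)

_^ℤ_ : Series → ℤ → Series
s ^ℤ (+ n)    = s ^ℕ n
s ^ℤ -[1+ n ] = recip s ^ℕ suc n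

-- ∏_{k=1}^{K} (1 - q^{jk})
partialProduct : ℕ → ℕ → Series
partialProduct j zero    = one
partialProduct j (suc K) = (one ⊖ (q^ (j ℕ.* suc K))) ⊛ partialProduct j K

-- f j = ∏_{k≥1} (1 - q^{jk}).  Factors with k > n do not affect the
-- coefficient of qⁿ, so it can be read off the n-th partial product
-- (see partialProduct-stable).
f : (j : ℕ) .{{_ : NonZero j}} → Series
f j n = partialProduct j n n

-- ∏ f_{j+i}^{tᵢ} over the entries t₀, t₁, … of the vector.
fProductFrom : (j : ℕ) .{{_ : NonZero j}} → ∀ {m} → Vec ℤ m → Series
fProductFrom j []       = one
fProductFrom j (t ∷ ts) = (f j ^ℤ t) ⊛ fProductFrom (suc j) ts

-- a (t₁ ∷ … ∷ tₘ ∷ []) n is the coefficient of qⁿ in f₁^{t₁} ⋯ fₘ^{tₘ}.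
a : ∀ {m} → Vec ℤ m → ℕ → ℤ
a ts = fProductFrom 1 ts

-- The triples (t₂ , t₃ , t₄).
S₂ : List (ℤ × ℤ × ℤ)
S₂ = (+ 2 , -[1+ 0 ] , -[1+ 0 ]) ∷ (+ 3 , -[1+ 0 ] , + 0) ∷ []

-- The remaining lemmas justify the definitions of recip and f.

q^-≢ : ∀ {m n} → m ≢ n → (q^ m) n ≡ 0ℤ
q^-≢ {m} {n} m≢n with m ℕ.≟ n
... | yes m≡n = contradiction m≡n m≢n
... | no  _   = refl

lookup-recipCoeffs : ∀ s n (i : Fin (suc n)) →
                     lookup (recipCoeffs s n) i ≡ recip s (n ∸ toℕ i)
lookup-recipCoeffs s zero    zero    = refl
lookup-recipCoeffs s (suc n) zero    = refl
lookup-recipCoeffs s (suc n) (suc i) = lookup-recipCoeffs s n i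

⊛-recip : ∀ s → s 0 ≡ 1ℤ → s ⊛ recip s ≗ one
⊛-recip s s₀≡1 zero    = trans (+-identityʳ _) (trans (*-identityʳ (s 0)) s₀≡1)
⊛-recip s s₀≡1 (suc n) = begin
  s 0 * - σ + (∑[ i ≤ n ] (s (suc (toℕ i)) * recip s (n ∸ toℕ i)))
    ≡⟨ cong₂ _+_
         (trans (cong (_* - σ) s₀≡1) (*-identityˡ (- σ)))
         (sum-cong-≗ {suc n} λ i →
            cong (s (suc (toℕ i)) *_) (sym (lookup-recipCoeffs s n i))) ⟩
  - σ + σ
    ≡⟨ +-inverseˡ σ ⟩
  0ℤ ∎
  where
  open ≡-Reasoning
  σ = ∑[ i ≤ n ] (s (suc (toℕ i)) * lookup (recipCoeffs s n) i)

[1-q^m]⊛-low : ∀ {m n} → n ℕ.< m → ∀ s → ((one ⊖ (q^ m)) ⊛ s) n ≡ s n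
[1-q^m]⊛-low {m} {n} n<m s = begin
  (1ℤ - (q^ m) 0) * s n + sum tail
    ≡⟨ cong₂ _+_
         (cong (λ c → (1ℤ - c) * s n) (q^-≢ {m} {0} λ { refl → ℕ.n≮0 n<m }))
         (trans (sum-cong-≗ {n} {tail} {λ _ → 0ℤ} tail≗0) (sum-replicate-zero n)) ⟩
  1ℤ * s n + 0ℤ
    ≡⟨ trans (+-identityʳ (1ℤ * s n)) (*-identityˡ (s n)) ⟩
  s n ∎
  where
  open ≡-Reasoning
  tail : Fin n → ℤ
  tail i = (one ⊖ (q^ m)) (suc (toℕ i)) * s (n ∸ suc (toℕ i))
  tail≗0 : ∀ i → tail i ≡ 0ℤ
  tail≗0 i = trans
    (cong (λ c → (0ℤ - c) * s (n ∸ suc (toℕ i)))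
      (q^-≢ {m} {suc (toℕ i)} λ { refl → ℕ.<⇒≱ n<m (toℕ<n i) }))
    (*-zeroˡ (s (n ∸ suc (toℕ i))))

partialProduct-stable : ∀ j .{{_ : NonZero j}} {n K} → n ℕ.≤ K →
                        partialProduct j K n ≡ f j n
partialProduct-stable j {n} {K} n≤K with ℕ.≤⇒≤′ n≤K
... | ℕ.≤′-reflexive refl = refl
... | ℕ.≤′-step {K′} n≤′K′ = trans
  ([1-q^m]⊛-low
    (ℕ.<-≤-trans (s≤s (ℕ.≤′⇒≤ n≤′K′)) (ℕ.m≤n*m (suc K′) j))
    (partialProduct j K′))
  (partialProduct-stable j (ℕ.≤′⇒≤ n≤′K′))

{-# OPTIONS --safe #-}
module Submission where

-- Both quotients are dissected modulo 3, with positive series as pieces.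
--
-- For f₂²/(f₃f₄), the Jacobi triple product turns f₂²/f₄ into ∑ (-1)^m q^{2m²}.
-- Sorting m modulo 3 and applying the triple product backwards gives
-- f₂²/f₄ = A(q³) - 2q² B(q³) with product formulas for A and B, and both A(q³)/f₃
-- and B(q³)/f₃ are products of factors 1/(1 - q^{3k}) and 1 + q^{3k}.
--
-- For f₂³/f₃ = (f₂³/f₆)(f₆/f₃), the factor f₆/f₃ = ∏ 1/(1 - q^{6k+3}) is positive in
-- q³, so only the signs in f₂³/f₆ matter.  With ω a primitive cube root of unity,
-- (1 + x)(1 + ωx)(1 + ω²x) = 1 + x³.  Multiplying this over x = z q^{2k}, k < 2s, and
-- comparing the coefficients of z^{3s} expresses f₂³/f₆, in the limit, as
-- ∑ ω^{i-j} q^{2(i² + ij + j²)}.  As i² + ij + j² ≡ (i - j)² modulo 3, the real part of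
-- ω^{i-j} is determined by the exponent: it is 1 on multiples of 3 and -1/2 on the
-- exponents ≡ 2, and no exponent is ≡ 1.
--
-- Infinite products and sums are compared up to a given power of q with finite
-- ones, for which the expansions are q-binomial identities.

open import Defs
open import Algebra.Bundles using (CommutativeRing)
open import Algebra.Structures using (IsCommutativeRing)
open import Data.Empty using (⊥)
open import Data.Fin.Base using (Fin; zero; suc; toℕ)
open import Data.Fin.Properties using (toℕ<n)
open import Data.Integer.Base using (ℤ; +_; +[1+_]; -[1+_]; 0ℤ; 1ℤ; _>_; _<_; _≤_; +≤+; -≤+; +<+; -<+)
import Data.Integer.Properties as ℤ
open import Data.Integer.Tactic.RingSolver using () renaming (solve-∀ to ℤ-solve-∀)
open import Data.List.Membership.Propositional using (_∈_)
open import Data.List.Relation.Unary.Any using (here; there)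
open import Data.Nat.Base as ℕ using (ℕ; zero; suc; _∸_; NonZero; z≤n; s≤s)
open import Data.Nat.Divisibility using (_∣_; divides; ∣m∣n⇒∣m+n; ∣m⇒∣m*n)
open import Data.Nat.Induction using (<-rec)
import Data.Nat.Properties as ℕ
import Data.Nat.Solver as ℕ-Solver
open import Data.Product.Base using (_×_; _,_; proj₁; proj₂)
open import Data.Unit using (⊤; tt)
open import Data.Vec.Base using ([]; _∷_)
open import Function.Base using (_∘_; it)
open import Level using (Level; 0ℓ)
open import Relation.Binary.PropositionalEquality as ≡ using (_≡_; _≢_; _≗_)
open import Relation.Nullary.Decidable using (yes; no)
open import Relation.Nullary.Negation using (contradiction)

-- Two obstacles shape the finite identities. No series in a second variable z is ever formed: a
-- polynomial in z enters only through the linear functional `Λ`, which sends z^i to a chosen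
-- series, so extracting a coefficient or substituting for z is a choice of that series. And ω does
-- not exist over the integers: the product is added to its conjugate, which replaces ω^(i-j) by the
-- integer ω^(i-j) + ω^(j-i), at the price of a factor 2 that is divided out at the end.
--
-- Each finite identity carries a monomial q^w₀ of large degree, so the coefficient of q^n is found
-- at degree w₀ + n, and an approximation is useful only if its error lies beyond. The terms far
-- from the centre, where the q-binomial coefficients are worst approximated, have a larger
-- exponent, because i(i-1)/2 is convex, and this compensates.
--
-- The cubic argument gives weak inequalities only. Strictness comes from the factor 1/(1 - q³) of
-- f₆/f₃, together with the coefficients 1 and -3 of q⁰ and q² in f₂³/f₆.

module ElementarySymmetric {c ℓ : Level} (R : CommutativeRing c ℓ) where
  open CommutativeRing R
  open import Algebra.Solver.Ring.NaturalCoefficients.Default commutativeSemiring using (solve; _:=_; _:+_; _:*_; con)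
  open import Algebra.Properties.Ring ring using (-‿distribʳ-*)
  open import Algebra.Properties.Semiring.Exp semiring using (_^_)
  open import Relation.Binary.Reasoning.Setoid setoid

  -- Finite sums, products and elementary symmetric polynomials over a commutative ring.

  ∑ : ℕ → (ℕ → Carrier) → Carrier
  ∑ zero    g = 0#
  ∑ (suc n) g = g 0 + ∑ n (g ∘ suc)

  ∑-cong : ∀ n {g h} → (∀ i → i ℕ.< n → g i ≈ h i) → ∑ n g ≈ ∑ n h
  ∑-cong zero    g≈h = refl
  ∑-cong (suc n) g≈h = +-cong (g≈h 0 (s≤s z≤n)) (∑-cong n λ i i<n → g≈h (suc i) (s≤s i<n))

  ∑-linear : ∀ n x g h → ∑ n (λ i → g i + x * h i) ≈ ∑ n g + x * ∑ n h
  ∑-linear zero    x g h = sym (trans (+-identityˡ (x * 0#)) (zeroʳ x))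
  ∑-linear (suc n) x g h = trans (+-congˡ (∑-linear n x (g ∘ suc) (h ∘ suc)))
    (lemma (g 0) (h 0) (∑ n (g ∘ suc)) (∑ n (h ∘ suc)) x)
    where
    lemma : ∀ a b s t x → (a + x * b) + (s + x * t) ≈ (a + s) + x * (b + t)
    lemma = solve 5 (λ a b s t x → (a :+ x :* b) :+ (s :+ x :* t) := (a :+ s) :+ x :* (b :+ t)) refl

  *-distribˡ-∑ : ∀ n x g → x * ∑ n g ≈ ∑ n (λ i → x * g i)
  *-distribˡ-∑ zero    x g = zeroʳ x
  *-distribˡ-∑ (suc n) x g = trans (distribˡ x (g 0) (∑ n (g ∘ suc)))
    (+-congˡ (*-distribˡ-∑ n x (g ∘ suc)))

  ∑-last : ∀ n g → ∑ (suc n) g ≈ ∑ n g + g n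
  ∑-last zero    g = +-comm (g 0) 0#
  ∑-last (suc n) g = trans (+-congˡ (∑-last n (g ∘ suc)))
    (sym (+-assoc (g 0) (∑ n (g ∘ suc)) (g (suc n))))

  ∑-zero : ∀ n {g} → (∀ i → g i ≈ 0#) → ∑ n g ≈ 0#
  ∑-zero zero    g≈0 = refl
  ∑-zero (suc n) g≈0 = trans (+-cong (g≈0 0) (∑-zero n (g≈0 ∘ suc))) (+-identityˡ 0#)

  ∑-only : ∀ {n} k g → k ℕ.< n → (∀ i → i ≢ k → g i ≈ 0#) → ∑ n g ≈ g k
  ∑-only {suc n} zero    g _         g≈0 = trans (+-congˡ (∑-zero n λ i → g≈0 (suc i) λ ()))
    (+-identityʳ (g 0))
  ∑-only {suc n} (suc k) g (s≤s k<n) g≈0 = trans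
    (+-cong (g≈0 0 λ ()) (∑-only k (g ∘ suc) k<n λ i i≢k → g≈0 (suc i) (i≢k ∘ ℕ.suc-injective)))
    (+-identityˡ (g (suc k)))

  ∏ : ℕ → (ℕ → Carrier) → Carrier
  ∏ zero    g = 1#
  ∏ (suc n) g = g n * ∏ n g

  ∏-cong : ∀ n {g h} → (∀ i → i ℕ.< n → g i ≈ h i) → ∏ n g ≈ ∏ n h
  ∏-cong zero    g≈h = refl
  ∏-cong (suc n) g≈h = *-cong (g≈h n ℕ.≤-refl) (∏-cong n λ i i<n → g≈h i (ℕ.m<n⇒m<1+n i<n))

  ∏-* : ∀ n g h → ∏ n (λ i → g i * h i) ≈ ∏ n g * ∏ n h
  ∏-* zero    g h = sym (*-identityˡ 1#)
  ∏-* (suc n) g h = trans (*-congˡ (∏-* n g h))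
    (solve 4 (λ a b c d → (a :* b) :* (c :* d) := (a :* c) :* (b :* d)) refl
      (g n) (h n) (∏ n g) (∏ n h))

  ∏-first : ∀ n g → ∏ (suc n) g ≈ ∏ n (g ∘ suc) * g 0
  ∏-first zero    g = *-comm (g 0) 1#
  ∏-first (suc n) g = trans (*-congˡ (∏-first n g)) (sym (*-assoc (g (suc n)) (∏ n (g ∘ suc)) (g 0)))

  ∏-+ : ∀ m n g → ∏ (m ℕ.+ n) g ≈ ∏ m g * ∏ n (λ i → g (m ℕ.+ i))
  ∏-+ m zero    g = trans (reflexive (≡.cong (λ l → ∏ l g) (ℕ.+-identityʳ m))) (sym (*-identityʳ (∏ m g)))
  ∏-+ m (suc n) g = begin
    ∏ (m ℕ.+ suc n) g                                  ≡⟨ ≡.cong (λ l → ∏ l g) (ℕ.+-suc m n) ⟩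
    g (m ℕ.+ n) * ∏ (m ℕ.+ n) g                        ≈⟨ *-congˡ (∏-+ m n g) ⟩
    g (m ℕ.+ n) * (∏ m g * ∏ n (λ i → g (m ℕ.+ i)))
      ≈⟨ solve 3 (λ a b c → a :* (b :* c) := b :* (a :* c)) refl
           (g (m ℕ.+ n)) (∏ m g) (∏ n (λ i → g (m ℕ.+ i))) ⟩
    ∏ m g * (g (m ℕ.+ n) * ∏ n (λ i → g (m ℕ.+ i)))    ∎

  ∏-reverse : ∀ n g → ∏ n g ≈ ∏ n (λ i → g (n ∸ suc i))
  ∏-reverse zero    g = refl
  ∏-reverse (suc n) g = begin
    g n * ∏ n g                          ≈⟨ *-congˡ (∏-reverse n g) ⟩
    g n * ∏ n (λ i → g (n ∸ suc i))      ≈⟨ *-comm (g n) (∏ n (λ i → g (n ∸ suc i))) ⟩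
    ∏ n (λ i → g (n ∸ suc i)) * g n      ≈⟨ ∏-first n (λ i → g (n ∸ i)) ⟨
    ∏ (suc n) (λ i → g (n ∸ i))          ∎

  ∑-+ : ∀ m n g → ∑ (m ℕ.+ n) g ≈ ∑ m g + ∑ n (λ i → g (m ℕ.+ i))
  ∑-+ zero    n g = sym (+-identityˡ (∑ n g))
  ∑-+ (suc m) n g = trans (+-congˡ (∑-+ m n (g ∘ suc)))
    (sym (+-assoc (g 0) (∑ m (g ∘ suc)) (∑ n (λ i → g (suc m ℕ.+ i)))))

  ∑-reverse : ∀ n g → ∑ n g ≈ ∑ n (λ i → g (n ∸ suc i))
  ∑-reverse zero    g = refl
  ∑-reverse (suc n) g = begin
    ∑ (suc n) g                          ≈⟨ ∑-last n g ⟩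
    ∑ n g + g n                          ≈⟨ +-congʳ (∑-reverse n g) ⟩
    ∑ n (λ i → g (n ∸ suc i)) + g n      ≈⟨ +-comm (∑ n (λ i → g (n ∸ suc i))) (g n) ⟩
    g n + ∑ n (λ i → g (n ∸ suc i))      ∎

  -- The i-th elementary symmetric polynomial in p 0, …, p (M - 1).
  elem : (ℕ → Carrier) → ℕ → ℕ → Carrier
  elem p M       zero    = 1#
  elem p zero    (suc i) = 0#
  elem p (suc M) (suc i) = elem p M (suc i) + p M * elem p M i

  elem-zero : ∀ p {M i} → M ℕ.< i → elem p M i ≈ 0#
  elem-zero p {zero}  {suc i} _         = refl
  elem-zero p {suc M} {suc i} (s≤s M<i) = begin
    elem p M (suc i) + p M * elem p M i
      ≈⟨ +-cong (elem-zero p (ℕ.m<n⇒m<1+n M<i)) (*-congˡ (elem-zero p M<i)) ⟩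
    0# + p M * 0#  ≈⟨ trans (+-identityˡ (p M * 0#)) (zeroʳ (p M)) ⟩
    0#             ∎

  elem-cong : ∀ {p r} → (∀ k → p k ≈ r k) → ∀ M i → elem p M i ≈ elem r M i
  elem-cong p≈r M       zero    = refl
  elem-cong p≈r zero    (suc i) = refl
  elem-cong p≈r (suc M) (suc i) =
    +-cong (elem-cong p≈r M (suc i)) (*-cong (p≈r M) (elem-cong p≈r M i))

  -- The image of ∏_{k<M} (1 + p k z) under the linear map zⁱ ↦ g i.
  Λ : (ℕ → Carrier) → ℕ → (ℕ → Carrier) → Carrier
  Λ p M g = ∑ (suc M) λ i → elem p M i * g i

  Λ-cong : ∀ p M {g h} → (∀ i → i ℕ.≤ M → g i ≈ h i) → Λ p M g ≈ Λ p M h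
  Λ-cong p M g≈h = ∑-cong (suc M) λ i i<1+M → *-congˡ {elem p M i} (g≈h i (ℕ.s≤s⁻¹ i<1+M))

  Λ-linear : ∀ p M x g h → Λ p M (λ i → g i + x * h i) ≈ Λ p M g + x * Λ p M h
  Λ-linear p M x g h = trans
    (∑-cong (suc M) λ i _ → lemma (elem p M i) (g i) x (h i))
    (∑-linear (suc M) x (λ i → elem p M i * g i) (λ i → elem p M i * h i))
    where
    lemma : ∀ e g x h → e * (g + x * h) ≈ e * g + x * (e * h)
    lemma = solve 4 (λ e g x h → e :* (g :+ x :* h) := e :* g :+ x :* (e :* h)) refl

  Λ-* : ∀ p M x g → Λ p M (λ i → x * g i) ≈ x * Λ p M g
  Λ-* p M x g = trans
    (∑-cong (suc M) λ i _ → solve 3 (λ e x g → e :* (x :* g) := x :* (e :* g)) refl (elem p M i) x (g i))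
    (sym (*-distribˡ-∑ (suc M) x (λ i → elem p M i * g i)))

  Λ-zero : ∀ p g → Λ p 0 g ≈ g 0
  Λ-zero p g = trans (+-identityʳ (1# * g 0)) (*-identityˡ (g 0))

  -- Adjoint form of multiplication by one more factor 1 + p M z: the factor moves from the
  -- polynomial to the function on which it is tested.
  Λ-suc : ∀ p M g → Λ p (suc M) g ≈ Λ p M (λ i → g i + p M * g (suc i))
  Λ-suc p M g = begin
    1# * g 0 + ∑ (suc M) (λ i → (elem p M (suc i) + p M * elem p M i) * g (suc i))
      ≈⟨ +-congˡ (trans (∑-cong (suc M) λ i _ → split (elem p M (suc i)) (p M) (elem p M i) (g (suc i)))
           (∑-linear (suc M) (p M) (λ i → elem p M (suc i) * g (suc i)) (λ i → elem p M i * g (suc i)))) ⟩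
    1# * g 0 + (∑ (suc M) (λ i → elem p M (suc i) * g (suc i)) + p M * Λ p M (g ∘ suc))
      ≈⟨ +-congˡ (+-congʳ (trans (∑-last M (λ i → elem p M (suc i) * g (suc i)))
           (+-congˡ (trans (*-congʳ (elem-zero p {M} ℕ.≤-refl)) (zeroˡ (g (suc M))))))) ⟩
    1# * g 0 + ((∑ M (λ i → elem p M (suc i) * g (suc i)) + 0#) + p M * Λ p M (g ∘ suc))
      ≈⟨ regroup (1# * g 0) (∑ M (λ i → elem p M (suc i) * g (suc i))) (p M * Λ p M (g ∘ suc)) ⟩
    Λ p M g + p M * Λ p M (g ∘ suc)
      ≈⟨ Λ-linear p M (p M) g (g ∘ suc) ⟨
    Λ p M (λ i → g i + p M * g (suc i)) ∎
    where
    split : ∀ a p b g → (a + p * b) * g ≈ a * g + p * (b * g)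
    split = solve 4 (λ a p b g → (a :+ p :* b) :* g := a :* g :+ p :* (b :* g)) refl
    regroup : ∀ a b d → a + ((b + 0#) + d) ≈ (a + b) + d
    regroup a b d = trans (+-congˡ (+-congʳ (+-identityʳ b))) (sym (+-assoc a b d))

  *-Λ : ∀ F p M g → F * Λ p M g ≈ ∑ (suc M) (λ i → F * elem p M i * g i)
  *-Λ F p M g = trans (*-distribˡ-∑ (suc M) F (λ i → elem p M i * g i))
    (∑-cong (suc M) λ i _ → sym (*-assoc F (elem p M i) (g i)))

  Λ₃ : (ℕ → Carrier) → ℕ → (ℕ → ℕ → ℕ → Carrier) → Carrier
  Λ₃ p M g = Λ p M λ i → Λ p M λ j → Λ p M λ k → g i j k

  -- Hands one factor `F` to each of the three variables. For `F` = `f c` every `X i` is then a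
  -- monomial times a series close to one, by `f-elem`.
  *-Λ₃ : ∀ F p M g → let X = λ i → F * elem p M i in
    F * (F * (F * Λ₃ p M g))
    ≈ ∑ (suc M) λ i → ∑ (suc M) λ j → ∑ (suc M) λ k → X i * (X j * (X k * g i j k))
  *-Λ₃ F p M g = begin
    F * (F * (F * Λ p M G))
      ≈⟨ *-congˡ (trans (*-congˡ (sym (Λ-* p M F G))) (sym (Λ-* p M F (λ i → F * G i)))) ⟩
    F * Λ p M (λ i → F * (F * G i))
      ≈⟨ *-Λ F p M (λ i → F * (F * G i)) ⟩
    ∑ (suc M) (λ i → X i * (F * (F * G i)))
      ≈⟨ ∑-cong (suc M) (λ i _ → trans (*-congˡ {X i} (inner i))
           (trans (*-distribˡ-∑ (suc M) (X i) (λ j → ∑ (suc M) λ k → X j * (X k * g i j k)))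
             (∑-cong (suc M) λ j _ → *-distribˡ-∑ (suc M) (X i) (λ k → X j * (X k * g i j k))))) ⟩
    ∑ (suc M) (λ i → ∑ (suc M) λ j → ∑ (suc M) λ k → X i * (X j * (X k * g i j k))) ∎
    where
    X G : ℕ → Carrier
    X i = F * elem p M i
    G i = Λ p M λ j → Λ p M λ k → g i j k
    inner : ∀ i → F * (F * G i) ≈ ∑ (suc M) λ j → ∑ (suc M) λ k → X j * (X k * g i j k)
    inner i = begin
      F * (F * G i)
        ≈⟨ *-congˡ (Λ-* p M F (λ j → Λ p M (g i j))) ⟨
      F * Λ p M (λ j → F * Λ p M (g i j))
        ≈⟨ *-Λ F p M (λ j → F * Λ p M (g i j)) ⟩
      ∑ (suc M) (λ j → X j * (F * Λ p M (g i j)))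
        ≈⟨ ∑-cong (suc M) (λ j _ → trans (*-congˡ {X j} (*-Λ F p M (g i j)))
             (*-distribˡ-∑ (suc M) (X j) (λ k → X k * g i j k))) ⟩
      ∑ (suc M) (λ j → ∑ (suc M) λ k → X j * (X k * g i j k)) ∎

  Λ₃-cong : ∀ p M {g h} → (∀ i j k → g i j k ≈ h i j k) → Λ₃ p M g ≈ Λ₃ p M h
  Λ₃-cong p M g≈h = Λ-cong p M λ i _ → Λ-cong p M λ j _ → Λ-cong p M λ k _ → g≈h i j k

  Λ₃-linear : ∀ p M x g h → Λ₃ p M (λ i j k → g i j k + x * h i j k) ≈ Λ₃ p M g + x * Λ₃ p M h
  Λ₃-linear p M x g h = trans
    (Λ-cong p M λ i _ → trans (Λ-cong p M λ j _ → Λ-linear p M x (g i j) (h i j))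
      (Λ-linear p M x (λ j → Λ p M (g i j)) (λ j → Λ p M (h i j))))
    (Λ-linear p M x (λ i → Λ p M λ j → Λ p M (g i j)) (λ i → Λ p M λ j → Λ p M (h i j)))

  -- Dual to multiplication by 1 + y z in each of three variables.
  extend₃ : Carrier → (ℕ → ℕ → ℕ → Carrier) → ℕ → ℕ → ℕ → Carrier
  extend₃ y g i j k =
    ((g i j k + y * g i j (suc k)) + y * (g i (suc j) k + y * g i (suc j) (suc k)))
    + y * ((g (suc i) j k + y * g (suc i) j (suc k))
      + y * (g (suc i) (suc j) k + y * g (suc i) (suc j) (suc k)))

  Λ₃-suc : ∀ p M g → Λ₃ p (suc M) g ≈ Λ₃ p M (extend₃ (p M) g)
  Λ₃-suc p M g = begin
    Λ₃ p (suc M) g  ≈⟨ Λ-suc p M G ⟩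
    Λ p M (λ i → G i + p M * G (suc i))
      ≈⟨ (Λ-cong p M λ i _ → trans (+-cong (G≈ i) (*-congˡ {p M} (G≈ (suc i))))
           (sym (trans (Λ-cong p M λ j _ → Λ-linear p M (p M) (D i j) (D (suc i) j))
             (Λ-linear p M (p M) (λ j → Λ p M (D i j)) (λ j → Λ p M (D (suc i) j)))))) ⟩
    Λ₃ p M (λ i j k → D i j k + p M * D (suc i) j k) ∎
    where
    G : ℕ → Carrier
    G i = Λ p (suc M) λ j → Λ p (suc M) λ k → g i j k
    D : ℕ → ℕ → ℕ → Carrier
    D i j k = (g i j k + p M * g i j (suc k)) + p M * (g i (suc j) k + p M * g i (suc j) (suc k))
    H : ℕ → ℕ → Carrier
    H i j = Λ p M λ k → g i j k + p M * g i j (suc k)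
    G≈ : ∀ i → G i ≈ Λ p M λ j → Λ p M λ k → D i j k
    G≈ i = begin
      G i
        ≈⟨ Λ-suc p M (λ j → Λ p (suc M) λ k → g i j k) ⟩
      Λ p M (λ j → Λ p (suc M) (λ k → g i j k) + p M * Λ p (suc M) (λ k → g i (suc j) k))
        ≈⟨ (Λ-cong p M λ j _ → +-cong (Λ-suc p M (g i j)) (*-congˡ {p M} (Λ-suc p M (g i (suc j))))) ⟩
      Λ p M (λ j → H i j + p M * H i (suc j))
        ≈⟨ (Λ-cong p M λ j _ → Λ-linear p M (p M) (λ k → g i j k + p M * g i j (suc k))
              (λ k → g i (suc j) k + p M * g i (suc j) (suc k))) ⟨
      Λ p M (λ j → Λ p M λ k → D i j k) ∎

  -- If W i j = ω^(i - j) + ω^(j - i) for a primitive cube root of unity ω, this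
  -- compares the coefficients of ∏ (1 + x)(1 + ωx)(1 + ω²x) = ∏ (1 + x³), x = p k z.
  Λ₃-cubes : ∀ p (W : ℕ → ℕ → Carrier) →
    (∀ i j → W (suc i) (suc j) ≈ W i j) →
    (∀ i j → W i j + W (suc i) j + W i (suc j) ≈ 0#) →
    ∀ M (h : ℕ → Carrier) → Λ₃ p M (λ i j k → W i j * h (i ℕ.+ j ℕ.+ k))
            ≈ W 0 0 * Λ (λ k → p k * p k * p k) M (λ i → h (i ℕ.* 3))
  Λ₃-cubes p W diagonal sum≈0 zero h = begin
    Λ₃ p 0 (λ i j k → W i j * h (i ℕ.+ j ℕ.+ k))
      ≈⟨ trans (Λ-zero p λ i → Λ p 0 λ j → Λ p 0 λ k → T i j k)
           (trans (Λ-zero p λ j → Λ p 0 λ k → T 0 j k) (Λ-zero p (T 0 0))) ⟩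
    W 0 0 * h 0
      ≈⟨ *-congˡ (Λ-zero (λ k → p k * p k * p k) (λ i → h (i ℕ.* 3))) ⟨
    W 0 0 * Λ (λ k → p k * p k * p k) 0 (λ i → h (i ℕ.* 3)) ∎
    where
    T : ℕ → ℕ → ℕ → Carrier
    T i j k = W i j * h (i ℕ.+ j ℕ.+ k)
  Λ₃-cubes p W diagonal sum≈0 (suc M) h = begin
    Λ₃ p (suc M) (T h)
      ≈⟨ trans (Λ₃-suc p M (T h)) (Λ₃-cong p M pointwise) ⟩
    Λ₃ p M (λ i j k → T h i j k + y³ * T (h ∘ (3 ℕ.+_)) i j k)
      ≈⟨ Λ₃-linear p M y³ (T h) (T (h ∘ (3 ℕ.+_))) ⟩
    Λ₃ p M (T h) + y³ * Λ₃ p M (T (h ∘ (3 ℕ.+_)))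
      ≈⟨ +-cong (Λ₃-cubes p W diagonal sum≈0 M h)
           (*-congˡ (Λ₃-cubes p W diagonal sum≈0 M (h ∘ (3 ℕ.+_)))) ⟩
    W 0 0 * Λ p³ M h₃ + y³ * (W 0 0 * Λ p³ M (h₃ ∘ suc))
      ≈⟨ factor (W 0 0) (Λ p³ M h₃) y³ (Λ p³ M (h₃ ∘ suc)) ⟩
    W 0 0 * (Λ p³ M h₃ + y³ * Λ p³ M (h₃ ∘ suc))
      ≈⟨ *-congˡ (trans (Λ-suc p³ M h₃) (Λ-linear p³ M y³ h₃ (h₃ ∘ suc))) ⟨
    W 0 0 * Λ p³ (suc M) h₃ ∎
    where
    y y³ : Carrier
    y = p M
    y³ = y * y * y
    p³ h₃ : ℕ → Carrier
    p³ k = p k * p k * p k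
    h₃ i = h (i ℕ.* 3)
    T : (ℕ → Carrier) → ℕ → ℕ → ℕ → Carrier
    T h i j k = W i j * h (i ℕ.+ j ℕ.+ k)
    factor : ∀ w a z b → w * a + z * (w * b) ≈ w * (a + z * b)
    factor = solve 4 (λ w a z b → w :* a :+ z :* (w :* b) := w :* (a :+ z :* b)) refl
    -- The terms in y and y² each collect all three weights `w`, `w₁`, `w₂`, whose sum is zero; only
    -- 1 and y³ keep a contribution.
    expand : ∀ y w w₁ w₂ h₀ h₁ h₂ h₃ →
      ((w * h₀ + y * (w * h₁)) + y * (w₂ * h₁ + y * (w₂ * h₂)))
      + y * ((w₁ * h₁ + y * (w₁ * h₂)) + y * (w * h₂ + y * (w * h₃)))
      ≈ (w * h₀ + y * y * y * (w * h₃)) + (y * h₁ + y * y * h₂) * (w + w₁ + w₂)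
    expand = solve 8 (λ y w w₁ w₂ h₀ h₁ h₂ h₃ → ((w :* h₀ :+ y :* (w :* h₁)) :+ y :* (w₂ :* h₁ :+ y :* (w₂ :* h₂))) :+ y :* ((w₁ :* h₁ :+ y :* (w₁ :* h₂)) :+ y :* (w :* h₂ :+ y :* (w :* h₃))) := (w :* h₀ :+ y :* y :* y :* (w :* h₃)) :+ (y :* h₁ :+ y :* y :* h₂) :* (w :+ w₁ :+ w₂)) refl
    pointwise : ∀ i j k → extend₃ y (T h) i j k ≈ T h i j k + y³ * T (h ∘ (3 ℕ.+_)) i j k
    pointwise i j k rewrite ℕ.+-suc i j | ℕ.+-suc (i ℕ.+ j) k = begin
      ((w * h₀ + y * (w * h₁)) + y * (w₂ * h₁ + y * (w₂ * h₂)))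
        + y * ((w₁ * h₁ + y * (w₁ * h₂)) + y * (W (suc i) (suc j) * h₂ + y * (W (suc i) (suc j) * h₃′)))
        ≈⟨ +-congˡ (*-congˡ (+-congˡ (*-congˡ (+-cong (*-congʳ (diagonal i j))
             (*-congˡ (*-congʳ (diagonal i j))))))) ⟩
      ((w * h₀ + y * (w * h₁)) + y * (w₂ * h₁ + y * (w₂ * h₂)))
        + y * ((w₁ * h₁ + y * (w₁ * h₂)) + y * (w * h₂ + y * (w * h₃′)))
        ≈⟨ expand y w w₁ w₂ h₀ h₁ h₂ h₃′ ⟩
      (w * h₀ + y³ * (w * h₃′)) + (y * h₁ + y * y * h₂) * (w + w₁ + w₂)
        ≈⟨ trans (+-congˡ (trans (*-congˡ (sum≈0 i j)) (zeroʳ (y * h₁ + y * y * h₂))))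
             (+-identityʳ (w * h₀ + y³ * (w * h₃′))) ⟩
      w * h₀ + y³ * (w * h₃′) ∎
      where
      w w₁ w₂ h₀ h₁ h₂ h₃′ : Carrier
      w = W i j
      w₁ = W (suc i) j
      w₂ = W i (suc j)
      h₀ = h (i ℕ.+ j ℕ.+ k)
      h₁ = h (suc (i ℕ.+ j ℕ.+ k))
      h₂ = h (suc (suc (i ℕ.+ j ℕ.+ k)))
      h₃′ = h (suc (suc (suc (i ℕ.+ j ℕ.+ k))))

  -- Homogeneous in `x` and `y` because the triple product needs z = -q^(-A), a negative power of q:
  -- taking `x` = q^A and `y` = -1 clears the denominator.
  Λ-∏ : ∀ p x y M → Λ p M (λ i → x ^ (M ∸ i) * y ^ i) ≈ ∏ M (λ k → x + p k * y)
  Λ-∏ p x y zero    = trans (Λ-zero p λ i → x ^ (0 ∸ i) * y ^ i) (*-identityˡ 1#)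
  Λ-∏ p x y (suc M) = begin
    Λ p (suc M) (λ i → x ^ (suc M ∸ i) * y ^ i)
      ≈⟨ Λ-suc p M (λ i → x ^ (suc M ∸ i) * y ^ i) ⟩
    Λ p M (λ i → x ^ (suc M ∸ i) * y ^ i + p M * (x ^ (M ∸ i) * (y * y ^ i)))
      ≈⟨ Λ-cong p M (λ i i≤M → trans (+-congʳ (*-congʳ (reflexive (≡.cong (x ^_) (ℕ.+-∸-assoc 1 i≤M)))))
           (factor x (x ^ (M ∸ i)) (y ^ i) (p M) y)) ⟩
    Λ p M (λ i → (x + p M * y) * (x ^ (M ∸ i) * y ^ i))
      ≈⟨ Λ-* p M (x + p M * y) (λ i → x ^ (M ∸ i) * y ^ i) ⟩
    (x + p M * y) * Λ p M (λ i → x ^ (M ∸ i) * y ^ i)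
      ≈⟨ *-congˡ (Λ-∏ p x y M) ⟩
    (x + p M * y) * ∏ M (λ k → x + p k * y) ∎
    where
    factor : ∀ x a b q y → x * a * b + q * (a * (y * b)) ≈ (x + q * y) * (a * b)
    factor = solve 5 (λ x a b q y → x :* a :* b :+ q :* (a :* (y :* b)) := (x :+ q :* y) :* (a :* b)) refl

  -- The identity behind the q-Pascal rule; with `v` = `w` it also factors 1 - v² as (1 + v)(1 - v).
  telescope : ∀ v w → (1# - v) + v * (1# - w) ≈ 1# - v * w
  telescope v w = begin
    (1# - v) + v * (1# - w)          ≈⟨ +-congˡ (distribˡ v 1# (- w)) ⟩
    (1# - v) + (v * 1# + v * - w)
      ≈⟨ +-congˡ (+-cong (*-identityʳ v) (sym (-‿distribʳ-* v w))) ⟩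
    (1# - v) + (v - v * w)           ≈⟨ +-assoc (1# - v) v (- (v * w)) ⟨
    (1# - v) + v - v * w
      ≈⟨ +-congʳ (trans (+-assoc 1# (- v) v) (trans (+-congˡ (-‿inverseˡ v)) (+-identityʳ 1#))) ⟩
    1# - v * w                       ∎

  -- With p k = xᵏ, this is the q-binomial formula for elem p (i + k) i.
  elem-geometric : ∀ (p P t : ℕ → Carrier) →
    (∀ m n → p (m ℕ.+ n) ≈ p m * p n) →
    P 0 ≈ 1# → (∀ n → P (suc n) ≈ (1# - p (suc n)) * P n) →
    t 0 ≈ 1# → (∀ i → t (suc i) ≈ p i * t i) →
    ∀ M i k → M ≡ i ℕ.+ k → elem p M i * (P i * P k) ≈ t i * P M
  elem-geometric p P t p₊ P₀ Pₛ t₀ tₛ = go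
    where
    go : ∀ M i k → M ≡ i ℕ.+ k → elem p M i * (P i * P k) ≈ t i * P M
    go M zero M ≡.refl = begin
      1# * (P 0 * P M)  ≈⟨ *-identityˡ (P 0 * P M) ⟩
      P 0 * P M         ≈⟨ *-congʳ (trans P₀ (sym t₀)) ⟩
      t 0 * P M         ∎
    go (suc M) (suc i) zero M≡i+0 with ≡.trans (ℕ.suc-injective M≡i+0) (ℕ.+-identityʳ i)
    ... | ≡.refl = begin
      (elem p M (suc M) + p M * elem p M M) * (P (suc M) * P 0)
        ≈⟨ *-congʳ (trans (+-congʳ (elem-zero p {M} ℕ.≤-refl)) (+-identityˡ (p M * elem p M M))) ⟩
      p M * elem p M M * (P (suc M) * P 0)
        ≈⟨ *-congˡ (*-congʳ (Pₛ M)) ⟩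
      p M * elem p M M * ((1# - p (suc M)) * P M * P 0)
        ≈⟨ solve 5 (λ a e d P P₀ → a :* e :* (d :* P :* P₀) := a :* d :* (e :* (P :* P₀))) refl
             (p M) (elem p M M) (1# - p (suc M)) (P M) (P 0) ⟩
      p M * (1# - p (suc M)) * (elem p M M * (P M * P 0))
        ≈⟨ *-congˡ (go M M 0 (≡.sym (ℕ.+-identityʳ M))) ⟩
      p M * (1# - p (suc M)) * (t M * P M)
        ≈⟨ solve 4 (λ a d t P → a :* d :* (t :* P) := a :* t :* (d :* P)) refl
             (p M) (1# - p (suc M)) (t M) (P M) ⟩
      p M * t M * ((1# - p (suc M)) * P M)
        ≈⟨ *-cong (tₛ M) (Pₛ M) ⟨
      t (suc M) * P (suc M) ∎
    -- Each term of the Pascal recursion uses one induction hypothesis after its surplus factor `dₖ`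
    -- or `dᵢ` has been split off. Since `p M` is `p i * p (suc k)`, the surplus factors telescope
    -- to 1 - `p (suc M)`.
    go (suc M) (suc i) (suc k) M≡i+k = begin
      (e + p M * e′) * (P (suc i) * P (suc k))
        ≈⟨ distribʳ (P (suc i) * P (suc k)) e (p M * e′) ⟩
      e * (P (suc i) * P (suc k)) + p M * e′ * (P (suc i) * P (suc k))
        ≈⟨ +-cong (*-congˡ (*-congˡ (Pₛ k))) (*-congˡ (*-congʳ (Pₛ i))) ⟩
      e * (P (suc i) * (dₖ * P k)) + p M * e′ * (dᵢ * P i * P (suc k))
        ≈⟨ solve 9 (λ a Q d R c b e S T →
                a :* (Q :* (d :* R)) :+ c :* b :* (e :* S :* T)
                := d :* (a :* (Q :* R)) :+ c :* e :* (b :* (S :* T))) refl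
             e (P (suc i)) dₖ (P k) (p M) e′ dᵢ (P i) (P (suc k)) ⟩
      dₖ * (e * (P (suc i) * P k)) + p M * dᵢ * (e′ * (P i * P (suc k)))
        ≈⟨ +-cong (*-congˡ (trans (go M (suc i) k M≡1+i+k) (*-congʳ (tₛ i))))
             (*-cong (*-congʳ (trans (reflexive (≡.cong p M≡i+1+k)) (p₊ i (suc k))))
               (go M i (suc k) M≡i+1+k)) ⟩
      dₖ * (p i * t i * P M) + p i * p (suc k) * dᵢ * (t i * P M)
        ≈⟨ solve 6 (λ d q t P r e → d :* (q :* t :* P) :+ q :* r :* e :* (t :* P)
                := q :* t :* ((d :+ r :* e) :* P)) refl
             dₖ (p i) (t i) (P M) (p (suc k)) dᵢ ⟩
      p i * t i * ((dₖ + p (suc k) * dᵢ) * P M)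
        ≈⟨ *-congˡ (*-congʳ (trans (telescope (p (suc k)) (p (suc i)))
             (+-congˡ (-‿cong (trans (sym (p₊ (suc k) (suc i)))
               (reflexive (≡.cong p (≡.trans (ℕ.+-comm (suc k) (suc i)) (≡.sym M≡i+k))))))))) ⟩
      p i * t i * ((1# - p (suc M)) * P M)
        ≈⟨ *-cong (tₛ i) (Pₛ M) ⟨
      t (suc i) * P (suc M) ∎
      where
      e e′ dₖ dᵢ : Carrier
      e  = elem p M (suc i)
      e′ = elem p M i
      dₖ = 1# - p (suc k)
      dᵢ = 1# - p (suc i)
      M≡i+1+k : M ≡ i ℕ.+ suc k
      M≡i+1+k = ℕ.suc-injective M≡i+k
      M≡1+i+k : M ≡ suc i ℕ.+ k
      M≡1+i+k = ≡.trans M≡i+1+k (ℕ.+-suc i k)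

open import Algebra.Properties.Semiring.Sum ℤ.+-*-semiring using (sum; sum-cong-≗)
open import Data.Integer.Base using (_+_; _*_; -_; _-_)
open ≡ using (refl; sym; trans; cong; cong₂; subst; subst₂; module ≡-Reasoning)
module ℕS = ℕ-Solver.+-*-Solver

-- The ring of formal power series.

infixl 6 _⊞_
infixr 8 _⊡_

_⊞_ : Series → Series → Series
(s ⊞ t) n = s n + t n

0ˢ : Series
0ˢ _ = 0ℤ

_⊡_ : ℤ → Series → Series
(k ⊡ s) n = k * s n

⊛-cong : ∀ {s s′ t t′} → s ≗ s′ → t ≗ t′ → s ⊛ t ≗ s′ ⊛ t′
⊛-cong s≗s′ t≗t′ n =
  sum-cong-≗ {suc n} (λ i → cong₂ _*_ (s≗s′ (toℕ i)) (t≗t′ (n ∸ toℕ i)))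

⊛-distribʳ : ∀ u s t → (s ⊞ t) ⊛ u ≗ (s ⊛ u) ⊞ (t ⊛ u)
⊛-distribʳ u s t zero    = lemma (s 0) (t 0) (u 0)
  where
  lemma : ∀ x y z → (x + y) * z + 0ℤ ≡ (x * z + 0ℤ) + (y * z + 0ℤ)
  lemma = ℤ-solve-∀
⊛-distribʳ u s t (suc n) = trans
  (cong (_+_ ((s 0 + t 0) * u (suc n))) (⊛-distribʳ u (s ∘ suc) (t ∘ suc) n))
  (lemma (s 0) (t 0) (u (suc n)) (((s ∘ suc) ⊛ u) n) (((t ∘ suc) ⊛ u) n))
  where
  lemma : ∀ x y z v w → (x + y) * z + (v + w) ≡ (x * z + v) + (y * z + w)
  lemma = ℤ-solve-∀

⊡-⊛ : ∀ k s t → (k ⊡ s) ⊛ t ≗ k ⊡ (s ⊛ t)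
⊡-⊛ k s t zero    = lemma k (s 0) (t 0)
  where
  lemma : ∀ k x y → (k * x) * y + 0ℤ ≡ k * (x * y + 0ℤ)
  lemma = ℤ-solve-∀
⊡-⊛ k s t (suc n) = trans
  (cong (_+_ (k * s 0 * t (suc n))) (⊡-⊛ k (s ∘ suc) t n))
  (lemma k (s 0) (t (suc n)) (((s ∘ suc) ⊛ t) n))
  where
  lemma : ∀ k x y z → (k * x) * y + k * z ≡ k * (x * y + z)
  lemma = ℤ-solve-∀

⊛-assoc : ∀ s t u → (s ⊛ t) ⊛ u ≗ s ⊛ (t ⊛ u)
⊛-assoc s t u zero    = lemma (s 0) (t 0) (u 0)
  where
  lemma : ∀ x y z → (x * y + 0ℤ) * z + 0ℤ ≡ x * (y * z + 0ℤ) + 0ℤ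
  lemma = ℤ-solve-∀
⊛-assoc s t u (suc n) = begin
  (s 0 * t 0 + 0ℤ) * u (suc n) + (((s 0 ⊡ (t ∘ suc)) ⊞ ((s ∘ suc) ⊛ t)) ⊛ u) n
    ≡⟨ cong₂ _+_ (cong (_* u (suc n)) (ℤ.+-identityʳ (s 0 * t 0)))
         (⊛-distribʳ u (s 0 ⊡ (t ∘ suc)) ((s ∘ suc) ⊛ t) n) ⟩
  s 0 * t 0 * u (suc n) + (((s 0 ⊡ (t ∘ suc)) ⊛ u) n + (((s ∘ suc) ⊛ t) ⊛ u) n)
    ≡⟨ cong (_+_ (s 0 * t 0 * u (suc n)))
         (cong₂ _+_ (⊡-⊛ (s 0) (t ∘ suc) u n) (⊛-assoc (s ∘ suc) t u n)) ⟩
  s 0 * t 0 * u (suc n) + (s 0 * ((t ∘ suc) ⊛ u) n + ((s ∘ suc) ⊛ (t ⊛ u)) n)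
    ≡⟨ lemma (s 0) (t 0) (u (suc n)) (((t ∘ suc) ⊛ u) n) (((s ∘ suc) ⊛ (t ⊛ u)) n) ⟩
  s 0 * (t 0 * u (suc n) + ((t ∘ suc) ⊛ u) n) + ((s ∘ suc) ⊛ (t ⊛ u)) n ∎
  where
  open ≡-Reasoning
  lemma : ∀ x y z v w → x * y * z + (x * v + w) ≡ x * (y * z + v) + w
  lemma = ℤ-solve-∀

-- Convolution computes by splitting off its first term; commutativity needs the last one split off
-- as well.
⊛-suc : ∀ s t n → (s ⊛ t) (suc n) ≡ s (suc n) * t 0 + (s ⊛ (t ∘ suc)) n
⊛-suc s t zero    = lemma (s 0 * t 1) (s 1 * t 0)
  where
  lemma : ∀ x y → x + (y + 0ℤ) ≡ y + (x + 0ℤ)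
  lemma = ℤ-solve-∀
⊛-suc s t (suc n) = trans
  (cong (_+_ (s 0 * t (suc (suc n)))) (⊛-suc (s ∘ suc) t n))
  (lemma (s 0 * t (suc (suc n))) (s (suc (suc n)) * t 0) (((s ∘ suc) ⊛ (t ∘ suc)) n))
  where
  lemma : ∀ x y z → x + (y + z) ≡ y + (x + z)
  lemma = ℤ-solve-∀

⊛-comm : ∀ s t → s ⊛ t ≗ t ⊛ s
⊛-comm s t zero    = cong (_+ 0ℤ) (ℤ.*-comm (s 0) (t 0))
⊛-comm s t (suc n) = trans (⊛-suc s t n)
  (cong₂ _+_ (ℤ.*-comm (s (suc n)) (t 0)) (⊛-comm s (t ∘ suc) n))

0ˢ-⊛ : ∀ s → 0ˢ ⊛ s ≗ 0ˢ
0ˢ-⊛ s zero    = refl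
0ˢ-⊛ s (suc n) = trans (ℤ.+-identityˡ ((0ˢ ⊛ s) n)) (0ˢ-⊛ s n)

one-⊛ : ∀ s → one ⊛ s ≗ s
one-⊛ s zero    = trans (ℤ.+-identityʳ (1ℤ * s 0)) (ℤ.*-identityˡ (s 0))
one-⊛ s (suc n) = trans (cong₂ _+_ (ℤ.*-identityˡ (s (suc n))) (0ˢ-⊛ s n))
  (ℤ.+-identityʳ (s (suc n)))

infix 4 _≐_
infixl 6 _⊕_
infixl 7 _·_
infixr 8 _•_ ⊝_

record _≐_ (s t : Series) : Set where
  constructor pointwise
  field
    at : s ≗ t

open _≐_

-- The ring operations are opaque because unification would otherwise
-- η-expand series and compare convolutions coefficientwise.
opaque
  _⊕_ _·_ : Series → Series → Series
  _⊕_ = _⊞_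
  _·_ = _⊛_

  ⊝_ : Series → Series
  (⊝ s) n = - s n

  _•_ : ℤ → Series → Series
  _•_ = _⊡_

  ⊕-at : ∀ s t n → (s ⊕ t) n ≡ s n + t n
  ⊕-at s t n = refl

  ⊝-at : ∀ s n → (⊝ s) n ≡ - s n
  ⊝-at s n = refl

  •-at : ∀ k s n → (k • s) n ≡ k * s n
  •-at k s n = refl

  ·-⊛ : ∀ s t → s · t ≐ s ⊛ t
  ·-⊛ s t = pointwise λ _ → refl

  •-· : ∀ k s t → (k • s) · t ≐ k • (s · t)
  •-· k s t = pointwise (⊡-⊛ k s t)

  ⊕-·-isCommutativeRing : IsCommutativeRing _≐_ _⊕_ _·_ ⊝_ 0ˢ one
  ⊕-·-isCommutativeRing = record
    { isRing = record
      { +-isAbelianGroup = record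
        { isGroup = record
          { isMonoid = record
            { isSemigroup = record
              { isMagma = record
                { isEquivalence = record
                  { refl  = pointwise λ _ → refl
                  ; sym   = λ p → pointwise λ n → sym (at p n)
                  ; trans = λ p r → pointwise λ n → trans (at p n) (at r n)
                  }
                ; ∙-cong = λ p r → pointwise λ n → cong₂ _+_ (at p n) (at r n)
                }
              ; assoc = λ s t u → pointwise λ n → ℤ.+-assoc (s n) (t n) (u n)
              }
            ; identity = (λ s → pointwise λ n → ℤ.+-identityˡ (s n))
                       , (λ s → pointwise λ n → ℤ.+-identityʳ (s n))
            }
          ; inverse = (λ s → pointwise λ n → ℤ.+-inverseˡ (s n))
                    , (λ s → pointwise λ n → ℤ.+-inverseʳ (s n))
          ; ⁻¹-cong = λ p → pointwise λ n → cong -_ (at p n)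
          }
        ; comm = λ s t → pointwise λ n → ℤ.+-comm (s n) (t n)
        }
      ; *-cong     = λ p r → pointwise (⊛-cong (at p) (at r))
      ; *-assoc    = λ s t u → pointwise (⊛-assoc s t u)
      ; *-identity = (λ s → pointwise (one-⊛ s))
                   , (λ s → pointwise λ n → trans (⊛-comm s one n) (one-⊛ s n))
      ; distrib    =
          (λ u s t → pointwise λ n → trans (⊛-comm u (s ⊞ t) n) (trans (⊛-distribʳ u s t n)
            (cong₂ _+_ (⊛-comm s u n) (⊛-comm t u n))))
        , (λ u s t → pointwise (⊛-distribʳ u s t))
      }
    ; *-comm = λ s t → pointwise (⊛-comm s t)
    }

seriesRing : CommutativeRing 0ℓ 0ℓ
seriesRing = record { isCommutativeRing = ⊕-·-isCommutativeRing }

module S = CommutativeRing seriesRing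
open import Algebra.Properties.Ring S.ring using (-1*x≈-x; -‿involutive; -0#≈0#; -‿distribˡ-*)
open import Algebra.Properties.Semiring.Exp S.semiring using (_^_; ^-homo-*)
open import Algebra.Solver.Ring.NaturalCoefficients.Default S.commutativeSemiring using (solve; _:=_; _:+_; _:*_; con)
import Relation.Binary.Reasoning.Setoid S.setoid as S-Reasoning
open ElementarySymmetric seriesRing

q^-refl : ∀ m → (q^ m) m ≡ 1ℤ
q^-refl m with m ℕ.≟ m
... | yes _  = refl
... | no m≢m = contradiction refl m≢m

q^-suc : ∀ m → (q^ suc m) ∘ suc ≗ q^ m
q^-suc m n with m ℕ.≟ n
... | yes refl = q^-refl (suc m)
... | no  m≢n  = q^-≢ (m≢n ∘ ℕ.suc-injective)

q^-⊛-suc : ∀ m s → ((q^ suc m) ⊛ s) ∘ suc ≗ (q^ m) ⊛ s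
q^-⊛-suc m s n = trans (ℤ.+-identityˡ (((q^ suc m) ∘ suc ⊛ s) n))
  (⊛-cong {t = s} (q^-suc m) (λ _ → refl) n)

opaque
  unfolding _·_

  q^-·-+ : ∀ m s n → ((q^ m) · s) (m ℕ.+ n) ≡ s n
  q^-·-+ zero    s n = one-⊛ s n
  q^-·-+ (suc m) s n = trans (q^-⊛-suc m s (m ℕ.+ n)) (q^-·-+ m s n)

  q^-·-< : ∀ {m n} s → n ℕ.< m → ((q^ m) · s) n ≡ 0ℤ
  q^-·-< {suc m} {zero}  s _         = refl
  q^-·-< {suc m} {suc n} s (s≤s n<m) = trans (q^-⊛-suc m s n) (q^-·-< s n<m)

  q^-+ : ∀ m n → q^ (m ℕ.+ n) ≐ (q^ m) · (q^ n)
  q^-+ m n = pointwise (go m)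
    where
    go : ∀ m → q^ (m ℕ.+ n) ≗ (q^ m) ⊛ (q^ n)
    go zero    k       = sym (one-⊛ (q^ n) k)
    go (suc m) zero    = refl
    go (suc m) (suc k) = trans (q^-suc (m ℕ.+ n) k)
      (trans (go m k) (sym (q^-⊛-suc m (q^ n) k)))

-- Agreement of series up to a power of q.

infix 4 _≈[_]_

-- Congruence modulo q^N.
record _≈[_]_ (s : Series) (N : ℕ) (t : Series) : Set where
  constructor below
  field
    at< : ∀ n → n ℕ.< N → s n ≡ t n

open _≈[_]_

≐⇒≈ : ∀ {N s t} → s ≐ t → s ≈[ N ] t
≐⇒≈ s≐t = below λ n _ → at s≐t n

≈-refl : ∀ {N s} → s ≈[ N ] s
≈-refl = below λ _ _ → refl

≈-sym : ∀ {N s t} → s ≈[ N ] t → t ≈[ N ] s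
≈-sym s≈t = below λ n n<N → sym (at< s≈t n n<N)

≈-trans : ∀ {N s t u} → s ≈[ N ] t → t ≈[ N ] u → s ≈[ N ] u
≈-trans s≈t t≈u = below λ n n<N → trans (at< s≈t n n<N) (at< t≈u n n<N)

≈-weaken : ∀ {M N s t} → M ℕ.≤ N → s ≈[ N ] t → s ≈[ M ] t
≈-weaken M≤N s≈t = below λ n n<M → at< s≈t n (ℕ.<-≤-trans n<M M≤N)

opaque
  unfolding _·_

  ·-≈ : ∀ {N s s′ t t′} → s ≈[ N ] s′ → t ≈[ N ] t′ → s · t ≈[ N ] s′ · t′
  ·-≈ {N} s≈s′ t≈t′ = below λ n n<N →
    go n (λ i i≤n → at< s≈s′ i (ℕ.<-≤-trans i≤n n<N)) (λ i i≤n → at< t≈t′ i (ℕ.<-≤-trans i≤n n<N))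
    where
    go : ∀ {s s′ t t′} n → (∀ i → i ℕ.< suc n → s i ≡ s′ i) → (∀ i → i ℕ.< suc n → t i ≡ t′ i) →
         (s ⊛ t) n ≡ (s′ ⊛ t′) n
    go zero    p r = cong (_+ 0ℤ) (cong₂ _*_ (p 0 (s≤s z≤n)) (r 0 (s≤s z≤n)))
    go {s} {s′} {t} {t′} (suc n) p r = cong₂ _+_
      (cong₂ _*_ (p 0 (s≤s z≤n)) (r (suc n) ℕ.≤-refl))
      (go {s ∘ suc} {s′ ∘ suc} {t} {t′} n (λ i i≤n → p (suc i) (s≤s i≤n))
        (λ i i≤n → r i (ℕ.m<n⇒m<1+n i≤n)))

  ·-₀ : ∀ {s t} → s 0 ≡ 1ℤ → t 0 ≡ 1ℤ → (s · t) 0 ≡ 1ℤ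
  ·-₀ s₀ t₀ = cong (_+ 0ℤ) (cong₂ _*_ s₀ t₀)

  recip-inverse : ∀ {s} → s 0 ≡ 1ℤ → s · recip s ≐ one
  recip-inverse {s} s₀≡1 = pointwise (⊛-recip s s₀≡1)

-- Evaluate `recip s · (s · t)` in two ways: an inverse modulo q^N is determined modulo q^N.
recip-≈ : ∀ {N s t} → s 0 ≡ 1ℤ → s · t ≈[ N ] one → recip s ≈[ N ] t
recip-≈ {N} {s} {t} s₀≡1 st≈1 =
  ≈-trans (≐⇒≈ (S.sym (S.*-identityʳ (recip s))))
  (≈-trans (·-≈ ≈-refl (≈-sym st≈1))
  (≐⇒≈ (S.trans (solve 3 (λ r s t → r :* (s :* t) := s :* r :* t) S.refl (recip s) s t)
    (S.trans (S.*-congʳ (recip-inverse s₀≡1)) (S.*-identityˡ t)))))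

recip-unique : ∀ {s t} → s 0 ≡ 1ℤ → s · t ≐ one → recip s ≐ t
recip-unique s₀≡1 st≐1 = pointwise λ n → at< (recip-≈ s₀≡1 (≐⇒≈ st≐1)) n (ℕ.n<1+n n)

recip-· : ∀ {s t} → s 0 ≡ 1ℤ → t 0 ≡ 1ℤ → recip (s · t) ≐ recip s · recip t
recip-· {s} {t} s₀ t₀ = recip-unique (·-₀ {s} {t} s₀ t₀) (begin
  s · t · (recip s · recip t)
    ≈⟨ solve 4 (λ s t a b → s :* t :* (a :* b) := (s :* a) :* (t :* b)) S.refl s t (recip s) (recip t) ⟩
  (s · recip s) · (t · recip t)  ≈⟨ S.*-cong (recip-inverse s₀) (recip-inverse t₀) ⟩
  one · one                      ≈⟨ S.*-identityˡ one ⟩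
  one                            ∎)
  where open S-Reasoning

opaque
  unfolding _·_

  ⊕-≈ : ∀ {N s s′ t t′} → s ≈[ N ] s′ → t ≈[ N ] t′ → s ⊕ t ≈[ N ] s′ ⊕ t′
  ⊕-≈ s≈s′ t≈t′ = below λ n n<N → cong₂ _+_ (at< s≈s′ n n<N) (at< t≈t′ n n<N)

-- A monomial factor raises the precision by its degree. This is what allows crude approximations in
-- terms of large exponent.
q^-·-≈ : ∀ w {K s t} → s ≈[ K ] t → (q^ w) · s ≈[ w ℕ.+ K ] (q^ w) · t
q^-·-≈ w {K} {s} {t} s≈t = below go
  where
  go : ∀ n → n ℕ.< w ℕ.+ K → ((q^ w) · s) n ≡ ((q^ w) · t) n
  go n n<w+K with n ℕ.<? w
  ... | yes n<w = trans (q^-·-< s n<w) (sym (q^-·-< t n<w))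
  ... | no  n≮w with ℕ.m≤n⇒∃[o]m+o≡n (ℕ.≮⇒≥ n≮w)
  ... | k , refl = trans (q^-·-+ w s k)
    (trans (at< s≈t k (ℕ.+-cancelˡ-< w k K n<w+K)) (sym (q^-·-+ w t k)))

q^-cancel-≈ : ∀ w {K s t} → (q^ w) · s ≈[ w ℕ.+ K ] (q^ w) · t → s ≈[ K ] t
q^-cancel-≈ w {K} {s} {t} p = below λ n n<K → trans (sym (q^-·-+ w s n))
  (trans (at< p (w ℕ.+ n) (ℕ.+-monoʳ-< w n<K)) (q^-·-+ w t n))

-- tri m = m (m - 1) / 2.
tri : ℕ → ℕ
tri zero    = zero
tri (suc i) = i ℕ.+ tri i

q^-cong : ∀ {m n} → m ≡ n → q^ m ≐ q^ n
q^-cong refl = S.refl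

⊖-≐ : ∀ s t → s ⊖ t ≐ s ⊕ ⊝ t
⊖-≐ s t = pointwise λ n → sym (trans (⊕-at s (⊝ t) n) (cong (_+_ (s n)) (⊝-at t n)))

-- The Jacobi triple product

q^[_*] : ℕ → ℕ → Series
q^[ c *] k = q^ (c ℕ.* k)

partialProduct-₀ : ∀ c .{{_ : NonZero c}} n → partialProduct c n 0 ≡ 1ℤ
partialProduct-₀ c n = partialProduct-stable c {0} {n} z≤n

partialProduct-suc : ∀ c n →
  partialProduct c (suc n) ≐ (one ⊕ ⊝ (q^ (c ℕ.* suc n))) · partialProduct c n
partialProduct-suc c n = S.trans (S.sym (·-⊛ (one ⊖ (q^ (c ℕ.* suc n))) (partialProduct c n)))
  (S.*-congʳ (⊖-≐ one (q^ (c ℕ.* suc n))))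

-- f c times the q-binomial coefficient (i + k choose i) in the variable q^c.
binomialUnit : (c : ℕ) .{{_ : NonZero c}} → ℕ → ℕ → Series
binomialUnit c i k =
  (partialProduct c (i ℕ.+ k) · f c) · (recip (partialProduct c i) · recip (partialProduct c k))

-- The (i + k)-th partial product differs from the i-th only by factors 1 - q^(cl) with l > i, and
-- `f c` from the k-th one only by factors with l > k; so the unit is 1 up to degree min(i, k).
binomialUnit-≈ : ∀ c .{{_ : NonZero c}} {K} i k → K ℕ.≤ suc i → K ℕ.≤ suc k →
                 binomialUnit c i k ≈[ K ] one
binomialUnit-≈ c i k K≤1+i K≤1+k = ≈-trans
  (·-≈ (·-≈ (below λ n n<K → stable n (i ℕ.+ k) i (ℕ.≤-trans (n≤ n<K K≤1+i) (ℕ.m≤m+n i k)) (n≤ n<K K≤1+i))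
            (below λ n n<K → sym (partialProduct-stable c (n≤ n<K K≤1+k))))
       ≈-refl)
  (≐⇒≈ (S.trans
    (solve 4 (λ a b x y → (a :* b) :* (x :* y) := (a :* x) :* (b :* y)) S.refl
      (partialProduct c i) (partialProduct c k) (recip (partialProduct c i)) (recip (partialProduct c k)))
    (S.trans (S.*-cong (recip-inverse (partialProduct-₀ c i)) (recip-inverse (partialProduct-₀ c k)))
      (S.*-identityˡ one))))
  where
  n≤ : ∀ {n K i} → n ℕ.< K → K ℕ.≤ suc i → n ℕ.≤ i
  n≤ n<K K≤1+i = ℕ.s≤s⁻¹ (ℕ.≤-trans n<K K≤1+i)
  stable : ∀ n K L → n ℕ.≤ K → n ℕ.≤ L → partialProduct c K n ≡ partialProduct c L n
  stable n K L n≤K n≤L = trans (partialProduct-stable c n≤K) (sym (partialProduct-stable c n≤L))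

-- The q-binomial theorem. The coefficient (i + k choose i) tends to 1/`f c`, so the factor `f c`
-- leaves a monomial times a series that tends to one.
f-elem : ∀ c .{{_ : NonZero c}} {M} i k → M ≡ i ℕ.+ k →
         f c · elem q^[ c *] M i ≐ (q^ (c ℕ.* tri i)) · binomialUnit c i k
f-elem c {M} i k refl = begin
  f c · elem q^[ c *] M i
    ≈⟨ S.trans (S.*-congˡ (S.sym (S.*-identityʳ e))) (S.*-congˡ (S.*-congˡ (S.sym
         (S.trans (S.*-cong (recip-inverse (partialProduct-₀ c i)) (recip-inverse (partialProduct-₀ c k)))
           (S.*-identityˡ one))))) ⟩
  f c · (e · ((P i · recip (P i)) · (P k · recip (P k))))
    ≈⟨ solve 6 (λ f e a x b y → f :* (e :* ((a :* x) :* (b :* y))) := (e :* (a :* b)) :* (f :* (x :* y)))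
         S.refl (f c) e (P i) (recip (P i)) (P k) (recip (P k)) ⟩
  (e · (P i · P k)) · (f c · (recip (P i) · recip (P k)))
    ≈⟨ S.*-congʳ (elem-geometric q^[ c *] P (λ i → q^ (c ℕ.* tri i))
         (λ m n → S.trans (q^-cong (ℕ.*-distribˡ-+ c m n)) (q^-+ (c ℕ.* m) (c ℕ.* n)))
         S.refl (partialProduct-suc c)
         (q^-cong (ℕ.*-zeroʳ c))
         (λ i → S.trans (q^-cong (ℕ.*-distribˡ-+ c i (tri i))) (q^-+ (c ℕ.* i) (c ℕ.* tri i)))
         M i k refl) ⟩
  ((q^ (c ℕ.* tri i)) · P M) · (f c · (recip (P i) · recip (P k)))
    ≈⟨ solve 4 (λ t p f r → (t :* p) :* (f :* r) := t :* ((p :* f) :* r)) S.refl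
         (q^ (c ℕ.* tri i)) (P M) (f c) (recip (P i) · recip (P k)) ⟩
  (q^ (c ℕ.* tri i)) · binomialUnit c i k ∎
  where
  open S-Reasoning
  e : Series
  e = elem q^[ c *] M i
  P : ℕ → Series
  P = partialProduct c

q^-^ : ∀ m n → (q^ m) ^ n ≐ q^ (m ℕ.* n)
q^-^ m zero    = q^-cong (sym (ℕ.*-zeroʳ m))
q^-^ m (suc n) = S.trans (S.*-congˡ (q^-^ m n))
  (S.trans (S.sym (q^-+ m (m ℕ.* n))) (q^-cong (sym (ℕ.*-suc m n))))

∏-const : ∀ n s → ∏ n (λ _ → s) ≐ s ^ n
∏-const zero    s = S.refl
∏-const (suc n) s = S.*-congˡ (∏-const n s)

∏-q^ : ∀ c n → ∏ n q^[ c *] ≐ q^ (c ℕ.* tri n)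
∏-q^ c zero    = q^-cong (sym (ℕ.*-zeroʳ c))
∏-q^ c (suc n) = S.trans (S.*-congˡ (∏-q^ c n))
  (S.trans (S.sym (q^-+ (c ℕ.* n) (c ℕ.* tri n))) (q^-cong (sym (ℕ.*-distribˡ-+ c n (tri n)))))

∑-≈ : ∀ n {N g h} → (∀ i → i ℕ.< n → g i ≈[ N ] h i) → ∑ n g ≈[ N ] ∑ n h
∑-≈ zero    g≈h = ≈-refl
∑-≈ (suc n) g≈h = ⊕-≈ (g≈h 0 (s≤s z≤n)) (∑-≈ n λ i i<n → g≈h (suc i) (s≤s i<n))

q^-·-≈-one : ∀ w {K N u} → u ≈[ K ] one → N ℕ.≤ w ℕ.+ K → (q^ w) · u ≈[ N ] q^ w
q^-·-≈-one w u≈1 N≤w+K = ≈-trans (≈-weaken N≤w+K (q^-·-≈ w u≈1)) (≐⇒≈ (S.*-identityʳ (q^ w)))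

-1ˢ : Series
-1ˢ = ⊝ one

-1ˢ-square : -1ˢ · -1ˢ ≐ one
-1ˢ-square = S.trans (-1*x≈-x (⊝ one)) (-‿involutive one)

-1ˢ-^-square : ∀ n → (-1ˢ ^ n) · (-1ˢ ^ n) ≐ one
-1ˢ-^-square zero    = S.*-identityˡ one
-1ˢ-^-square (suc n) = S.trans
  (solve 2 (λ a b → (a :* b) :* (a :* b) := (a :* a) :* (b :* b)) S.refl -1ˢ (-1ˢ ^ n))
  (S.trans (S.*-cong -1ˢ-square (-1ˢ-^-square n)) (S.*-identityˡ one))

finitePoch : ℕ → ℕ → ℕ → Series
finitePoch a c K = ∏ K λ k → one ⊕ ⊝ (q^ (a ℕ.+ c ℕ.* k))

halfThetaTerm : ℕ → ℕ → ℕ → Series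
halfThetaTerm c a m = (-1ˢ ^ m) · (q^ (c ℕ.* tri m ℕ.+ a ℕ.* m))

halfTheta : ℕ → ℕ → ℕ → Series
halfTheta c a N = ∑ N (halfThetaTerm c a)

-- Up to a monomial, q^A - q^{ck} is 1 - q^{a+c(s-1-k)} for k < s and
-- 1 - q^{b+c(k-s)} for k ≥ s.
module FiniteTripleProduct (a b c s′ : ℕ) .{{_ : NonZero a}} .{{_ : NonZero b}} .{{_ : NonZero c}}
                           (c≡a+b : c ≡ a ℕ.+ b) where

  -- A is c s - b; taking `s` to be a successor avoids the truncated subtraction. The degree `w₀` is
  -- that of the monomial released by the factors: c (s-1-k) from each of the low ones, A from each
  -- of the high ones.
  s A w₀ : ℕ
  s  = suc s′
  A  = c ℕ.* s′ ℕ.+ a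
  w₀ = c ℕ.* tri s ℕ.+ A ℕ.* s

  A+b≡cs : A ℕ.+ b ≡ c ℕ.* s
  A+b≡cs = begin
    c ℕ.* s′ ℕ.+ a ℕ.+ b    ≡⟨ ℕ.+-assoc (c ℕ.* s′) a b ⟩
    c ℕ.* s′ ℕ.+ (a ℕ.+ b)  ≡⟨ cong (c ℕ.* s′ ℕ.+_) c≡a+b ⟨
    c ℕ.* s′ ℕ.+ c          ≡⟨ ℕ.+-comm (c ℕ.* s′) c ⟩
    c ℕ.+ c ℕ.* s′          ≡⟨ ℕ.*-suc c s′ ⟨
    c ℕ.* s                 ∎
    where open ≡-Reasoning

  -[_] : Series → Series
  -[ t ] = one ⊕ ⊝ t

  factor-high : ∀ l → (q^ A) ⊕ q^[ c *] (s ℕ.+ l) · -1ˢ ≐ (q^ A) · -[ q^ (b ℕ.+ c ℕ.* l) ]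
  factor-high l = begin
    (q^ A) ⊕ q^[ c *] (s ℕ.+ l) · -1ˢ
      ≈⟨ S.+-congˡ (S.*-congʳ (S.trans (q^-cong exponent) (q^-+ A (b ℕ.+ c ℕ.* l)))) ⟩
    (q^ A) ⊕ (q^ A) · (q^ (b ℕ.+ c ℕ.* l)) · -1ˢ
      ≈⟨ solve 3 (λ x z y → x :+ x :* z :* y := x :* (con 1 :+ y :* z)) S.refl
           (q^ A) (q^ (b ℕ.+ c ℕ.* l)) -1ˢ ⟩
    (q^ A) · (one ⊕ -1ˢ · (q^ (b ℕ.+ c ℕ.* l)))
      ≈⟨ S.*-congˡ (S.+-congˡ (-1*x≈-x (q^ (b ℕ.+ c ℕ.* l)))) ⟩
    (q^ A) · -[ q^ (b ℕ.+ c ℕ.* l) ] ∎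
    where
    open S-Reasoning
    exponent : c ℕ.* (s ℕ.+ l) ≡ A ℕ.+ (b ℕ.+ c ℕ.* l)
    exponent = trans (ℕ.*-distribˡ-+ c s l)
      (trans (cong (ℕ._+ c ℕ.* l) (sym A+b≡cs)) (ℕ.+-assoc A b (c ℕ.* l)))

  factor-low : ∀ k → k ℕ.< s → (q^ A) ⊕ q^[ c *] (s ∸ suc k) · -1ˢ
                               ≐ (q^[ c *] (s ∸ suc k) · -1ˢ) · -[ q^ (a ℕ.+ c ℕ.* k) ]
  factor-low k k<s = begin
    (q^ A) ⊕ Q · -1ˢ
      ≈⟨ S.+-congʳ (S.trans (q^-cong exponent) (q^-+ (c ℕ.* (s ∸ suc k)) (a ℕ.+ c ℕ.* k))) ⟩
    Q · Z ⊕ Q · -1ˢ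
      ≈⟨ S.+-congʳ (S.trans (S.sym (S.*-identityʳ (Q · Z))) (S.*-congˡ (S.sym -1ˢ-square))) ⟩
    Q · Z · (-1ˢ · -1ˢ) ⊕ Q · -1ˢ
      ≈⟨ solve 3 (λ x z y → x :* z :* (y :* y) :+ x :* y := x :* y :* (con 1 :+ y :* z)) S.refl Q Z -1ˢ ⟩
    Q · -1ˢ · (one ⊕ -1ˢ · Z)
      ≈⟨ S.*-congˡ (S.+-congˡ (-1*x≈-x Z)) ⟩
    (Q · -1ˢ) · -[ Z ] ∎
    where
    open S-Reasoning
    Q Z : Series
    Q = q^[ c *] (s ∸ suc k)
    Z = q^ (a ℕ.+ c ℕ.* k)
    exponent : A ≡ c ℕ.* (s′ ∸ k) ℕ.+ (a ℕ.+ c ℕ.* k)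
    exponent = trans (cong (λ m → c ℕ.* m ℕ.+ a) (sym (ℕ.m∸n+n≡m (ℕ.s≤s⁻¹ k<s))))
      (ℕS.solve 4 (λ c m k a → c ℕS.:* (m ℕS.:+ k) ℕS.:+ a ℕS.:= c ℕS.:* m ℕS.:+ (a ℕS.:+ c ℕS.:* k))
        refl c (s′ ∸ k) k a)

  product : ∏ (s ℕ.+ s) (λ k → (q^ A) ⊕ q^[ c *] k · -1ˢ)
            ≐ ((-1ˢ ^ s) · (q^ w₀)) · (finitePoch a c s · finitePoch b c s)
  product = begin
    ∏ (s ℕ.+ s) (λ k → (q^ A) ⊕ q^[ c *] k · -1ˢ)
      ≈⟨ ∏-+ s s (λ k → (q^ A) ⊕ q^[ c *] k · -1ˢ) ⟩
    ∏ s (λ k → (q^ A) ⊕ q^[ c *] k · -1ˢ) · ∏ s (λ k → (q^ A) ⊕ q^[ c *] (s ℕ.+ k) · -1ˢ)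
      ≈⟨ S.*-cong low high ⟩
    (((q^ (c ℕ.* tri s)) · (-1ˢ ^ s)) · finitePoch a c s) · ((q^ (A ℕ.* s)) · finitePoch b c s)
      ≈⟨ solve 5 (λ x y u z v → ((x :* y) :* u) :* (z :* v) := (y :* (x :* z)) :* (u :* v)) S.refl
           (q^ (c ℕ.* tri s)) (-1ˢ ^ s) (finitePoch a c s) (q^ (A ℕ.* s)) (finitePoch b c s) ⟩
    ((-1ˢ ^ s) · ((q^ (c ℕ.* tri s)) · (q^ (A ℕ.* s)))) · (finitePoch a c s · finitePoch b c s)
      ≈⟨ S.*-congʳ (S.*-congˡ (q^-+ (c ℕ.* tri s) (A ℕ.* s))) ⟨
    ((-1ˢ ^ s) · (q^ w₀)) · (finitePoch a c s · finitePoch b c s) ∎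
    where
    open S-Reasoning
    high : ∏ s (λ k → (q^ A) ⊕ q^[ c *] (s ℕ.+ k) · -1ˢ) ≐ (q^ (A ℕ.* s)) · finitePoch b c s
    high = begin
      ∏ s (λ k → (q^ A) ⊕ q^[ c *] (s ℕ.+ k) · -1ˢ)
        ≈⟨ ∏-cong s (λ k _ → factor-high k) ⟩
      ∏ s (λ k → (q^ A) · -[ q^ (b ℕ.+ c ℕ.* k) ])
        ≈⟨ ∏-* s (λ _ → q^ A) (λ k → -[ q^ (b ℕ.+ c ℕ.* k) ]) ⟩
      ∏ s (λ _ → q^ A) · finitePoch b c s
        ≈⟨ S.*-congʳ (S.trans (∏-const s (q^ A)) (q^-^ A s)) ⟩
      (q^ (A ℕ.* s)) · finitePoch b c s ∎
    low : ∏ s (λ k → (q^ A) ⊕ q^[ c *] k · -1ˢ) ≐ ((q^ (c ℕ.* tri s)) · (-1ˢ ^ s)) · finitePoch a c s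
    low = begin
      ∏ s (λ k → (q^ A) ⊕ q^[ c *] k · -1ˢ)
        ≈⟨ ∏-reverse s (λ k → (q^ A) ⊕ q^[ c *] k · -1ˢ) ⟩
      ∏ s (λ k → (q^ A) ⊕ q^[ c *] (s ∸ suc k) · -1ˢ)
        ≈⟨ ∏-cong s factor-low ⟩
      ∏ s (λ k → (q^[ c *] (s ∸ suc k) · -1ˢ) · -[ q^ (a ℕ.+ c ℕ.* k) ])
        ≈⟨ ∏-* s (λ k → q^[ c *] (s ∸ suc k) · -1ˢ) (λ k → -[ q^ (a ℕ.+ c ℕ.* k) ]) ⟩
      ∏ s (λ k → q^[ c *] (s ∸ suc k) · -1ˢ) · finitePoch a c s
        ≈⟨ S.*-congʳ (S.trans (∏-* s (λ k → q^[ c *] (s ∸ suc k)) (λ _ → -1ˢ))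
             (S.*-cong (S.trans (S.sym (∏-reverse s q^[ c *])) (∏-q^ c s)) (∏-const s -1ˢ))) ⟩
      ((q^ (c ℕ.* tri s)) · (-1ˢ ^ s)) · finitePoch a c s ∎

tri-+ : ∀ m n → tri (m ℕ.+ n) ≡ tri m ℕ.+ m ℕ.* n ℕ.+ tri n
tri-+ zero    n = refl
tri-+ (suc m) n rewrite tri-+ m n =
  ℕS.solve 4 (λ m n s t → m ℕS.:+ n ℕS.:+ (s ℕS.:+ m ℕS.:* n ℕS.:+ t)
                          ℕS.:= m ℕS.:+ s ℕS.:+ (n ℕS.:+ m ℕS.:* n) ℕS.:+ t) refl m n (tri m) (tri n)

tri-double : ∀ m → tri (suc m) ℕ.+ tri (suc m) ≡ suc m ℕ.* m
tri-double zero    = refl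
tri-double (suc m) = trans
  (ℕS.solve 2 (λ m t → (ℕS.con 1 ℕS.:+ m ℕS.:+ t) ℕS.:+ (ℕS.con 1 ℕS.:+ m ℕS.:+ t)
                       ℕS.:= ℕS.con 2 ℕS.:+ m ℕS.:+ m ℕS.:+ (t ℕS.:+ t)) refl m (tri (suc m)))
  (trans (cong ((2 ℕ.+ m ℕ.+ m) ℕ.+_) (tri-double m))
    (ℕS.solve 1 (λ m → ℕS.con 2 ℕS.:+ m ℕS.:+ m ℕS.:+ (m ℕS.:+ m ℕS.:* m)
                       ℕS.:= (ℕS.con 2 ℕS.:+ m) ℕS.:* (ℕS.con 1 ℕS.:+ m)) refl m))

q^-≈-0 : ∀ m → q^ m ≈[ m ] 0ˢ
q^-≈-0 m = below λ n n<m → q^-≢ (λ { refl → ℕ.<-irrefl refl n<m })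

opaque
  unfolding _·_

  ⊝-≈ : ∀ {N s t} → s ≈[ N ] t → ⊝ s ≈[ N ] ⊝ t
  ⊝-≈ s≈t = below λ n n<N → cong -_ (at< s≈t n n<N)

1-q^-≈-1 : ∀ m → one ⊕ ⊝ (q^ m) ≈[ m ] one
1-q^-≈-1 m = ≈-trans (⊕-≈ ≈-refl (⊝-≈ (q^-≈-0 m)))
  (≐⇒≈ (S.trans (S.+-congˡ -0#≈0#) (S.+-identityʳ one)))

-- (q^a; q^c)_∞: when a and c are positive, the factors with k ≥ n do not affect
-- the coefficient of qⁿ.
poch : ℕ → ℕ → Series
poch a c n = finitePoch a c n n

finitePoch-stable : ∀ a c .{{_ : NonZero a}} .{{_ : NonZero c}} {n K} → n ℕ.≤ K →
                    finitePoch a c K n ≡ poch a c n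
finitePoch-stable a c {n} n≤K = go (ℕ.≤⇒≤′ n≤K)
  where
  go : ∀ {K} → n ℕ.≤′ K → finitePoch a c K n ≡ poch a c n
  go (ℕ.≤′-reflexive refl) = refl
  go (ℕ.≤′-step {K} n≤′K)  = trans
    (at< (≈-trans (·-≈ (1-q^-≈-1 (a ℕ.+ c ℕ.* K)) ≈-refl) (≐⇒≈ (S.*-identityˡ (finitePoch a c K)))) n
      (ℕ.≤-trans (s≤s (ℕ.≤′⇒≤ n≤′K))
        (ℕ.+-mono-≤ (ℕ.>-nonZero⁻¹ a) (ℕ.m≤n*m K c))))
    (go n≤′K)

finitePoch-≈ : ∀ a c .{{_ : NonZero a}} .{{_ : NonZero c}} K → finitePoch a c K ≈[ suc K ] poch a c
finitePoch-≈ a c K = below λ n n<1+K → finitePoch-stable a c (ℕ.s≤s⁻¹ n<1+K)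

module TripleProduct (a b c s′ : ℕ) .{{_ : NonZero a}} .{{_ : NonZero b}} .{{_ : NonZero c}}
                     (c≡a+b : c ≡ a ℕ.+ b) where
  open FiniteTripleProduct a b c s′ c≡a+b

  term : ℕ → Series
  term i = (f c · elem q^[ c *] (s ℕ.+ s) i) · ((q^ A) ^ (s ℕ.+ s ∸ i) · (-1ˢ ^ i))

  -- The unit in the i-th term is exact through degree min(i, k), so the term is exact through
  -- degree w + min(i, k).
  term-≈ : ∀ {N w} i k → s ℕ.+ s ≡ i ℕ.+ k → c ℕ.* tri i ℕ.+ A ℕ.* k ≡ w →
           N ℕ.≤ w ℕ.+ i → N ℕ.≤ w ℕ.+ k → term i ≈[ N ] (-1ˢ ^ i) · (q^ w)
  term-≈ {N} {w} i k 2s≡i+k refl N≤w+i N≤w+k = ≈-trans (≐⇒≈ (begin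
    (f c · elem q^[ c *] (s ℕ.+ s) i) · ((q^ A) ^ (s ℕ.+ s ∸ i) · (-1ˢ ^ i))
      ≈⟨ S.*-cong (f-elem c i k 2s≡i+k) (S.*-congʳ (S.trans
           (S.reflexive (cong ((q^ A) ^_) (trans (cong (_∸ i) 2s≡i+k) (ℕ.m+n∸m≡n i k)))) (q^-^ A k))) ⟩
    ((q^ (c ℕ.* tri i)) · u) · ((q^ (A ℕ.* k)) · (-1ˢ ^ i))
      ≈⟨ solve 4 (λ x u z y → (x :* u) :* (z :* y) := y :* ((x :* z) :* u)) S.refl
           (q^ (c ℕ.* tri i)) u (q^ (A ℕ.* k)) (-1ˢ ^ i) ⟩
    (-1ˢ ^ i) · (((q^ (c ℕ.* tri i)) · (q^ (A ℕ.* k))) · u)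
      ≈⟨ S.*-congˡ (S.*-congʳ (q^-+ (c ℕ.* tri i) (A ℕ.* k))) ⟨
    (-1ˢ ^ i) · ((q^ w) · u) ∎))
    (·-≈ ≈-refl (q^-·-≈-one w
      (binomialUnit-≈ c i k (K≤ i N≤w+i) (K≤ k N≤w+k)) (ℕ.m≤n+m∸n N w)))
    where
    open S-Reasoning
    u : Series
    u = binomialUnit c i k
    K≤ : ∀ i → N ℕ.≤ w ℕ.+ i → N ∸ w ℕ.≤ suc i
    K≤ i N≤w+i = ℕ.m≤n⇒m≤1+n (ℕ.m≤n+o⇒m∸n≤o N w N≤w+i)

  scale : Series
  scale = (-1ˢ ^ s) · (q^ w₀)

  N : ℕ
  N = w₀ ℕ.+ s

  rescale : ∀ {i m h} → (-1ˢ ^ i) ≐ (-1ˢ ^ s) · (-1ˢ ^ m) →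
            (-1ˢ ^ i) · (q^ (w₀ ℕ.+ h)) ≐ scale · ((-1ˢ ^ m) · (q^ h))
  rescale {i} {m} {h} sign = S.trans (S.*-cong sign (q^-+ w₀ h))
    (solve 4 (λ y z w h → (y :* z) :* (w :* h) := (y :* w) :* (z :* h)) S.refl
      (-1ˢ ^ s) (-1ˢ ^ m) (q^ w₀) (q^ h))

  -- At distance m from the centre the smaller of the two indices is only r = s - m, but the
  -- exponent exceeds `w₀` by e, which is at least m, and the loss is made good.
  bound : ∀ e m r → m ℕ.≤ e → s ℕ.≤ m ℕ.+ r → N ℕ.≤ w₀ ℕ.+ e ℕ.+ r
  bound e m r m≤e s≤m+r = ℕ.≤-trans (ℕ.+-monoʳ-≤ w₀ (ℕ.≤-trans s≤m+r (ℕ.+-monoˡ-≤ r m≤e)))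
    (ℕ.≤-reflexive (sym (ℕ.+-assoc w₀ e r)))

  m≤exponent : ∀ d .{{_ : NonZero d}} m → m ℕ.≤ c ℕ.* tri m ℕ.+ d ℕ.* m
  m≤exponent d m = ℕ.≤-trans (ℕ.m≤n*m m d) (ℕ.m≤n+m (d ℕ.* m) (c ℕ.* tri m))

  -- Index s is the centre of the bilateral sum: the indices s + m produce the half with b, and
  -- below, the indices s - m with m > 0 the half with a.
  term-high : ∀ m → m ℕ.≤ s → term (s ℕ.+ m) ≈[ N ] scale · halfThetaTerm c b m
  term-high m m≤s with ℕ.m≤n⇒∃[o]m+o≡n m≤s
  ... | r , m+r≡s = ≈-trans
    (term-≈ (s ℕ.+ m) r (trans (cong (s ℕ.+_) (sym m+r≡s)) (sym (ℕ.+-assoc s m r))) exponent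
      (bound (c ℕ.* tri m ℕ.+ b ℕ.* m) m (s ℕ.+ m) (m≤exponent b m)
        (ℕ.≤-trans (ℕ.m≤m+n s m) (ℕ.m≤n+m (s ℕ.+ m) m)))
      (bound (c ℕ.* tri m ℕ.+ b ℕ.* m) m r (m≤exponent b m) (ℕ.≤-reflexive (sym m+r≡s))))
    (≐⇒≈ (rescale {s ℕ.+ m} {m} (^-homo-* -1ˢ s m)))
    where
    exponent : c ℕ.* tri (s ℕ.+ m) ℕ.+ A ℕ.* r ≡ w₀ ℕ.+ (c ℕ.* tri m ℕ.+ b ℕ.* m)
    exponent = begin
      c ℕ.* tri (s ℕ.+ m) ℕ.+ A ℕ.* r
        ≡⟨ cong (λ t → c ℕ.* t ℕ.+ A ℕ.* r) (tri-+ s m) ⟩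
      c ℕ.* (tri s ℕ.+ s ℕ.* m ℕ.+ tri m) ℕ.+ A ℕ.* r
        ≡⟨ ℕS.solve 7 (λ c t s m u A r → c ℕS.:* (t ℕS.:+ s ℕS.:* m ℕS.:+ u) ℕS.:+ A ℕS.:* r
             ℕS.:= c ℕS.:* t ℕS.:+ A ℕS.:* r ℕS.:+ c ℕS.:* u ℕS.:+ (c ℕS.:* s) ℕS.:* m)
             refl c (tri s) s m (tri m) A r ⟩
      c ℕ.* tri s ℕ.+ A ℕ.* r ℕ.+ c ℕ.* tri m ℕ.+ (c ℕ.* s) ℕ.* m
        ≡⟨ cong (λ x → c ℕ.* tri s ℕ.+ A ℕ.* r ℕ.+ c ℕ.* tri m ℕ.+ x ℕ.* m) A+b≡cs ⟨
      c ℕ.* tri s ℕ.+ A ℕ.* r ℕ.+ c ℕ.* tri m ℕ.+ (A ℕ.+ b) ℕ.* m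
        ≡⟨ ℕS.solve 6 (λ ct m u A r b → ct ℕS.:+ A ℕS.:* r ℕS.:+ u ℕS.:+ (A ℕS.:+ b) ℕS.:* m
             ℕS.:= ct ℕS.:+ A ℕS.:* (m ℕS.:+ r) ℕS.:+ (u ℕS.:+ b ℕS.:* m))
             refl (c ℕ.* tri s) m (c ℕ.* tri m) A r b ⟩
      c ℕ.* tri s ℕ.+ A ℕ.* (m ℕ.+ r) ℕ.+ (c ℕ.* tri m ℕ.+ b ℕ.* m)
        ≡⟨ cong (λ x → c ℕ.* tri s ℕ.+ A ℕ.* x ℕ.+ (c ℕ.* tri m ℕ.+ b ℕ.* m)) m+r≡s ⟩
      w₀ ℕ.+ (c ℕ.* tri m ℕ.+ b ℕ.* m) ∎
      where open ≡-Reasoning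

  term-low : ∀ m → m ℕ.< s → term (s ∸ suc m) ≈[ N ] scale · halfThetaTerm c a (suc m)
  term-low m m<s = ≈-trans
    (term-≈ r (s ℕ.+ suc m)
      (trans (cong (ℕ._+ s) (sym r+m≡s)) (trans (ℕ.+-assoc r (suc m) s) (cong (r ℕ.+_) (ℕ.+-comm (suc m) s))))
      exponent
      (bound e (suc m) r (m≤exponent a (suc m)) (ℕ.≤-reflexive (trans (sym r+m≡s) (ℕ.+-comm r (suc m)))))
      (bound e (suc m) (s ℕ.+ suc m) (m≤exponent a (suc m))
        (ℕ.≤-trans (ℕ.m≤m+n s (suc m)) (ℕ.m≤n+m (s ℕ.+ suc m) (suc m)))))
    (≐⇒≈ (rescale {r} {suc m} sign))
    where
    r e : ℕ
    r = s ∸ suc m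
    e = c ℕ.* tri (suc m) ℕ.+ a ℕ.* suc m
    r+m≡s : r ℕ.+ suc m ≡ s
    r+m≡s = ℕ.m∸n+n≡m m<s
    sign : (-1ˢ ^ r) ≐ (-1ˢ ^ s) · (-1ˢ ^ suc m)
    sign = begin
      -1ˢ ^ r                                         ≈⟨ S.*-identityʳ (-1ˢ ^ r) ⟨
      (-1ˢ ^ r) · one                                 ≈⟨ S.*-congˡ (-1ˢ-^-square (suc m)) ⟨
      (-1ˢ ^ r) · ((-1ˢ ^ suc m) · (-1ˢ ^ suc m))
        ≈⟨ S.*-assoc (-1ˢ ^ r) (-1ˢ ^ suc m) (-1ˢ ^ suc m) ⟨
      ((-1ˢ ^ r) · (-1ˢ ^ suc m)) · (-1ˢ ^ suc m)
        ≈⟨ S.*-congʳ (S.trans (S.sym (^-homo-* -1ˢ r (suc m))) (S.reflexive (cong (-1ˢ ^_) r+m≡s))) ⟩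
      (-1ˢ ^ s) · (-1ˢ ^ suc m) ∎
      where open S-Reasoning
    r+m≡s′ : r ℕ.+ m ≡ s′
    r+m≡s′ = ℕ.suc-injective (trans (sym (ℕ.+-suc r m)) r+m≡s)
    exponent : c ℕ.* tri r ℕ.+ A ℕ.* (s ℕ.+ suc m) ≡ w₀ ℕ.+ e
    exponent = begin
      c ℕ.* tri r ℕ.+ A ℕ.* (s ℕ.+ suc m)
        ≡⟨ trans (cong (c ℕ.* tri r ℕ.+_) (ℕ.*-distribˡ-+ A s (suc m)))
             (cong (λ x → c ℕ.* tri r ℕ.+ (A ℕ.* s ℕ.+ (c ℕ.* x ℕ.+ a) ℕ.* suc m)) (sym r+m≡s′)) ⟩
      c ℕ.* tri r ℕ.+ (A ℕ.* s ℕ.+ (c ℕ.* (r ℕ.+ m) ℕ.+ a) ℕ.* suc m)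
        ≡⟨ ℕS.solve 6 (λ c t As r m a →
             c ℕS.:* t ℕS.:+ (As ℕS.:+ (c ℕS.:* (r ℕS.:+ m) ℕS.:+ a) ℕS.:* (ℕS.con 1 ℕS.:+ m))
             ℕS.:= c ℕS.:* (t ℕS.:+ r ℕS.:* (ℕS.con 1 ℕS.:+ m)) ℕS.:+ As ℕS.:+ c ℕS.:* ((ℕS.con 1 ℕS.:+ m) ℕS.:* m)
                   ℕS.:+ a ℕS.:* (ℕS.con 1 ℕS.:+ m))
             refl c (tri r) (A ℕ.* s) r m a ⟩
      c ℕ.* (tri r ℕ.+ r ℕ.* suc m) ℕ.+ A ℕ.* s ℕ.+ c ℕ.* (suc m ℕ.* m) ℕ.+ a ℕ.* suc m
        ≡⟨ cong (λ x → c ℕ.* (tri r ℕ.+ r ℕ.* suc m) ℕ.+ A ℕ.* s ℕ.+ c ℕ.* x ℕ.+ a ℕ.* suc m) (tri-double m) ⟨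
      c ℕ.* (tri r ℕ.+ r ℕ.* suc m) ℕ.+ A ℕ.* s ℕ.+ c ℕ.* (tri (suc m) ℕ.+ tri (suc m)) ℕ.+ a ℕ.* suc m
        ≡⟨ ℕS.solve 5 (λ c x t As am →
             c ℕS.:* x ℕS.:+ As ℕS.:+ c ℕS.:* (t ℕS.:+ t) ℕS.:+ am
             ℕS.:= c ℕS.:* (x ℕS.:+ t) ℕS.:+ As ℕS.:+ (c ℕS.:* t ℕS.:+ am))
             refl c (tri r ℕ.+ r ℕ.* suc m) (tri (suc m)) (A ℕ.* s) (a ℕ.* suc m) ⟩
      c ℕ.* (tri r ℕ.+ r ℕ.* suc m ℕ.+ tri (suc m)) ℕ.+ A ℕ.* s ℕ.+ e
        ≡⟨ cong (λ x → c ℕ.* x ℕ.+ A ℕ.* s ℕ.+ e) (trans (sym (tri-+ r (suc m))) (cong tri r+m≡s)) ⟩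
      w₀ ℕ.+ e ∎
      where open ≡-Reasoning

  expansion : scale · (f c · (finitePoch a c s · finitePoch b c s))
              ≐ ∑ s term ⊕ ∑ (suc s) (λ m → term (s ℕ.+ m))
  expansion = begin
    scale · (f c · (finitePoch a c s · finitePoch b c s))
      ≈⟨ solve 3 (λ x y z → x :* (y :* z) := y :* (x :* z)) S.refl
           scale (f c) (finitePoch a c s · finitePoch b c s) ⟩
    f c · (scale · (finitePoch a c s · finitePoch b c s))
      ≈⟨ S.*-congˡ (S.sym (S.trans (Λ-∏ q^[ c *] (q^ A) -1ˢ (s ℕ.+ s)) product)) ⟩
    f c · Λ q^[ c *] (s ℕ.+ s) g
      ≈⟨ *-distribˡ-∑ (suc (s ℕ.+ s)) (f c) (λ i → elem q^[ c *] (s ℕ.+ s) i · g i) ⟩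
    ∑ (suc (s ℕ.+ s)) (λ i → f c · (elem q^[ c *] (s ℕ.+ s) i · g i))
      ≈⟨ ∑-cong (suc (s ℕ.+ s)) (λ i _ → S.sym (S.*-assoc (f c) (elem q^[ c *] (s ℕ.+ s) i) (g i))) ⟩
    ∑ (suc (s ℕ.+ s)) term
      ≡⟨ cong (λ n → ∑ n term) (ℕ.+-suc s s) ⟨
    ∑ (s ℕ.+ suc s) term
      ≈⟨ ∑-+ s (suc s) term ⟩
    ∑ s term ⊕ ∑ (suc s) (λ m → term (s ℕ.+ m)) ∎
    where
    open S-Reasoning
    g : ℕ → Series
    g i = (q^ A) ^ (s ℕ.+ s ∸ i) · (-1ˢ ^ i)

  -- The right side is the sum over all integers m of (-1)^m q^(c m(m-1)/2 + b m), folded at 0: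
  -- replacing m by -m turns b into c - b = a.
  jacobiTripleProduct : f c · (poch a c · poch b c)
                        ≈[ s ] ∑ s (halfThetaTerm c a ∘ suc) ⊕ halfTheta c b (suc s)
  jacobiTripleProduct = ≈-trans
    (·-≈ ≈-refl (≈-sym (·-≈ (≈-weaken (ℕ.n≤1+n s) (finitePoch-≈ a c s)) (≈-weaken (ℕ.n≤1+n s) (finitePoch-≈ b c s)))))
    (q^-cancel-≈ w₀ (≈-trans (≐⇒≈ (S.sym (unsign lhs))) (≈-trans (·-≈ ≈-refl scaled) (≐⇒≈ (unsign rhs)))))
    where
    lhs rhs : Series
    lhs = f c · (finitePoch a c s · finitePoch b c s)
    rhs = ∑ s (halfThetaTerm c a ∘ suc) ⊕ halfTheta c b (suc s)
    -- The sign (-1)^s is its own inverse, so multiplying by it once more leaves a pure monomial to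
    -- cancel.
    unsign : ∀ t → (-1ˢ ^ s) · (scale · t) ≐ (q^ w₀) · t
    unsign t = S.trans
      (solve 3 (λ y w t → y :* ((y :* w) :* t) := (y :* y) :* (w :* t)) S.refl (-1ˢ ^ s) (q^ w₀) t)
      (S.trans (S.*-congʳ (-1ˢ-^-square s)) (S.*-identityˡ ((q^ w₀) · t)))
    scaled : scale · lhs ≈[ N ] scale · rhs
    scaled = ≈-trans (≐⇒≈ (S.trans expansion (S.+-congʳ (∑-reverse s term))))
      (≈-trans (⊕-≈ (∑-≈ s term-low) (∑-≈ (suc s) λ m m<1+s → term-high m (ℕ.s≤s⁻¹ m<1+s)))
      (≐⇒≈ (S.sym (S.trans
        (S.distribˡ scale (∑ s (halfThetaTerm c a ∘ suc)) (halfTheta c b (suc s)))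
        (S.+-cong (*-distribˡ-∑ s scale (halfThetaTerm c a ∘ suc))
          (*-distribˡ-∑ (suc s) scale (halfThetaTerm c b)))))))

-- Dissection of f₂²/f₄

-- Ramanujan's theta function f(-q^a, -q^b) in product form.
theta : (a b : ℕ) .{{_ : NonZero (a ℕ.+ b)}} → Series
theta a b = f (a ℕ.+ b) · (poch a (a ℕ.+ b) · poch b (a ℕ.+ b))

halfThetaTerm-zero : ∀ c a → halfThetaTerm c a 0 ≐ one
halfThetaTerm-zero c a = S.trans (S.*-identityˡ (q^ (c ℕ.* 0 ℕ.+ a ℕ.* 0)))
  (q^-cong (cong₂ ℕ._+_ (ℕ.*-zeroʳ c) (ℕ.*-zeroʳ a)))

halfTheta-last : ∀ c a .{{_ : NonZero a}} N → halfTheta c a (suc N) ≈[ N ] halfTheta c a N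
halfTheta-last c a N = ≈-trans (≐⇒≈ (∑-last N (halfThetaTerm c a)))
  (≈-trans (⊕-≈ ≈-refl (·-≈ ≈-refl (≈-weaken
      (ℕ.≤-trans (ℕ.m≤n*m N a) (ℕ.m≤n+m (a ℕ.* N) (c ℕ.* tri N)))
      (q^-≈-0 (c ℕ.* tri N ℕ.+ a ℕ.* N)))))
    (≐⇒≈ (S.trans (S.+-congˡ (S.zeroʳ (-1ˢ ^ N))) (S.+-identityʳ (halfTheta c a N)))))

theta-≈ : ∀ a b .{{_ : NonZero a}} .{{_ : NonZero b}} .{{_ : NonZero (a ℕ.+ b)}} s′ → let c = a ℕ.+ b in
  theta a b ≈[ suc s′ ] ∑ (suc s′) (halfThetaTerm c a ∘ suc) ⊕ halfTheta c b (suc s′)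
theta-≈ a b s′ = ≈-trans (TripleProduct.jacobiTripleProduct a b (a ℕ.+ b) s′ refl)
  (⊕-≈ ≈-refl (halfTheta-last (a ℕ.+ b) b (suc s′)))

-- For equal parameters both halves agree except for the central term 1. Adding another 1 gives
-- twice a one-sided sum, whose indices can be sorted modulo 3 within the natural numbers.
1+theta-≈ : ∀ a .{{_ : NonZero a}} .{{_ : NonZero (a ℕ.+ a)}} s′ →
  one ⊕ theta a a ≈[ suc s′ ] halfTheta (a ℕ.+ a) a (suc s′) ⊕ halfTheta (a ℕ.+ a) a (suc s′)
1+theta-≈ a s′ = ≈-trans
  (⊕-≈ ≈-refl (theta-≈ a a s′))
  (≈-trans (≐⇒≈ (S.trans (S.sym (S.+-assoc one (∑ (suc s′) (t ∘ suc)) (halfTheta (a ℕ.+ a) a (suc s′))))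
      (S.+-congʳ (S.+-congʳ (S.sym (halfThetaTerm-zero (a ℕ.+ a) a))))))
    (⊕-≈ (halfTheta-last (a ℕ.+ a) a (suc s′)) ≈-refl))
  where
  t : ℕ → Series
  t = halfThetaTerm (a ℕ.+ a) a

∑-*3 : ∀ n g → ∑ (n ℕ.* 3) g ≐ ∑ n (λ k → g (k ℕ.* 3) ⊕ (g (suc (k ℕ.* 3)) ⊕ g (suc (suc (k ℕ.* 3)))))
∑-*3 zero    g = S.refl
∑-*3 (suc n) g = S.trans
  (S.+-congˡ (S.+-congˡ (S.+-congˡ (∑-*3 n (g ∘ (3 ℕ.+_))))))
  (solve 4 (λ a b c d → a :+ (b :+ (c :+ d)) := (a :+ (b :+ c)) :+ d) S.refl
    (g 0) (g 1) (g 2) (∑ n (λ k → g (3 ℕ.+ k ℕ.* 3) ⊕ (g (4 ℕ.+ k ℕ.* 3) ⊕ g (5 ℕ.+ k ℕ.* 3)))))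

tri-square : ∀ m → tri m ℕ.+ tri m ℕ.+ m ≡ m ℕ.* m
tri-square zero    = refl
tri-square (suc m) = trans (cong (ℕ._+ suc m) (tri-double m))
  (trans (ℕ.+-comm (suc m ℕ.* m) (suc m)) (sym (ℕ.*-suc (suc m) m)))

4tri+2 : ∀ m → 4 ℕ.* tri m ℕ.+ 2 ℕ.* m ≡ 2 ℕ.* (m ℕ.* m)
4tri+2 m = trans
  (ℕS.solve 2 (λ t m → ℕS.con 4 ℕS.:* t ℕS.:+ ℕS.con 2 ℕS.:* m ℕS.:= ℕS.con 2 ℕS.:* (t ℕS.:+ t ℕS.:+ m)) refl (tri m) m)
  (cong (2 ℕ.*_) (tri-square m))

36tri+18 : ∀ k → 36 ℕ.* tri k ℕ.+ 18 ℕ.* k ≡ 18 ℕ.* (k ℕ.* k)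
36tri+18 k = trans
  (ℕS.solve 2 (λ t m → ℕS.con 36 ℕS.:* t ℕS.:+ ℕS.con 18 ℕS.:* m ℕS.:= ℕS.con 18 ℕS.:* (t ℕS.:+ t ℕS.:+ m)) refl (tri k) k)
  (cong (18 ℕ.*_) (tri-square k))

exponent-*3 : ∀ k → 4 ℕ.* tri (k ℕ.* 3) ℕ.+ 2 ℕ.* (k ℕ.* 3) ≡ 36 ℕ.* tri k ℕ.+ 18 ℕ.* k
exponent-*3 k = trans (4tri+2 (k ℕ.* 3)) (trans
  (ℕS.solve 1 (λ k → ℕS.con 2 ℕS.:* ((k ℕS.:* ℕS.con 3) ℕS.:* (k ℕS.:* ℕS.con 3)) ℕS.:= ℕS.con 18 ℕS.:* (k ℕS.:* k)) refl k)
  (sym (36tri+18 k)))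

exponent-1+*3 : ∀ k → 4 ℕ.* tri (suc (k ℕ.* 3)) ℕ.+ 2 ℕ.* suc (k ℕ.* 3) ≡ 2 ℕ.+ (36 ℕ.* tri k ℕ.+ 30 ℕ.* k)
exponent-1+*3 k = trans (4tri+2 (suc (k ℕ.* 3))) (trans
  (ℕS.solve 1 (λ k → ℕS.con 2 ℕS.:* ((ℕS.con 1 ℕS.:+ k ℕS.:* ℕS.con 3) ℕS.:* (ℕS.con 1 ℕS.:+ k ℕS.:* ℕS.con 3))
     ℕS.:= ℕS.con 2 ℕS.:+ (ℕS.con 18 ℕS.:* (k ℕS.:* k) ℕS.:+ ℕS.con 12 ℕS.:* k)) refl k)
  (trans (cong (λ x → 2 ℕ.+ (x ℕ.+ 12 ℕ.* k)) (sym (36tri+18 k)))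
    (ℕS.solve 2 (λ t k → ℕS.con 2 ℕS.:+ (ℕS.con 36 ℕS.:* t ℕS.:+ ℕS.con 18 ℕS.:* k ℕS.:+ ℕS.con 12 ℕS.:* k)
       ℕS.:= ℕS.con 2 ℕS.:+ (ℕS.con 36 ℕS.:* t ℕS.:+ ℕS.con 30 ℕS.:* k)) refl (tri k) k)))

-- Here m = 3(k+1) - 1, so 2m² is 18(k+1)² - 12(k+1) + 2. This is the reflection of m = 3k + 1 and
-- explains `suc k`, as well as 6 = 18 - 12 next to 30 = 18 + 12.
exponent-2+*3 : ∀ k → 4 ℕ.* tri (suc (suc (k ℕ.* 3))) ℕ.+ 2 ℕ.* suc (suc (k ℕ.* 3))
                  ≡ 2 ℕ.+ (36 ℕ.* tri (suc k) ℕ.+ 6 ℕ.* suc k)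
exponent-2+*3 k = trans (4tri+2 (suc (suc (k ℕ.* 3)))) (trans
  (ℕS.solve 1 (λ k → ℕS.con 2 ℕS.:* ((ℕS.con 2 ℕS.:+ k ℕS.:* ℕS.con 3) ℕS.:* (ℕS.con 2 ℕS.:+ k ℕS.:* ℕS.con 3))
     ℕS.:= ℕS.con 2 ℕS.:+ (ℕS.con 18 ℕS.:* (k ℕS.:* k) ℕS.:+ (ℕS.con 24 ℕS.:* k ℕS.:+ ℕS.con 6))) refl k)
  (trans (cong (λ x → 2 ℕ.+ (x ℕ.+ (24 ℕ.* k ℕ.+ 6))) (sym (36tri+18 k)))
    (ℕS.solve 2 (λ t k → ℕS.con 2 ℕS.:+ (ℕS.con 36 ℕS.:* t ℕS.:+ ℕS.con 18 ℕS.:* k ℕS.:+ (ℕS.con 24 ℕS.:* k ℕS.:+ ℕS.con 6))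
       ℕS.:= ℕS.con 2 ℕS.:+ (ℕS.con 36 ℕS.:* (k ℕS.:+ t) ℕS.:+ ℕS.con 6 ℕS.:* (ℕS.con 1 ℕS.:+ k))) refl (tri k) k)))

-1ˢ-^-*3 : ∀ k → -1ˢ ^ (k ℕ.* 3) ≐ -1ˢ ^ k
-1ˢ-^-*3 zero    = S.refl
-1ˢ-^-*3 (suc k) = S.*-congˡ (S.trans (S.sym (S.*-assoc -1ˢ -1ˢ (-1ˢ ^ (k ℕ.* 3))))
  (S.trans (S.*-cong -1ˢ-square (-1ˢ-^-*3 k)) (S.*-identityˡ (-1ˢ ^ k))))

halfThetaTerm-*3 : ∀ k → halfThetaTerm 4 2 (k ℕ.* 3) ≐ halfThetaTerm 36 18 k
halfThetaTerm-*3 k = S.*-cong (-1ˢ-^-*3 k) (q^-cong (exponent-*3 k))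

halfThetaTerm-1+*3 : ∀ k → halfThetaTerm 4 2 (suc (k ℕ.* 3)) ≐ (-1ˢ · (q^ 2)) · halfThetaTerm 36 30 k
halfThetaTerm-1+*3 k = S.trans
  (S.*-cong (S.*-congˡ (-1ˢ-^-*3 k)) (S.trans (q^-cong (exponent-1+*3 k)) (q^-+ 2 (36 ℕ.* tri k ℕ.+ 30 ℕ.* k))))
  (solve 4 (λ y z q e → (y :* z) :* (q :* e) := (y :* q) :* (z :* e)) S.refl
    -1ˢ (-1ˢ ^ k) (q^ 2) (q^ (36 ℕ.* tri k ℕ.+ 30 ℕ.* k)))

halfThetaTerm-2+*3 : ∀ k → halfThetaTerm 4 2 (suc (suc (k ℕ.* 3))) ≐ (-1ˢ · (q^ 2)) · halfThetaTerm 36 6 (suc k)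
halfThetaTerm-2+*3 k = S.trans
  (S.*-cong (S.*-congˡ (S.*-congˡ (-1ˢ-^-*3 k)))
    (S.trans (q^-cong (exponent-2+*3 k)) (q^-+ 2 (36 ℕ.* tri (suc k) ℕ.+ 6 ℕ.* suc k))))
  (solve 4 (λ y z q e → (y :* (y :* z)) :* (q :* e) := (y :* q) :* ((y :* z) :* e)) S.refl
    -1ˢ (-1ˢ ^ k) (q^ 2) (q^ (36 ℕ.* tri (suc k) ℕ.+ 6 ℕ.* suc k)))

-- The residues 1 and 2 are the two halves of one bilateral sum, that of `theta 6 30`; residue 0
-- remains one-sided.
halfTheta-dissection : ∀ L → halfTheta 4 2 (L ℕ.* 3) ≐
  halfTheta 36 18 L ⊕ (-1ˢ · (q^ 2)) · (∑ L (halfThetaTerm 36 6 ∘ suc) ⊕ halfTheta 36 30 L)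
halfTheta-dissection L = begin
  ∑ (L ℕ.* 3) (halfThetaTerm 4 2)
    ≈⟨ ∑-*3 L (halfThetaTerm 4 2) ⟩
  ∑ L (λ k → halfThetaTerm 4 2 (k ℕ.* 3)
    ⊕ (halfThetaTerm 4 2 (suc (k ℕ.* 3)) ⊕ halfThetaTerm 4 2 (suc (suc (k ℕ.* 3)))))
    ≈⟨ ∑-cong L (λ k _ → S.+-cong (halfThetaTerm-*3 k) (S.trans (S.+-cong (halfThetaTerm-1+*3 k) (halfThetaTerm-2+*3 k))
         (S.trans (S.+-comm (z · halfThetaTerm 36 30 k) (z · halfThetaTerm 36 6 (suc k)))
           (S.sym (S.distribˡ z (halfThetaTerm 36 6 (suc k)) (halfThetaTerm 36 30 k)))))) ⟩
  ∑ L (λ k → halfThetaTerm 36 18 k ⊕ z · (halfThetaTerm 36 6 (suc k) ⊕ halfThetaTerm 36 30 k))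
    ≈⟨ ∑-linear L z (halfThetaTerm 36 18) (λ k → halfThetaTerm 36 6 (suc k) ⊕ halfThetaTerm 36 30 k) ⟩
  halfTheta 36 18 L ⊕ z · ∑ L (λ k → halfThetaTerm 36 6 (suc k) ⊕ halfThetaTerm 36 30 k)
    ≈⟨ S.+-congˡ (S.*-congˡ (S.trans
         (∑-cong L λ k _ → S.+-congˡ (S.sym (S.*-identityˡ (halfThetaTerm 36 30 k))))
         (S.trans (∑-linear L one (halfThetaTerm 36 6 ∘ suc) (halfThetaTerm 36 30))
           (S.+-congˡ (S.*-identityˡ (halfTheta 36 30 L)))))) ⟩
  halfTheta 36 18 L ⊕ z · (∑ L (halfThetaTerm 36 6 ∘ suc) ⊕ halfTheta 36 30 L) ∎
  where
  open S-Reasoning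
  z : Series
  z = -1ˢ · (q^ 2)

-- Doubling the one-sided dissection turns residue 0 into 1 + `theta 18 18`, and the 1 cancels
-- against the one on the left; the bilateral part keeps its factor 2.
theta-dissection : theta 2 2 ≐ theta 18 18 ⊕ ⊝ ((q^ 2) · (theta 6 30 ⊕ theta 6 30))
theta-dissection = pointwise λ n → at< (approximate n) n (ℕ.n<1+n n)
  where
  z : Series
  z = -1ˢ · (q^ 2)
  1+theta : ∀ n → one ⊕ theta 2 2 ≈[ suc n ] one ⊕ (theta 18 18 ⊕ z · (theta 6 30 ⊕ theta 6 30))
  1+theta n = ≈-trans
    -- With 2 + 3n the number of terms is 3(n + 1), which splits evenly into three classes.
    (≈-weaken (s≤s (ℕ.≤-trans (ℕ.m≤m*n n 3) (ℕ.m≤n+m (n ℕ.* 3) 2))) (1+theta-≈ 2 (2 ℕ.+ n ℕ.* 3)))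
    (≈-trans (≐⇒≈ (S.trans (S.+-cong (halfTheta-dissection (suc n)) (halfTheta-dissection (suc n)))
        (solve 3 (λ h z t → (h :+ z :* t) :+ (h :+ z :* t) := (h :+ h) :+ z :* (t :+ t)) S.refl
          (halfTheta 36 18 (suc n)) z T)))
    (≈-trans (⊕-≈ (≈-sym (1+theta-≈ 18 n)) (·-≈ ≈-refl (⊕-≈ (≈-sym (theta-≈ 6 30 n)) (≈-sym (theta-≈ 6 30 n)))))
      (≐⇒≈ (S.+-assoc one (theta 18 18) (z · (theta 6 30 ⊕ theta 6 30))))))
    where
    T : Series
    T = ∑ (suc n) (halfThetaTerm 36 6 ∘ suc) ⊕ halfTheta 36 30 (suc n)
  cancel : ∀ t → -1ˢ ⊕ (one ⊕ t) ≐ t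
  cancel t = S.trans (S.sym (S.+-assoc -1ˢ one t)) (S.trans (S.+-congʳ (S.-‿inverseˡ one)) (S.+-identityˡ t))
  approximate : ∀ n → theta 2 2 ≈[ suc n ] theta 18 18 ⊕ ⊝ ((q^ 2) · (theta 6 30 ⊕ theta 6 30))
  approximate n = ≈-trans (≐⇒≈ (S.sym (cancel (theta 2 2))))
    (≈-trans (⊕-≈ ≈-refl (1+theta n))
      (≐⇒≈ (S.trans (cancel (theta 18 18 ⊕ z · (theta 6 30 ⊕ theta 6 30)))
        (S.+-congˡ (S.trans (S.*-assoc -1ˢ (q^ 2) (theta 6 30 ⊕ theta 6 30))
          (-1*x≈-x ((q^ 2) · (theta 6 30 ⊕ theta 6 30))))))))

-- Sign patterns modulo 3

-- What a sign condition needs in order to survive finite sums and multiplication by nonnegative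
-- numbers; all residue classes are then treated alike.
record IsCone (P : ℤ → Set) : Set where
  field
    zero-closed : P 0ℤ
    +-closed    : ∀ {x y} → P x → P y → P (x + y)
    *-closed    : ∀ {x y} → 0ℤ ≤ x → P y → P (x * y)

IsZero NonNegative NonPositive : ℤ → Set
IsZero x = x ≡ 0ℤ
NonNegative x = 0ℤ ≤ x
NonPositive x = x ≤ 0ℤ

isZero-isCone : IsCone IsZero
isZero-isCone = record
  { zero-closed = refl
  ; +-closed    = λ { refl refl → refl }
  ; *-closed    = λ { {x} _ refl → ℤ.*-zeroʳ x }
  }

nonNegative-isCone : IsCone NonNegative
nonNegative-isCone = record
  { zero-closed = ℤ.≤-refl
  ; +-closed    = ℤ.+-mono-≤
  ; *-closed    = λ { {+ m} {+ n} _ _ → subst (0ℤ ≤_) (ℤ.pos-* m n) (+≤+ z≤n) }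
  }

nonPositive-isCone : IsCone NonPositive
nonPositive-isCone = record
  { zero-closed = ℤ.≤-refl
  ; +-closed    = ℤ.+-mono-≤
  ; *-closed    = λ { {+ m} {y} _ y≤0 → subst ((+ m) * y ≤_) (ℤ.*-zeroʳ (+ m)) (ℤ.*-monoˡ-≤-nonNeg (+ m) y≤0) }
  }

-- Recursion in steps of three makes invariance under a shift by 3 hold by computation.
Mod3 : (P₀ P₁ P₂ : ℤ → Set) → ℕ → ℤ → Set
Mod3 P₀ P₁ P₂ 0                   = P₀
Mod3 P₀ P₁ P₂ 1                   = P₁
Mod3 P₀ P₁ P₂ 2                   = P₂
Mod3 P₀ P₁ P₂ (suc (suc (suc n))) = Mod3 P₀ P₁ P₂ n

Mod3-isCone : ∀ {P₀ P₁ P₂} → IsCone P₀ → IsCone P₁ → IsCone P₂ → ∀ n → IsCone (Mod3 P₀ P₁ P₂ n)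
Mod3-isCone c₀ c₁ c₂ 0                   = c₀
Mod3-isCone c₀ c₁ c₂ 1                   = c₁
Mod3-isCone c₀ c₁ c₂ 2                   = c₂
Mod3-isCone c₀ c₁ c₂ (suc (suc (suc n))) = Mod3-isCone c₀ c₁ c₂ n

SignPattern : ℕ → ℤ → Set
SignPattern = Mod3 NonNegative IsZero NonPositive

signPattern-isCone : ∀ n → IsCone (SignPattern n)
signPattern-isCone = Mod3-isCone nonNegative-isCone isZero-isCone nonPositive-isCone

Mod3-+ : ∀ {P₀ P₁ P₂} p n {x} → Mod3 P₀ P₁ P₂ n x → Mod3 P₀ P₁ P₂ (p ℕ.* 3 ℕ.+ n) x
Mod3-+ zero    n σ = σ
Mod3-+ {P₀} {P₁} {P₂} (suc p) n σ = Mod3-+ {P₀} {P₁} {P₂} p n σ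

signPattern-+⁻¹ : ∀ p n {x} → SignPattern (p ℕ.* 3 ℕ.+ n) x → SignPattern n x
signPattern-+⁻¹ zero    n σ = σ
signPattern-+⁻¹ (suc p) n σ = signPattern-+⁻¹ p n σ

signPattern-half : ∀ n {x} → SignPattern n ((+ 2) * x) → SignPattern n x
signPattern-half 0                   {x} σ = ℤ.*-cancelˡ-≤-pos 0ℤ x (+ 2) σ
signPattern-half 1                   {x} σ = ℤ.*-cancelˡ-≡ (+ 2) x 0ℤ σ
signPattern-half 2                   {x} σ = ℤ.*-cancelˡ-≤-pos x 0ℤ (+ 2) σ
signPattern-half (suc (suc (suc n)))     σ = signPattern-half n σ

-- ωⁿ + ω⁻ⁿ for a primitive cube root of unity ω.
trace : ℕ → ℤ
trace 0                   = + 2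
trace 1                   = -[1+ 0 ]
trace 2                   = -[1+ 0 ]
trace (suc (suc (suc n))) = trace n

trace-sum : ∀ n → trace n + trace (1 ℕ.+ n) + trace (2 ℕ.+ n) ≡ 0ℤ
trace-sum 0                   = refl
trace-sum 1                   = refl
trace-sum 2                   = refl
trace-sum (suc (suc (suc n))) = trace-sum n

-- Here 2j stands for -j modulo 3, so this is ω^(i-j) + ω^(j-i).
weight : ℕ → ℕ → ℤ
weight i j = trace (j ℕ.* 2 ℕ.+ i)

weight-diagonal : ∀ i j → weight (suc i) (suc j) ≡ weight i j
weight-diagonal i j = cong (λ n → trace (2 ℕ.+ n)) (ℕ.+-suc (j ℕ.* 2) i)

weight-sum : ∀ i j → weight i j + weight (suc i) j + weight i (suc j) ≡ 0ℤ
weight-sum i j = trans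
  (cong (λ n → weight i j + trace n + weight i (suc j)) (ℕ.+-suc (j ℕ.* 2) i))
  (trace-sum (j ℕ.* 2 ℕ.+ i))

Multiple3 : ℕ → Set
Multiple3 0                   = ⊤
Multiple3 1                   = ⊥
Multiple3 2                   = ⊥
Multiple3 (suc (suc (suc n))) = Multiple3 n

*3-multiple3 : ∀ s → Multiple3 (s ℕ.* 3)
*3-multiple3 zero    = tt
*3-multiple3 (suc s) = *3-multiple3 s

tri³ : ℕ → ℕ → ℕ → ℕ
tri³ i j k = tri i ℕ.+ tri j ℕ.+ tri k

-- tri i + tri j + tri k modulo 3 decides whether i ≡ j modulo 3.
weight-sign : ∀ i j k → Multiple3 (i ℕ.+ j ℕ.+ k) → SignPattern (2 ℕ.* tri³ i j k) (weight i j)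
-- Raising an index by 3 adds 3(i + 1) to `tri`, hence a multiple of 6 to the exponent, and leaves
-- the weight unchanged.
weight-sign (suc (suc (suc i))) j k m = subst₂ SignPattern
  (ℕS.solve 4 (λ i x y z → (ℕS.con 2 ℕS.:* (ℕS.con 1 ℕS.:+ i)) ℕS.:* ℕS.con 3 ℕS.:+ ℕS.con 2 ℕS.:* (x ℕS.:+ y ℕS.:+ z)
    ℕS.:= ℕS.con 2 ℕS.:* (((ℕS.con 2 ℕS.:+ i) ℕS.:+ ((ℕS.con 1 ℕS.:+ i) ℕS.:+ (i ℕS.:+ x))) ℕS.:+ y ℕS.:+ z))
    refl i (tri i) (tri j) (tri k))
  (cong trace (ℕS.solve 2 (λ i j → ℕS.con 3 ℕS.:+ (j ℕS.:* ℕS.con 2 ℕS.:+ i)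
    ℕS.:= j ℕS.:* ℕS.con 2 ℕS.:+ (ℕS.con 3 ℕS.:+ i)) refl i j))
  (Mod3-+ {NonNegative} {IsZero} {NonPositive} (2 ℕ.* suc i) (2 ℕ.* tri³ i j k) (weight-sign i j k m))
weight-sign i (suc (suc (suc j))) k m = subst (λ n → SignPattern n (weight i j))
  (ℕS.solve 4 (λ j x y z → (ℕS.con 2 ℕS.:* (ℕS.con 1 ℕS.:+ j)) ℕS.:* ℕS.con 3 ℕS.:+ ℕS.con 2 ℕS.:* (x ℕS.:+ y ℕS.:+ z)
    ℕS.:= ℕS.con 2 ℕS.:* (x ℕS.:+ ((ℕS.con 2 ℕS.:+ j) ℕS.:+ ((ℕS.con 1 ℕS.:+ j) ℕS.:+ (j ℕS.:+ y))) ℕS.:+ z))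
    refl j (tri i) (tri j) (tri k))
  (Mod3-+ {NonNegative} {IsZero} {NonPositive} (2 ℕ.* suc j) (2 ℕ.* tri³ i j k) (weight-sign i j k (subst Multiple3
    (ℕS.solve 3 (λ i j k → i ℕS.:+ (ℕS.con 3 ℕS.:+ j) ℕS.:+ k ℕS.:= ℕS.con 3 ℕS.:+ (i ℕS.:+ j ℕS.:+ k)) refl i j k) m)))
weight-sign i j (suc (suc (suc k))) m = subst (λ n → SignPattern n (weight i j))
  (ℕS.solve 4 (λ k x y z → (ℕS.con 2 ℕS.:* (ℕS.con 1 ℕS.:+ k)) ℕS.:* ℕS.con 3 ℕS.:+ ℕS.con 2 ℕS.:* (x ℕS.:+ y ℕS.:+ z)
    ℕS.:= ℕS.con 2 ℕS.:* (x ℕS.:+ y ℕS.:+ ((ℕS.con 2 ℕS.:+ k) ℕS.:+ ((ℕS.con 1 ℕS.:+ k) ℕS.:+ (k ℕS.:+ z)))))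
    refl k (tri i) (tri j) (tri k))
  (Mod3-+ {NonNegative} {IsZero} {NonPositive} (2 ℕ.* suc k) (2 ℕ.* tri³ i j k) (weight-sign i j k (subst Multiple3
    (ℕS.solve 3 (λ i j k → i ℕS.:+ j ℕS.:+ (ℕS.con 3 ℕS.:+ k) ℕS.:= ℕS.con 3 ℕS.:+ (i ℕS.:+ j ℕS.:+ k)) refl i j k) m)))
-- Among residue triples only these nine have a sum divisible by 3. Equal residues give weight 2 and
-- an exponent divisible by 3; the permutations of 0, 1, 2 give weight -1 and exponent 2.
weight-sign 0 0 0 _ = +≤+ z≤n
weight-sign 0 1 2 _ = -≤+
weight-sign 0 2 1 _ = -≤+
weight-sign 1 0 2 _ = -≤+
weight-sign 1 1 1 _ = +≤+ z≤n
weight-sign 1 2 0 _ = -≤+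
weight-sign 2 0 1 _ = -≤+
weight-sign 2 1 0 _ = -≤+
weight-sign 2 2 2 _ = +≤+ z≤n

-- Convexity bounds for the exponents.

-- The difference of the two sides is (x-s)(x-s-1)/2, nonnegative at integers: the line of slope s
-- meets `tri` at both s and s + 1.
tri-tangent : ∀ s x → tri s ℕ.+ s ℕ.* x ℕ.≤ tri x ℕ.+ s ℕ.* s
tri-tangent s zero = ℕ.≤-trans (ℕ.≤-reflexive (trans (cong (tri s ℕ.+_) (ℕ.*-zeroʳ s)) (ℕ.+-identityʳ (tri s))))
  (ℕ.≤-trans (ℕ.m≤m+n (tri s) (tri s ℕ.+ s)) (ℕ.≤-reflexive (trans (sym (ℕ.+-assoc (tri s) (tri s) s)) (tri-square s))))
tri-tangent zero    (suc x) = z≤n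
tri-tangent (suc s) (suc x) = begin
  s ℕ.+ tri s ℕ.+ suc s ℕ.* suc x
    ≡⟨ ℕS.solve 3 (λ s t x → s ℕS.:+ t ℕS.:+ (ℕS.con 1 ℕS.:+ s) ℕS.:* (ℕS.con 1 ℕS.:+ x)
         ℕS.:= ℕS.con 1 ℕS.:+ s ℕS.:+ s ℕS.:+ x ℕS.:+ (t ℕS.:+ s ℕS.:* x)) refl s (tri s) x ⟩
  1 ℕ.+ s ℕ.+ s ℕ.+ x ℕ.+ (tri s ℕ.+ s ℕ.* x)
    ≤⟨ ℕ.+-monoʳ-≤ (1 ℕ.+ s ℕ.+ s ℕ.+ x) (tri-tangent s x) ⟩
  1 ℕ.+ s ℕ.+ s ℕ.+ x ℕ.+ (tri x ℕ.+ s ℕ.* s)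
    ≡⟨ ℕS.solve 3 (λ s t x → ℕS.con 1 ℕS.:+ s ℕS.:+ s ℕS.:+ x ℕS.:+ (t ℕS.:+ s ℕS.:* s)
         ℕS.:= x ℕS.:+ t ℕS.:+ (ℕS.con 1 ℕS.:+ s) ℕS.:* (ℕS.con 1 ℕS.:+ s)) refl s (tri x) x ⟩
  x ℕ.+ tri x ℕ.+ suc s ℕ.* suc s ∎
  where open ℕ.≤-Reasoning

tangent³ : ∀ s x j k → 3 ℕ.* tri s ℕ.+ s ℕ.* (x ℕ.+ j ℕ.+ k) ℕ.≤ tri³ x j k ℕ.+ s ℕ.* (s ℕ.* 3)
tangent³ s x j k = begin
  3 ℕ.* tri s ℕ.+ s ℕ.* (x ℕ.+ j ℕ.+ k)
    ≡⟨ ℕS.solve 5 (λ t s x j k → ℕS.con 3 ℕS.:* t ℕS.:+ s ℕS.:* (x ℕS.:+ j ℕS.:+ k)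
         ℕS.:= (t ℕS.:+ s ℕS.:* x) ℕS.:+ (t ℕS.:+ s ℕS.:* j) ℕS.:+ (t ℕS.:+ s ℕS.:* k)) refl (tri s) s x j k ⟩
  (tri s ℕ.+ s ℕ.* x) ℕ.+ (tri s ℕ.+ s ℕ.* j) ℕ.+ (tri s ℕ.+ s ℕ.* k)
    ≤⟨ ℕ.+-mono-≤ (ℕ.+-mono-≤ (tri-tangent s x) (tri-tangent s j)) (tri-tangent s k) ⟩
  (tri x ℕ.+ s ℕ.* s) ℕ.+ (tri j ℕ.+ s ℕ.* s) ℕ.+ (tri k ℕ.+ s ℕ.* s)
    ≡⟨ ℕS.solve 4 (λ s x j k → (x ℕS.:+ s ℕS.:* s) ℕS.:+ (j ℕS.:+ s ℕS.:* s) ℕS.:+ (k ℕS.:+ s ℕS.:* s)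
         ℕS.:= x ℕS.:+ j ℕS.:+ k ℕS.:+ s ℕS.:* (s ℕS.:* ℕS.con 3)) refl s (tri x) (tri j) (tri k) ⟩
  tri³ x j k ℕ.+ s ℕ.* (s ℕ.* 3) ∎
  where open ℕ.≤-Reasoning

module Bounds (s i j k : ℕ) (i+j+k≡3s : i ℕ.+ j ℕ.+ k ≡ s ℕ.* 3) where

  minimum : 3 ℕ.* tri s ℕ.≤ tri³ i j k
  minimum = ℕ.+-cancelʳ-≤ (s ℕ.* (s ℕ.* 3)) (3 ℕ.* tri s) (tri³ i j k)
    (subst (λ t → 3 ℕ.* tri s ℕ.+ s ℕ.* t ℕ.≤ tri³ i j k ℕ.+ s ℕ.* (s ℕ.* 3)) i+j+k≡3s (tangent³ s i j k))

  -- The tangent inequality taken at i + 1 instead of i: the left side gains the slope s, the right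
  -- side gains `tri (suc i)` - `tri i` = i.
  lower : 3 ℕ.* tri s ℕ.+ s ℕ.≤ tri³ i j k ℕ.+ i
  lower = ℕ.+-cancelʳ-≤ (s ℕ.* (s ℕ.* 3)) (3 ℕ.* tri s ℕ.+ s) (tri³ i j k ℕ.+ i) (begin
    3 ℕ.* tri s ℕ.+ s ℕ.+ s ℕ.* (s ℕ.* 3)
      ≡⟨ cong (λ t → 3 ℕ.* tri s ℕ.+ s ℕ.+ s ℕ.* t) i+j+k≡3s ⟨
    3 ℕ.* tri s ℕ.+ s ℕ.+ s ℕ.* (i ℕ.+ j ℕ.+ k)
      ≡⟨ trans (ℕ.+-assoc (3 ℕ.* tri s) s (s ℕ.* (i ℕ.+ j ℕ.+ k)))
           (cong (3 ℕ.* tri s ℕ.+_) (sym (ℕ.*-suc s (i ℕ.+ j ℕ.+ k)))) ⟩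
    3 ℕ.* tri s ℕ.+ s ℕ.* (suc i ℕ.+ j ℕ.+ k)
      ≤⟨ tangent³ s (suc i) j k ⟩
    tri³ (suc i) j k ℕ.+ s ℕ.* (s ℕ.* 3)
      ≡⟨ ℕS.solve 5 (λ i x j k z → ((i ℕS.:+ x) ℕS.:+ j ℕS.:+ k) ℕS.:+ z
           ℕS.:= (x ℕS.:+ j ℕS.:+ k ℕS.:+ i) ℕS.:+ z) refl i (tri i) (tri j) (tri k) (s ℕ.* (s ℕ.* 3)) ⟩
    tri³ i j k ℕ.+ i ℕ.+ s ℕ.* (s ℕ.* 3) ∎)
    where open ℕ.≤-Reasoning

-- The tangent inequality taken at i - 1, where `tri` is smaller by i - 1; for i = 0 the minimum
-- suffices.
tri³-upper : ∀ s i j k → i ℕ.+ j ℕ.+ k ≡ s ℕ.* 3 → 3 ℕ.* tri s ℕ.+ i ℕ.≤ suc (tri³ i j k) ℕ.+ s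
tri³-upper s zero    j k sum = ℕ.≤-trans (ℕ.≤-reflexive (ℕ.+-identityʳ (3 ℕ.* tri s)))
  (ℕ.≤-trans (Bounds.minimum s 0 j k sum) (ℕ.≤-trans (ℕ.n≤1+n (tri³ 0 j k)) (ℕ.m≤m+n (suc (tri³ 0 j k)) s)))
tri³-upper s (suc x) j k sum = ℕ.+-cancelʳ-≤ (s ℕ.* (s ℕ.* 3)) (3 ℕ.* tri s ℕ.+ suc x) (suc (tri³ (suc x) j k) ℕ.+ s) (begin
  3 ℕ.* tri s ℕ.+ suc x ℕ.+ s ℕ.* (s ℕ.* 3)
    ≡⟨ cong (λ t → 3 ℕ.* tri s ℕ.+ suc x ℕ.+ s ℕ.* t) sum ⟨
  3 ℕ.* tri s ℕ.+ suc x ℕ.+ s ℕ.* (suc x ℕ.+ j ℕ.+ k)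
    ≡⟨ ℕS.solve 5 (λ t x s j k → t ℕS.:+ (ℕS.con 1 ℕS.:+ x) ℕS.:+ s ℕS.:* (ℕS.con 1 ℕS.:+ x ℕS.:+ j ℕS.:+ k)
         ℕS.:= (t ℕS.:+ s ℕS.:* (x ℕS.:+ j ℕS.:+ k)) ℕS.:+ (ℕS.con 1 ℕS.:+ x ℕS.:+ s)) refl (3 ℕ.* tri s) x s j k ⟩
  (3 ℕ.* tri s ℕ.+ s ℕ.* (x ℕ.+ j ℕ.+ k)) ℕ.+ (suc x ℕ.+ s)
    ≤⟨ ℕ.+-monoˡ-≤ (suc x ℕ.+ s) (tangent³ s x j k) ⟩
  (tri³ x j k ℕ.+ s ℕ.* (s ℕ.* 3)) ℕ.+ (suc x ℕ.+ s)
    ≡⟨ ℕS.solve 6 (λ x t j k z s → (t ℕS.:+ j ℕS.:+ k ℕS.:+ z) ℕS.:+ (ℕS.con 1 ℕS.:+ x ℕS.:+ s)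
         ℕS.:= (ℕS.con 1 ℕS.:+ ((x ℕS.:+ t) ℕS.:+ j ℕS.:+ k) ℕS.:+ s) ℕS.:+ z)
         refl x (tri x) (tri j) (tri k) (s ℕ.* (s ℕ.* 3)) s ⟩
  suc (tri³ (suc x) j k) ℕ.+ s ℕ.+ s ℕ.* (s ℕ.* 3) ∎)
  where open ℕ.≤-Reasoning

-- Of the two copies of `tri³` in the exponent, one is bounded by its minimum 3 `tri s`. The other,
-- together with i or with i′ = 2s - i, makes up for n, which is below s.
precision : ∀ s n i i′ j k → n ℕ.< s → i ℕ.+ j ℕ.+ k ≡ s ℕ.* 3 → s ℕ.+ s ≡ i ℕ.+ i′ →
            (6 ℕ.* tri s ℕ.+ n ℕ.≤ 2 ℕ.* tri³ i j k ℕ.+ i) × (6 ℕ.* tri s ℕ.+ n ℕ.≤ 2 ℕ.* tri³ i j k ℕ.+ i′)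
precision s n i i′ j k n<s sum 2s≡i+i′ = combine i first , combine i′ second
  where
  open ℕ.≤-Reasoning
  open Bounds s i j k sum
  T : ℕ
  T = tri³ i j k
  combine : ∀ r → 3 ℕ.* tri s ℕ.+ n ℕ.≤ T ℕ.+ r → 6 ℕ.* tri s ℕ.+ n ℕ.≤ 2 ℕ.* T ℕ.+ r
  combine r p = begin
    6 ℕ.* tri s ℕ.+ n
      ≡⟨ ℕS.solve 2 (λ t n → ℕS.con 6 ℕS.:* t ℕS.:+ n ℕS.:= ℕS.con 3 ℕS.:* t ℕS.:+ (ℕS.con 3 ℕS.:* t ℕS.:+ n)) refl (tri s) n ⟩
    3 ℕ.* tri s ℕ.+ (3 ℕ.* tri s ℕ.+ n)
      ≤⟨ ℕ.+-mono-≤ minimum p ⟩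
    T ℕ.+ (T ℕ.+ r)
      ≡⟨ ℕS.solve 2 (λ t r → t ℕS.:+ (t ℕS.:+ r) ℕS.:= ℕS.con 2 ℕS.:* t ℕS.:+ r) refl T r ⟩
    2 ℕ.* T ℕ.+ r ∎
  first : 3 ℕ.* tri s ℕ.+ n ℕ.≤ T ℕ.+ i
  first = ℕ.≤-trans (ℕ.+-monoʳ-≤ (3 ℕ.* tri s) (ℕ.<⇒≤ n<s)) lower
  second : 3 ℕ.* tri s ℕ.+ n ℕ.≤ T ℕ.+ i′
  second = ℕ.s≤s⁻¹ (ℕ.+-cancelʳ-≤ s (suc (3 ℕ.* tri s ℕ.+ n)) (suc (T ℕ.+ i′)) (begin
    suc (3 ℕ.* tri s ℕ.+ n) ℕ.+ s
      ≡⟨ cong (ℕ._+ s) (ℕ.+-suc (3 ℕ.* tri s) n) ⟨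
    3 ℕ.* tri s ℕ.+ suc n ℕ.+ s
      ≤⟨ ℕ.+-monoˡ-≤ s (ℕ.+-monoʳ-≤ (3 ℕ.* tri s) n<s) ⟩
    3 ℕ.* tri s ℕ.+ s ℕ.+ s
      ≡⟨ trans (ℕ.+-assoc (3 ℕ.* tri s) s s) (cong (3 ℕ.* tri s ℕ.+_) 2s≡i+i′) ⟩
    3 ℕ.* tri s ℕ.+ (i ℕ.+ i′)
      ≡⟨ ℕ.+-assoc (3 ℕ.* tri s) i i′ ⟨
    3 ℕ.* tri s ℕ.+ i ℕ.+ i′
      ≤⟨ ℕ.+-monoˡ-≤ i′ (tri³-upper s i j k sum) ⟩
    suc T ℕ.+ s ℕ.+ i′
      ≡⟨ ℕS.solve 3 (λ t s r → ℕS.con 1 ℕS.:+ t ℕS.:+ s ℕS.:+ r ℕS.:= ℕS.con 1 ℕS.:+ (t ℕS.:+ r) ℕS.:+ s) refl T s i′ ⟩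
    suc (T ℕ.+ i′) ℕ.+ s ∎))

∑-closed : ∀ {P} → IsCone P → ∀ N n g → (∀ i → i ℕ.< n → P (g i N)) → P (∑ n g N)
∑-closed cone N zero        g p = IsCone.zero-closed cone
∑-closed {P} cone N (suc n) g p = subst P (sym (⊕-at (g 0) (∑ n (g ∘ suc)) N))
  (IsCone.+-closed cone (p 0 (s≤s z≤n)) (∑-closed cone N n (g ∘ suc) λ i i<n → p (suc i) (s≤s i<n)))

-- The sign pattern of f₂³/f₆.

cubicQuotient : Series
cubicQuotient = (f 2 · (f 2 · f 2)) · recip (f 6)

f-₀ : ∀ c .{{_ : NonZero c}} → f c 0 ≡ 1ℤ
f-₀ c = refl

-- Any s > n would do: the coefficient of qⁿ in f₂³/f₆ is read off at q^{w₀+n}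
-- from the finite identity with M = 2s factors.
module CubicSign (n : ℕ) where

  s M w₀ N : ℕ
  s  = suc n
  M  = s ℕ.+ s
  w₀ = 6 ℕ.* tri s
  N  = w₀ ℕ.+ n

  X : ℕ → Series
  X i = f 2 · elem q^[ 2 *] M i

  -- A Kronecker delta at 3s: under `Λ₃` it selects the coefficient of z^(3s).
  h : ℕ → Series
  h t = (q^ t) (s ℕ.* 3) • one

  W : ℕ → ℕ → Series
  W i j = weight i j • one

  -- Exact through degree `N`, the only degree at which a coefficient is read off.
  X-triple : ∀ i j k → i ℕ.≤ M → j ℕ.≤ M → k ℕ.≤ M → i ℕ.+ j ℕ.+ k ≡ s ℕ.* 3 →
             X i · (X j · X k) ≈[ suc N ] q^ (2 ℕ.* tri³ i j k)
  X-triple i j k i≤M j≤M k≤M sum = ≈-trans (≐⇒≈ (begin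
    X i · (X j · X k)
      ≈⟨ S.*-cong (f-elem 2 i (M ∸ i) (M≡ i≤M)) (S.*-cong (f-elem 2 j (M ∸ j) (M≡ j≤M)) (f-elem 2 k (M ∸ k) (M≡ k≤M))) ⟩
    (x · u i) · ((y · u j) · (z · u k))
      ≈⟨ solve 6 (λ x u y v z w → (x :* u) :* ((y :* v) :* (z :* w)) := ((x :* y) :* z) :* (u :* (v :* w))) S.refl
           x (u i) y (u j) z (u k) ⟩
    ((x · y) · z) · (u i · (u j · u k))
      ≈⟨ S.*-congʳ (S.trans (q^-cong (trans (ℕ.*-distribˡ-+ 2 (tri i ℕ.+ tri j) (tri k))
             (cong (ℕ._+ 2 ℕ.* tri k) (ℕ.*-distribˡ-+ 2 (tri i) (tri j)))))
           (S.trans (q^-+ (2 ℕ.* tri i ℕ.+ 2 ℕ.* tri j) (2 ℕ.* tri k))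
             (S.*-congʳ (q^-+ (2 ℕ.* tri i) (2 ℕ.* tri j))))) ⟨
    (q^ w) · (u i · (u j · u k)) ∎))
    (q^-·-≈-one w
      (≈-trans (·-≈ (u-≈ i i≤M p-i) (·-≈ (u-≈ j j≤M p-j) (u-≈ k k≤M p-k)))
        (≐⇒≈ (S.trans (S.*-identityˡ (one · one)) (S.*-identityˡ one))))
      (ℕ.m≤n+m∸n (suc N) w))
    where
    open S-Reasoning
    w : ℕ
    w = 2 ℕ.* tri³ i j k
    x y z : Series
    x = q^ (2 ℕ.* tri i)
    y = q^ (2 ℕ.* tri j)
    z = q^ (2 ℕ.* tri k)
    u : ℕ → Series
    u i = binomialUnit 2 i (M ∸ i)
    M≡ : ∀ {i} → i ℕ.≤ M → M ≡ i ℕ.+ (M ∸ i)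
    M≡ i≤M = sym (ℕ.m+[n∸m]≡n i≤M)
    Precise : ℕ → Set
    Precise i = (N ℕ.≤ w ℕ.+ i) × (N ℕ.≤ w ℕ.+ (M ∸ i))
    p-i : Precise i
    p-i = precision s n i (M ∸ i) j k ℕ.≤-refl sum (M≡ i≤M)
    p-j : Precise j
    p-j = subst (λ T → (N ℕ.≤ 2 ℕ.* T ℕ.+ j) × (N ℕ.≤ 2 ℕ.* T ℕ.+ (M ∸ j)))
      (cong (ℕ._+ tri k) (ℕ.+-comm (tri j) (tri i)))
      (precision s n j (M ∸ j) i k ℕ.≤-refl (trans (cong (ℕ._+ k) (ℕ.+-comm j i)) sum) (M≡ j≤M))
    p-k : Precise k
    p-k = subst (λ T → (N ℕ.≤ 2 ℕ.* T ℕ.+ k) × (N ℕ.≤ 2 ℕ.* T ℕ.+ (M ∸ k)))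
      (rotate (tri k) (tri i) (tri j))
      (precision s n k (M ∸ k) i j ℕ.≤-refl (trans (rotate k i j) sum) (M≡ k≤M))
      where
      rotate : ∀ a b c → a ℕ.+ b ℕ.+ c ≡ b ℕ.+ c ℕ.+ a
      rotate a b c = trans (ℕ.+-assoc a b c) (ℕ.+-comm a (b ℕ.+ c))
    bound : ∀ {i} → N ℕ.≤ w ℕ.+ i → suc N ∸ w ℕ.≤ suc i
    bound {i} p = ℕ.m≤n+o⇒m∸n≤o (suc N) w (ℕ.≤-trans (s≤s p) (ℕ.≤-reflexive (sym (ℕ.+-suc w i))))
    u-≈ : ∀ i → i ℕ.≤ M → Precise i → u i ≈[ suc N ∸ w ] one
    u-≈ i i≤M (p , p′) = binomialUnit-≈ 2 i (M ∸ i) (bound p) (bound p′)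

  •-as-· : ∀ a t → a • t ≐ (a • one) · t
  •-as-· a t = S.sym (S.trans (•-· a one t) (pointwise λ m → trans (•-at a (one · t) m)
    (trans (cong (a *_) (at (S.*-identityˡ t) m)) (sym (•-at a t m)))))

  •one-·-at : ∀ a t m → ((a • one) · t) m ≡ a * t m
  •one-·-at a t m = trans (sym (at (•-as-· a t) m)) (•-at a t m)

  -- A term reaches degree `N` only if i + j + k = 3s and 2 `tri³ i j k` = `N`; its coefficient is
  -- then the weight. Since `N` = 6 `tri s` + n is congruent to n modulo 3, `weight-sign` at `N` is
  -- the pattern at n.
  term-sign : ∀ i j k → i ℕ.≤ M → j ℕ.≤ M → k ℕ.≤ M →
              SignPattern n ((X i · (X j · (X k · (W i j · h (i ℕ.+ j ℕ.+ k))))) N)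
  term-sign i j k i≤M j≤M k≤M = subst (SignPattern n) (sym coefficient) sign
    where
    open IsCone (signPattern-isCone n)
    b : ℤ
    b = (q^ (i ℕ.+ j ℕ.+ k)) (s ℕ.* 3)
    coefficient : (X i · (X j · (X k · (W i j · h (i ℕ.+ j ℕ.+ k))))) N
                  ≡ weight i j * (b * (X i · (X j · X k)) N)
    coefficient = trans
      (at (solve 5 (λ x y z a b → x :* (y :* (z :* (a :* b))) := a :* (b :* (x :* (y :* z)))) S.refl
        (X i) (X j) (X k) (W i j) (h (i ℕ.+ j ℕ.+ k))) N)
      (trans (•one-·-at (weight i j) (h (i ℕ.+ j ℕ.+ k) · (X i · (X j · X k))) N)
        (cong (weight i j *_) (•one-·-at b (X i · (X j · X k)) N)))
    vanish : ∀ {x} → x ≡ 0ℤ → SignPattern n (weight i j * x)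
    vanish x≡0 = subst (SignPattern n) (sym (trans (cong (weight i j *_) x≡0) (ℤ.*-zeroʳ (weight i j)))) zero-closed
    sign : SignPattern n (weight i j * (b * (X i · (X j · X k)) N))
    sign with i ℕ.+ j ℕ.+ k ℕ.≟ s ℕ.* 3
    ... | no  i+j+k≢3s = vanish refl
    ... | yes i+j+k≡3s with 2 ℕ.* tri³ i j k ℕ.≟ N
    ...   | no  w≢N = vanish (trans (ℤ.*-identityˡ _)
            (trans (at< (X-triple i j k i≤M j≤M k≤M i+j+k≡3s) N (ℕ.n<1+n N)) (q^-≢ w≢N)))
    ...   | yes w≡N = subst (SignPattern n)
            (sym (trans (cong (weight i j *_) (trans (ℤ.*-identityˡ _)
                (trans (at< (X-triple i j k i≤M j≤M k≤M i+j+k≡3s) N (ℕ.n<1+n N))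
                  (trans (cong (λ w → (q^ w) N) w≡N) (q^-refl N)))))
              (ℤ.*-identityʳ (weight i j))))
            (signPattern-+⁻¹ (2 ℕ.* tri s) n (subst (λ m → SignPattern m (weight i j))
              (trans w≡N (cong (ℕ._+ n) (ℕS.solve 1 (λ t → ℕS.con 6 ℕS.:* t ℕS.:= (ℕS.con 2 ℕS.:* t) ℕS.:* ℕS.con 3) refl (tri s))))
              (weight-sign i j k (subst Multiple3 (sym i+j+k≡3s) (*3-multiple3 s)))))

  Ω : Series
  Ω = Λ₃ q^[ 2 *] M λ i j k → W i j · h (i ℕ.+ j ℕ.+ k)

  Ω-sign : SignPattern n ((f 2 · (f 2 · (f 2 · Ω))) N)
  Ω-sign = subst (SignPattern n) (sym (at (*-Λ₃ (f 2) q^[ 2 *] M (λ i j k → W i j · h (i ℕ.+ j ℕ.+ k))) N))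
    (∑-closed cone N (suc M) (λ i → ∑ (suc M) λ j → ∑ (suc M) (term i j)) λ i i≤M →
      ∑-closed cone N (suc M) (λ j → ∑ (suc M) (term i j)) λ j j≤M →
        ∑-closed cone N (suc M) (term i j) λ k k≤M →
          term-sign i j k (ℕ.s≤s⁻¹ i≤M) (ℕ.s≤s⁻¹ j≤M) (ℕ.s≤s⁻¹ k≤M))
    where
    cone : IsCone (SignPattern n)
    cone = signPattern-isCone n
    term : ℕ → ℕ → ℕ → Series
    term i j k = X i · (X j · (X k · (W i j · h (i ℕ.+ j ℕ.+ k))))

  W-zero : ∀ {a} → a ≡ 0ℤ → a • one ≐ 0ˢ
  W-zero refl = pointwise λ m → trans (•-at 0ℤ one m) (ℤ.*-zeroˡ (one m))

  •-⊕ : ∀ a b → (a • one) ⊕ (b • one) ≐ (a + b) • one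
  •-⊕ a b = pointwise λ m → trans (⊕-at (a • one) (b • one) m)
    (trans (cong₂ _+_ (•-at a one m) (•-at b one m))
      (trans (sym (ℤ.*-distribʳ-+ (one m) a b)) (sym (•-at (a + b) one m))))

  h-zero : ∀ i → i ≢ s → h (i ℕ.* 3) ≐ 0ˢ
  h-zero i i≢s = W-zero (q^-≢ λ 3i≡3s → i≢s (ℕ.*-cancelʳ-≡ i s 3 3i≡3s))

  h-one : h (s ℕ.* 3) ≐ one
  h-one = pointwise λ m → trans (•-at ((q^ (s ℕ.* 3)) (s ℕ.* 3)) one m)
    (trans (cong (_* one m) (q^-refl (s ℕ.* 3))) (ℤ.*-identityˡ (one m)))

  -- The cubed factors involve only powers of z³ and have parameters q^(6k), so the selector at 3s
  -- leaves the single central index s.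
  Ω-≐ : Ω ≐ ((+ 2) • one) · elem q^[ 6 *] M s
  Ω-≐ = begin
    Ω
      ≈⟨ Λ₃-cubes q^[ 2 *] W
           (λ i j → S.reflexive (cong (_• one) (weight-diagonal i j)))
           (λ i j → S.trans (S.+-congʳ (•-⊕ (weight i j) (weight (suc i) j)))
             (S.trans (•-⊕ (weight i j + weight (suc i) j) (weight i (suc j))) (W-zero (weight-sum i j))))
           M h ⟩
    W 0 0 · Λ p³ M (λ i → h (i ℕ.* 3))
      ≈⟨ S.*-congˡ (∑-only s (λ i → elem p³ M i · h (i ℕ.* 3)) (s≤s (ℕ.m≤m+n s s))
           (λ i i≢s → S.trans (S.*-congˡ (h-zero i i≢s)) (S.zeroʳ (elem p³ M i)))) ⟩
    W 0 0 · (elem p³ M s · h (s ℕ.* 3))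
      ≈⟨ S.*-congˡ (S.trans (S.*-congˡ h-one) (S.*-identityʳ (elem p³ M s))) ⟩
    W 0 0 · elem p³ M s
      ≈⟨ S.*-congˡ (elem-cong p³≐ M s) ⟩
    ((+ 2) • one) · elem q^[ 6 *] M s ∎
    where
    open S-Reasoning
    p³ : ℕ → Series
    p³ k = q^[ 2 *] k · q^[ 2 *] k · q^[ 2 *] k
    p³≐ : ∀ k → p³ k ≐ q^[ 6 *] k
    p³≐ k = S.sym (S.trans (q^-cong (ℕS.solve 1 (λ k → ℕS.con 6 ℕS.:* k
          ℕS.:= ℕS.con 2 ℕS.:* k ℕS.:+ ℕS.con 2 ℕS.:* k ℕS.:+ ℕS.con 2 ℕS.:* k) refl k))
      (S.trans (q^-+ (2 ℕ.* k ℕ.+ 2 ℕ.* k) (2 ℕ.* k)) (S.*-congʳ (q^-+ (2 ℕ.* k) (2 ℕ.* k)))))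

  -- Inserting f₆/f₆ lets `f-elem` evaluate the central symmetric polynomial; its monomial q^(6 tri
  -- s) is the origin of `w₀`.
  f³-Ω : f 2 · (f 2 · (f 2 · Ω)) ≐ ((+ 2) • one) · ((q^ w₀) · (cubicQuotient · binomialUnit 6 s s))
  f³-Ω = begin
    f 2 · (f 2 · (f 2 · Ω))
      ≈⟨ S.*-congˡ (S.*-congˡ (S.*-congˡ Ω-≐)) ⟩
    f 2 · (f 2 · (f 2 · (two · e)))
      ≈⟨ S.*-congˡ (S.*-congˡ (S.*-congˡ (S.*-congˡ (S.trans (S.sym (S.*-identityˡ e))
           (S.*-congʳ (S.sym (recip-inverse (f-₀ 6)))))))) ⟩
    f 2 · (f 2 · (f 2 · (two · ((f 6 · recip (f 6)) · e))))
      ≈⟨ solve 5 (λ x t y r e → x :* (x :* (x :* (t :* ((y :* r) :* e)))) := t :* (((x :* (x :* x)) :* r) :* (y :* e)))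
           S.refl (f 2) two (f 6) (recip (f 6)) e ⟩
    two · (cubicQuotient · (f 6 · e))
      ≈⟨ S.*-congˡ (S.*-congˡ (f-elem 6 s s refl)) ⟩
    two · (cubicQuotient · ((q^ w₀) · binomialUnit 6 s s))
      ≈⟨ S.*-congˡ (solve 3 (λ b w u → b :* (w :* u) := w :* (b :* u)) S.refl
           cubicQuotient (q^ w₀) (binomialUnit 6 s s)) ⟩
    two · ((q^ w₀) · (cubicQuotient · binomialUnit 6 s s)) ∎
    where
    open S-Reasoning
    two e : Series
    two = (+ 2) • one
    e = elem q^[ 6 *] M s

  cubicQuotient-sign : SignPattern n (cubicQuotient n)
  -- The factor 2 removed here is the trace of 1, the weight at i = j = 0.
  cubicQuotient-sign = signPattern-half n (subst (SignPattern n) value Ω-sign)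
    where
    value : (f 2 · (f 2 · (f 2 · Ω))) N ≡ (+ 2) * cubicQuotient n
    value = trans (at f³-Ω N)
      (trans (•one-·-at (+ 2) ((q^ w₀) · (cubicQuotient · binomialUnit 6 s s)) N)
        (cong ((+ 2) *_) (trans (q^-·-+ w₀ (cubicQuotient · binomialUnit 6 s s) n)
          (at< (≈-trans (·-≈ ≈-refl (binomialUnit-≈ 6 s s ℕ.≤-refl ℕ.≤-refl))
            (≐⇒≈ (S.*-identityʳ cubicQuotient))) n (ℕ.m<n⇒m<1+n (ℕ.n<1+n n))))))

-- Series in q³ with nonnegative or positive coefficients.

Mod3-map : ∀ {P₀ P₁ P₂ Q₀ Q₁ Q₂ : ℤ → Set} → (∀ {x} → P₀ x → Q₀ x) → (∀ {x} → P₁ x → Q₁ x) →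
           (∀ {x} → P₂ x → Q₂ x) → ∀ n {x} → Mod3 P₀ P₁ P₂ n x → Mod3 Q₀ Q₁ Q₂ n x
Mod3-map f₀ f₁ f₂ 0                   = f₀
Mod3-map f₀ f₁ f₂ 1                   = f₁
Mod3-map f₀ f₁ f₂ 2                   = f₂
Mod3-map {P₀} {P₁} {P₂} {Q₀} {Q₁} {Q₂} f₀ f₁ f₂ (suc (suc (suc n))) =
  Mod3-map {P₀} {P₁} {P₂} {Q₀} {Q₁} {Q₂} f₀ f₁ f₂ n

module _ {P₀ P₁ P₂ : ℤ → Set} where
  Mod3-0 : ∀ n {x} → Mod3 P₀ P₁ P₂ (n ℕ.* 3) x → P₀ x
  Mod3-0 zero    = λ p → p
  Mod3-0 (suc n) = Mod3-0 n

  Mod3-1 : ∀ n {x} → Mod3 P₀ P₁ P₂ (1 ℕ.+ n ℕ.* 3) x → P₁ x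
  Mod3-1 zero    = λ p → p
  Mod3-1 (suc n) = Mod3-1 n

  Mod3-2 : ∀ n {x} → Mod3 P₀ P₁ P₂ (2 ℕ.+ n ℕ.* 3) x → P₂ x
  Mod3-2 zero    = λ p → p
  Mod3-2 (suc n) = Mod3-2 n

Positive : ℤ → Set
Positive x = 0ℤ < x

NonNegative3 Positive3 : ℕ → ℤ → Set
NonNegative3 = Mod3 NonNegative IsZero IsZero
Positive3    = Mod3 Positive IsZero IsZero

nonNegative3-isCone : ∀ n → IsCone (NonNegative3 n)
nonNegative3-isCone = Mod3-isCone nonNegative-isCone isZero-isCone isZero-isCone

positive3⇒nonNegative3 : ∀ n {x} → Positive3 n x → NonNegative3 n x
positive3⇒nonNegative3 = Mod3-map {Positive} {IsZero} {IsZero} {NonNegative} {IsZero} {IsZero} ℤ.<⇒≤ (λ p → p) (λ p → p)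

positive3-+ : ∀ n {x y} → Positive3 n x → NonNegative3 n y → Positive3 n (x + y)
positive3-+ 0                   p r       = ℤ.+-mono-<-≤ p r
positive3-+ 1                   refl refl = refl
positive3-+ 2                   refl refl = refl
positive3-+ (suc (suc (suc n)))           = positive3-+ n

-- The first factor vanishes unless 3 divides m, so m + n may be taken to have the residue of n.
Mod3-* : ∀ {P₀ P₁ P₂} → (∀ n → IsCone (Mod3 P₀ P₁ P₂ n)) → ∀ m n {x y} →
         NonNegative3 m x → Mod3 P₀ P₁ P₂ n y → Mod3 P₀ P₁ P₂ (m ℕ.+ n) (x * y)
Mod3-* cone 0 n     0≤x  σ = IsCone.*-closed (cone n) 0≤x σ
Mod3-* cone 1 n {y = y} refl σ = IsCone.zero-closed (cone (1 ℕ.+ n))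
Mod3-* cone 2 n {y = y} refl σ = IsCone.zero-closed (cone (2 ℕ.+ n))
Mod3-* {P₀} {P₁} {P₂} cone (suc (suc (suc m))) n {x} {y} = Mod3-* {P₀} {P₁} {P₂} cone m n {x} {y}

sum-closed : ∀ {P} → IsCone P → ∀ {n} (g : Fin n → ℤ) → (∀ i → P (g i)) → P (sum g)
sum-closed cone {zero}  g p = IsCone.zero-closed cone
sum-closed cone {suc n} g p = IsCone.+-closed cone (p zero) (sum-closed cone (g ∘ suc) (p ∘ suc))

Mod3-term : ∀ {P₀ P₁ P₂} → (∀ n → IsCone (Mod3 P₀ P₁ P₂ n)) → ∀ {s t : Series} →
            (∀ i → Mod3 P₀ P₁ P₂ i (s i)) → (∀ i → NonNegative3 i (t i)) →
            ∀ n i → i ℕ.≤ n → Mod3 P₀ P₁ P₂ n (s i * t (n ∸ i))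
Mod3-term {P₀} {P₁} {P₂} cone {s} {t} σ τ n i i≤n = subst₂ (Mod3 P₀ P₁ P₂)
  (ℕ.m∸n+n≡m i≤n) (ℤ.*-comm (t (n ∸ i)) (s i)) (Mod3-* {P₀} {P₁} {P₂} cone (n ∸ i) i {t (n ∸ i)} {s i} (τ (n ∸ i)) (σ i))

NonNegative3ˢ Positive3ˢ : Series → Set
NonNegative3ˢ s = ∀ n → NonNegative3 n (s n)
Positive3ˢ s = ∀ n → Positive3 n (s n)

nonNegative3ˢ-resp : ∀ {s t} → s ≐ t → NonNegative3ˢ t → NonNegative3ˢ s
nonNegative3ˢ-resp s≐t τ n = subst (NonNegative3 n) (sym (at s≐t n)) (τ n)

positive3ˢ-resp : ∀ {s t} → s ≐ t → Positive3ˢ t → Positive3ˢ s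
positive3ˢ-resp s≐t τ n = subst (Positive3 n) (sym (at s≐t n)) (τ n)

opaque
  unfolding _·_

  ·-nonNegative3ˢ : ∀ {s t} → NonNegative3ˢ s → NonNegative3ˢ t → NonNegative3ˢ (s · t)
  ·-nonNegative3ˢ {s} {t} σ τ n = sum-closed (nonNegative3-isCone n)
    (λ (i : Fin (suc n)) → s (toℕ i) * t (n ∸ toℕ i))
    (λ i → Mod3-term {NonNegative} {IsZero} {IsZero} nonNegative3-isCone {s} {t} σ τ n (toℕ i) (ℕ.s≤s⁻¹ (toℕ<n i)))

  ⊕-nonNegative3ˢ : ∀ {s t} → NonNegative3ˢ s → NonNegative3ˢ t → NonNegative3ˢ (s ⊕ t)
  ⊕-nonNegative3ˢ σ τ n = IsCone.+-closed (nonNegative3-isCone n) (σ n) (τ n)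

  -- The constant term 1 of `s` contributes a full copy of `t`; the remaining terms only add
  -- nonnegative amounts.
  ·-positive3ˢ : ∀ {s t} → s 0 ≡ 1ℤ → NonNegative3ˢ s → Positive3ˢ t → Positive3ˢ (s · t)
  ·-positive3ˢ {s} {t} s₀≡1 σ τ n = positive3-+ n
    (subst (Positive3 n) (sym (trans (cong (_* t n) s₀≡1) (ℤ.*-identityˡ (t n)))) (τ n))
    (sum-closed (nonNegative3-isCone n) (λ (i : Fin n) → s (suc (toℕ i)) * t (n ∸ suc (toℕ i)))
      (λ i → Mod3-term {NonNegative} {IsZero} {IsZero} nonNegative3-isCone {s} {t} σ (λ i → positive3⇒nonNegative3 i (τ i)) n (suc (toℕ i)) (toℕ<n i)))

one-nonNegative3ˢ : NonNegative3ˢ one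
one-nonNegative3ˢ 0                   = +≤+ z≤n
one-nonNegative3ˢ 1                   = refl
one-nonNegative3ˢ 2                   = refl
one-nonNegative3ˢ (suc (suc (suc n))) = IsCone.zero-closed (nonNegative3-isCone n)

q^-·-nonNegative3 : ∀ {m} → 3 ∣ m → ∀ s n → (∀ k → m ℕ.+ k ≡ n → NonNegative3 k (s k)) →
                    NonNegative3 n (((q^ m) · s) n)
q^-·-nonNegative3 {m} (divides p m≡3p) s n σ with n ℕ.<? m
... | yes n<m = subst (NonNegative3 n) (sym (q^-·-< s n<m)) (IsCone.zero-closed (nonNegative3-isCone n))
... | no  n≮m with ℕ.m≤n⇒∃[o]m+o≡n (ℕ.≮⇒≥ n≮m)
... | k , refl = subst₂ NonNegative3 (cong (ℕ._+ k) (sym m≡3p)) (sym (q^-·-+ m s k))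
  (Mod3-+ {NonNegative} {IsZero} {IsZero} p k (σ k refl))

q^-nonNegative3ˢ : ∀ {m} → 3 ∣ m → NonNegative3ˢ (q^ m)
q^-nonNegative3ˢ {m} 3∣m n = subst (NonNegative3 n) (at (S.*-identityʳ (q^ m)) n)
  (q^-·-nonNegative3 3∣m one n λ k _ → one-nonNegative3ˢ k)

-- Geometric series

opaque
  unfolding _·_

  1-q^-₀ : ∀ m .{{_ : NonZero m}} → (one ⊕ ⊝ (q^ m)) 0 ≡ 1ℤ
  1-q^-₀ (suc m) = refl

geometric : ℕ → Series
geometric m = recip (one ⊕ ⊝ (q^ m))

geometric-step : ∀ m .{{_ : NonZero m}} → geometric m ≐ one ⊕ (q^ m) · geometric m
geometric-step m = begin
  g                                    ≈⟨ S.*-identityˡ g ⟨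
  one · g                              ≈⟨ S.*-congʳ (S.trans (S.+-congˡ (S.-‿inverseˡ x)) (S.+-identityʳ one)) ⟨
  (one ⊕ (⊝ x ⊕ x)) · g
    ≈⟨ solve 3 (λ y x g → (con 1 :+ (y :+ x)) :* g := (con 1 :+ y) :* g :+ x :* g) S.refl (⊝ x) x g ⟩
  (one ⊕ ⊝ x) · g ⊕ x · g              ≈⟨ S.+-congʳ (recip-inverse (1-q^-₀ m)) ⟩
  one ⊕ x · g                          ∎
  where
  open S-Reasoning
  x g : Series
  x = q^ m
  g = geometric m

geometric-nonNegative3ˢ : ∀ m .{{_ : NonZero m}} → 3 ∣ m → NonNegative3ˢ (geometric m)
geometric-nonNegative3ˢ m 3∣m = <-rec (λ n → NonNegative3 n (geometric m n)) λ n rec →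
  subst (NonNegative3 n) (sym (trans (at (geometric-step m) n) (⊕-at one ((q^ m) · geometric m) n)))
    (IsCone.+-closed (nonNegative3-isCone n) (one-nonNegative3ˢ n)
      (q^-·-nonNegative3 3∣m (geometric m) n λ { k refl → rec (ℕ.m<n+m k (ℕ.>-nonZero⁻¹ m)) }))

-- Strict positivity at every multiple of 3 originates here, in 1/(1 - q³); the other factors need
-- only be nonnegative with constant term 1.
geometric-positive3ˢ : Positive3ˢ (geometric 3)
geometric-positive3ˢ = go
  where
  step : ∀ n → geometric 3 n ≡ one n + ((q^ 3) · geometric 3) n
  step n = trans (at (geometric-step 3) n) (⊕-at one ((q^ 3) · geometric 3) n)
  go : Positive3ˢ (geometric 3)
  go 0                   = +<+ (s≤s z≤n)
  go 1                   = trans (step 1) (trans (ℤ.+-identityˡ _) (q^-·-< (geometric 3) (s≤s (s≤s z≤n))))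
  go 2                   = trans (step 2) (trans (ℤ.+-identityˡ _) (q^-·-< (geometric 3) (s≤s (s≤s (s≤s z≤n)))))
  go (suc (suc (suc n))) = subst (Positive3 n)
    (sym (trans (step (3 ℕ.+ n)) (trans (ℤ.+-identityˡ _) (q^-·-+ 3 (geometric 3) n)))) (go n)

-- Reciprocals of infinite products

finitePoch-₀ : ∀ a c .{{_ : NonZero a}} .{{_ : NonZero c}} K → finitePoch a c K 0 ≡ 1ℤ
finitePoch-₀ a c K = finitePoch-stable a c {0} {K} z≤n

recip-poch : ∀ a c .{{_ : NonZero a}} .{{_ : NonZero c}} K →
             recip (poch a c) ≈[ suc K ] recip (finitePoch a c K)
recip-poch a c K = recip-≈ refl (≈-trans (·-≈ (≈-sym (finitePoch-≈ a c K)) ≈-refl)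
  (≐⇒≈ (recip-inverse (finitePoch-₀ a c K))))

+-nonZero : ∀ a b .{{_ : NonZero a}} → NonZero (a ℕ.+ b)
+-nonZero (suc a) b = _

recip-finitePoch-suc : ∀ a c .{{_ : NonZero a}} .{{_ : NonZero c}} K →
  recip (finitePoch a c (suc K)) ≐ geometric (a ℕ.+ c ℕ.* K) · recip (finitePoch a c K)
recip-finitePoch-suc a c K =
  recip-· (1-q^-₀ (a ℕ.+ c ℕ.* K) {{+-nonZero a (c ℕ.* K)}}) (finitePoch-₀ a c K)

recip-one : recip one ≐ one
recip-one = recip-unique refl (S.*-identityˡ one)

module _ {a c : ℕ} .{{_ : NonZero a}} .{{_ : NonZero c}} (3∣a : 3 ∣ a) (3∣c : 3 ∣ c) where

  factor-nonNegative3ˢ : ∀ K → NonNegative3ˢ (geometric (a ℕ.+ c ℕ.* K))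
  factor-nonNegative3ˢ K = geometric-nonNegative3ˢ (a ℕ.+ c ℕ.* K) {{+-nonZero a (c ℕ.* K)}}
    (∣m∣n⇒∣m+n 3∣a (∣m⇒∣m*n K 3∣c))

  recip-finitePoch-nonNegative3ˢ : ∀ K → NonNegative3ˢ (recip (finitePoch a c K))
  recip-finitePoch-nonNegative3ˢ zero    = nonNegative3ˢ-resp recip-one one-nonNegative3ˢ
  recip-finitePoch-nonNegative3ˢ (suc K) = nonNegative3ˢ-resp (recip-finitePoch-suc a c K)
    (·-nonNegative3ˢ (factor-nonNegative3ˢ K) (recip-finitePoch-nonNegative3ˢ K))

  recip-poch-nonNegative3ˢ : NonNegative3ˢ (recip (poch a c))
  recip-poch-nonNegative3ˢ n = subst (NonNegative3 n) (sym (at< (recip-poch a c n) n (ℕ.n<1+n n)))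
    (recip-finitePoch-nonNegative3ˢ n n)

recip-poch-positive3ˢ : ∀ {c} .{{_ : NonZero c}} → 3 ∣ c → Positive3ˢ (recip (poch 3 c))
recip-poch-positive3ˢ {c} 3∣c n = subst (Positive3 n)
  (sym (at< (recip-poch 3 c (suc n)) n (ℕ.m<n⇒m<1+n (ℕ.n<1+n n)))) (go n n)
  where
  -- At least one factor is required, since the one with k = 0 is 1/(1 - q³).
  go : ∀ K → Positive3ˢ (recip (finitePoch 3 c (suc K)))
  go zero    = positive3ˢ-resp (S.trans (recip-finitePoch-suc 3 c 0)
    (S.trans (S.*-congˡ recip-one) (S.trans (S.*-identityʳ (geometric (3 ℕ.+ c ℕ.* 0)))
      (S.reflexive (cong (λ m → geometric (3 ℕ.+ m)) (ℕ.*-zeroʳ c)))))) geometric-positive3ˢ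
  go (suc K) = positive3ˢ-resp (recip-finitePoch-suc 3 c (suc K))
    (·-positive3ˢ refl (factor-nonNegative3ˢ (divides 1 refl) 3∣c (suc K)) (go K))

-- Splitting infinite products modulo 2 and 3

∏-*2 : ∀ K g → ∏ (K ℕ.* 2) g ≐ ∏ K (λ k → g (k ℕ.* 2)) · ∏ K (λ k → g (suc (k ℕ.* 2)))
∏-*2 zero    g = S.sym (S.*-identityˡ one)
∏-*2 (suc K) g = S.trans (S.*-congˡ (S.*-congˡ (∏-*2 K g)))
  (solve 4 (λ b a x y → b :* (a :* (x :* y)) := (a :* x) :* (b :* y)) S.refl
    (g (suc (K ℕ.* 2))) (g (K ℕ.* 2)) (∏ K (λ k → g (k ℕ.* 2))) (∏ K (λ k → g (suc (k ℕ.* 2)))))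

∏-*3 : ∀ K g → ∏ (K ℕ.* 3) g ≐
  ∏ K (λ k → g (k ℕ.* 3)) · (∏ K (λ k → g (suc (k ℕ.* 3))) · ∏ K (λ k → g (suc (suc (k ℕ.* 3)))))
∏-*3 zero    g = S.sym (S.trans (S.*-identityˡ (one · one)) (S.*-identityˡ one))
∏-*3 (suc K) g = S.trans (S.*-congˡ (S.*-congˡ (S.*-congˡ (∏-*3 K g))))
  (solve 6 (λ c b a x y z → c :* (b :* (a :* (x :* (y :* z)))) := (a :* x) :* ((b :* y) :* (c :* z))) S.refl
    (g (suc (suc (K ℕ.* 3)))) (g (suc (K ℕ.* 3))) (g (K ℕ.* 3))
    (∏ K (λ k → g (k ℕ.* 3))) (∏ K (λ k → g (suc (k ℕ.* 3)))) (∏ K (λ k → g (suc (suc (k ℕ.* 3))))))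

1-q^-cong : ∀ {m n} → m ≡ n → one ⊕ ⊝ (q^ m) ≐ one ⊕ ⊝ (q^ n)
1-q^-cong refl = S.refl

poch-split₂ : ∀ a c .{{_ : NonZero a}} .{{_ : NonZero c}} →
              poch a c ≐ poch a (c ℕ.* 2) · poch (a ℕ.+ c) (c ℕ.* 2)
poch-split₂ a c = pointwise λ n → at< (≈-trans
    (≈-sym (≈-weaken (s≤s (ℕ.m≤m*n n 2)) (finitePoch-≈ a c (n ℕ.* 2))))
    (≈-trans (≐⇒≈ (finite n))
      (·-≈ (finitePoch-≈ a (c ℕ.* 2) {{it}} {{2c}} n) (finitePoch-≈ (a ℕ.+ c) (c ℕ.* 2) {{+-nonZero a c}} {{2c}} n))))
  n (ℕ.n<1+n n)
  where
  2c : NonZero (c ℕ.* 2)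
  2c = ℕ.m*n≢0 c 2
  finite : ∀ K → finitePoch a c (K ℕ.* 2) ≐ finitePoch a (c ℕ.* 2) K · finitePoch (a ℕ.+ c) (c ℕ.* 2) K
  finite K = S.trans (∏-*2 K λ k → one ⊕ ⊝ (q^ (a ℕ.+ c ℕ.* k))) (S.*-cong
    (∏-cong K λ k _ → 1-q^-cong (ℕS.solve 3 (λ a c k → a ℕS.:+ c ℕS.:* (k ℕS.:* ℕS.con 2)
      ℕS.:= a ℕS.:+ c ℕS.:* ℕS.con 2 ℕS.:* k) refl a c k))
    (∏-cong K λ k _ → 1-q^-cong (ℕS.solve 3 (λ a c k → a ℕS.:+ c ℕS.:* (ℕS.con 1 ℕS.:+ k ℕS.:* ℕS.con 2)
      ℕS.:= a ℕS.:+ c ℕS.:+ c ℕS.:* ℕS.con 2 ℕS.:* k) refl a c k)))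

poch-split₃ : ∀ a c .{{_ : NonZero a}} .{{_ : NonZero c}} →
  poch a c ≐ poch a (c ℕ.* 3) · (poch (a ℕ.+ c) (c ℕ.* 3) · poch (a ℕ.+ c ℕ.* 2) (c ℕ.* 3))
poch-split₃ a c = pointwise λ n → at< (≈-trans
    (≈-sym (≈-weaken (s≤s (ℕ.m≤m*n n 3)) (finitePoch-≈ a c (n ℕ.* 3))))
    (≈-trans (≐⇒≈ (finite n))
      (·-≈ (finitePoch-≈ a (c ℕ.* 3) {{it}} {{3c}} n)
        (·-≈ (finitePoch-≈ (a ℕ.+ c) (c ℕ.* 3) {{+-nonZero a c}} {{3c}} n)
          (finitePoch-≈ (a ℕ.+ c ℕ.* 2) (c ℕ.* 3) {{+-nonZero a (c ℕ.* 2)}} {{3c}} n)))))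
  n (ℕ.n<1+n n)
  where
  3c : NonZero (c ℕ.* 3)
  3c = ℕ.m*n≢0 c 3
  finite : ∀ K → finitePoch a c (K ℕ.* 3) ≐ finitePoch a (c ℕ.* 3) K
    · (finitePoch (a ℕ.+ c) (c ℕ.* 3) K · finitePoch (a ℕ.+ c ℕ.* 2) (c ℕ.* 3) K)
  finite K = S.trans (∏-*3 K λ k → one ⊕ ⊝ (q^ (a ℕ.+ c ℕ.* k))) (S.*-cong
    (∏-cong K λ k _ → 1-q^-cong (ℕS.solve 3 (λ a c k → a ℕS.:+ c ℕS.:* (k ℕS.:* ℕS.con 3)
      ℕS.:= a ℕS.:+ c ℕS.:* ℕS.con 3 ℕS.:* k) refl a c k))
    (S.*-cong
      (∏-cong K λ k _ → 1-q^-cong (ℕS.solve 3 (λ a c k → a ℕS.:+ c ℕS.:* (ℕS.con 1 ℕS.:+ k ℕS.:* ℕS.con 3)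
        ℕS.:= a ℕS.:+ c ℕS.:+ c ℕS.:* ℕS.con 3 ℕS.:* k) refl a c k))
      (∏-cong K λ k _ → 1-q^-cong (ℕS.solve 3 (λ a c k → a ℕS.:+ c ℕS.:* (ℕS.con 2 ℕS.:+ k ℕS.:* ℕS.con 3)
        ℕS.:= a ℕS.:+ c ℕS.:* ℕS.con 2 ℕS.:+ c ℕS.:* ℕS.con 3 ℕS.:* k) refl a c k))))

f≐poch : ∀ c .{{_ : NonZero c}} → f c ≐ poch c c
f≐poch c = pointwise λ n → at (finite n) n
  where
  finite : ∀ K → partialProduct c K ≐ finitePoch c c K
  finite zero    = S.refl
  finite (suc K) = S.trans (partialProduct-suc c K)
    (S.*-cong (1-q^-cong (ℕ.*-suc c K)) (finite K))

-- (1 - q^{2a+2ck}) / (1 - q^{a+ck}) = 1 + q^{a+ck}.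
poch-ratio-nonNegative3ˢ : ∀ {a c} .{{_ : NonZero a}} .{{_ : NonZero c}} → 3 ∣ a → 3 ∣ c →
  NonNegative3ˢ (poch (a ℕ.* 2) (c ℕ.* 2) · recip (poch a c))
poch-ratio-nonNegative3ˢ {a} {c} 3∣a 3∣c n = subst (NonNegative3 n)
  (sym (at< (≈-trans
      (·-≈ (≈-trans (≈-sym (finitePoch-≈ (a ℕ.* 2) (c ℕ.* 2) {{ℕ.m*n≢0 a 2}} {{ℕ.m*n≢0 c 2}} n))
        (≈-trans (≐⇒≈ (finite n)) (·-≈ ≈-refl (finitePoch-≈ a c n)))) ≈-refl)
      (≐⇒≈ (S.trans (S.*-assoc (ratio n) (poch a c) (recip (poch a c)))
        (S.trans (S.*-congˡ (recip-inverse refl)) (S.*-identityʳ (ratio n))))))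
    n (ℕ.n<1+n n)))
  (ratio-nonNegative3ˢ n n)
  where
  ratio : ℕ → Series
  ratio K = ∏ K λ k → one ⊕ (q^ (a ℕ.+ c ℕ.* k))
  ratio-nonNegative3ˢ : ∀ K → NonNegative3ˢ (ratio K)
  ratio-nonNegative3ˢ zero    = one-nonNegative3ˢ
  ratio-nonNegative3ˢ (suc K) = ·-nonNegative3ˢ
    (⊕-nonNegative3ˢ one-nonNegative3ˢ (q^-nonNegative3ˢ (∣m∣n⇒∣m+n 3∣a (∣m⇒∣m*n K 3∣c))))
    (ratio-nonNegative3ˢ K)
  factor : ∀ k → one ⊕ ⊝ (q^ (a ℕ.* 2 ℕ.+ c ℕ.* 2 ℕ.* k))
                 ≐ (one ⊕ (q^ (a ℕ.+ c ℕ.* k))) · (one ⊕ ⊝ (q^ (a ℕ.+ c ℕ.* k)))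
  factor k = S.sym (S.trans
    (solve 2 (λ x y → (con 1 :+ x) :* (con 1 :+ y) := (con 1 :+ y) :+ x :* (con 1 :+ y)) S.refl x (⊝ x))
    (S.trans (telescope x x) (S.+-congˡ (S.-‿cong (S.trans
      (S.sym (q^-+ (a ℕ.+ c ℕ.* k) (a ℕ.+ c ℕ.* k)))
      (q^-cong (ℕS.solve 3 (λ a c k → (a ℕS.:+ c ℕS.:* k) ℕS.:+ (a ℕS.:+ c ℕS.:* k)
        ℕS.:= a ℕS.:* ℕS.con 2 ℕS.:+ c ℕS.:* ℕS.con 2 ℕS.:* k) refl a c k)))))))
    where
    x : Series
    x = q^ (a ℕ.+ c ℕ.* k)
  finite : ∀ K → finitePoch (a ℕ.* 2) (c ℕ.* 2) K ≐ ratio K · finitePoch a c K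
  finite K = S.trans (∏-cong K λ k _ → factor k)
    (∏-* K (λ k → one ⊕ (q^ (a ℕ.+ c ℕ.* k))) (λ k → one ⊕ ⊝ (q^ (a ℕ.+ c ℕ.* k))))

·-recip : ∀ {s t x} → s 0 ≡ 1ℤ → x ≐ t · s → x · recip s ≐ t
·-recip {s} {t} s₀≡1 x≐ts = S.trans (S.*-congʳ x≐ts)
  (S.trans (S.*-assoc t s (recip s)) (S.trans (S.*-congˡ (recip-inverse s₀≡1)) (S.*-identityʳ t)))

recip-inverseˡ : ∀ {s} → s 0 ≡ 1ℤ → recip s · s ≐ one
recip-inverseˡ {s} s₀≡1 = S.trans (S.*-comm (recip s) s) (recip-inverse s₀≡1)

3∣_ : ∀ k → 3 ∣ k ℕ.* 3
3∣ k = divides k refl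

f3≐ : f 3 ≐ poch 3 6 · f 6
f3≐ = S.trans (f≐poch 3) (S.trans (poch-split₂ 3 3) (S.*-congˡ (S.sym (f≐poch 6))))

f6/f3 : f 6 · recip (f 3) ≐ recip (poch 3 6)
f6/f3 = ·-recip refl (S.sym (begin
  recip (poch 3 6) · f 3                 ≈⟨ S.*-congˡ f3≐ ⟩
  recip (poch 3 6) · (poch 3 6 · f 6)    ≈⟨ S.*-assoc (recip (poch 3 6)) (poch 3 6) (f 6) ⟨
  recip (poch 3 6) · poch 3 6 · f 6      ≈⟨ S.*-congʳ (recip-inverseˡ refl) ⟩
  one · f 6                              ≈⟨ S.*-identityˡ (f 6) ⟩
  f 6                                    ∎))
  where open S-Reasoning

f6/f3-positive3ˢ : Positive3ˢ (f 6 · recip (f 3))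
f6/f3-positive3ˢ = positive3ˢ-resp f6/f3 (recip-poch-positive3ˢ (3∣ 2))

-- Splitting f₃ modulo 9 and then (q⁹;q⁹) by parity cancels f₃₆ and one of the two factors
-- `poch 18 36`. The other stays in the numerator and is paired with `poch 9 18`, where the quotient
-- is a product of 1 + q^(9+18k).
theta-18-18/f3 : theta 18 18 · recip (f 3) ≐
  (poch 18 36 · recip (poch 9 18)) · (recip (poch 6 9) · recip (poch 3 9))
theta-18-18/f3 = ·-recip refl (S.sym (begin
  (p₁₈ · r₉) · (r₆ · r₃) · f 3
    ≈⟨ S.*-congˡ (S.trans (f≐poch 3) (S.trans (poch-split₃ 3 3) (S.*-congˡ (S.*-congˡ poch-9-9)))) ⟩
  (p₁₈ · r₉) · (r₆ · r₃) · (p₃ · (p₆ · (p₉ · (p₁₈ · f 36))))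
    ≈⟨ solve 8 (λ a x y z b c d F → (a :* x) :* (y :* z) :* (b :* (c :* (d :* (a :* F))))
         := ((x :* d) :* ((y :* c) :* (z :* b))) :* (F :* (a :* a))) S.refl p₁₈ r₉ r₆ r₃ p₃ p₆ p₉ (f 36) ⟩
  ((r₉ · p₉) · ((r₆ · p₆) · (r₃ · p₃))) · theta 18 18
    ≈⟨ S.*-congʳ (S.trans (S.*-cong (recip-inverseˡ refl) (S.*-cong (recip-inverseˡ refl) (recip-inverseˡ refl)))
         (S.trans (S.*-identityˡ (one · one)) (S.*-identityˡ one))) ⟩
  one · theta 18 18
    ≈⟨ S.*-identityˡ (theta 18 18) ⟩
  theta 18 18 ∎))
  where
  open S-Reasoning
  p₃ p₆ p₉ p₁₈ r₃ r₆ r₉ : Series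
  p₃  = poch 3 9
  p₆  = poch 6 9
  p₉  = poch 9 18
  p₁₈ = poch 18 36
  r₃  = recip p₃
  r₆  = recip p₆
  r₉  = recip p₉
  poch-9-9 : poch 9 9 ≐ p₉ · (p₁₈ · f 36)
  poch-9-9 = S.trans (poch-split₂ 9 9) (S.*-congˡ (S.trans (poch-split₂ 18 18) (S.*-congˡ (S.sym (f≐poch 36)))))

theta-18-18/f3-positive3ˢ : Positive3ˢ (theta 18 18 · recip (f 3))
theta-18-18/f3-positive3ˢ = positive3ˢ-resp theta-18-18/f3
  (·-positive3ˢ (·-₀ {poch 18 36} {recip (poch 9 18)} refl refl) (poch-ratio-nonNegative3ˢ (3∣ 3) (3∣ 6))
    (·-positive3ˢ refl (recip-poch-nonNegative3ˢ (3∣ 2) (3∣ 3)) (recip-poch-positive3ˢ (3∣ 3))))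

-- Splitting f₆ into residues modulo 36 shows that all of `theta 6 30` divides out, so only
-- reciprocals remain.
theta-6-30/f3 : theta 6 30 · recip (f 3) ≐
  recip (poch 12 36) · (recip (poch 18 36) · (recip (poch 24 36) · recip (poch 3 6)))
theta-6-30/f3 = ·-recip refl (S.sym (begin
  r₁₂ · (r₁₈ · (r₂₄ · r₃)) · f 3
    ≈⟨ S.*-congˡ (S.trans f3≐ (S.*-congˡ f6≐)) ⟩
  r₁₂ · (r₁₈ · (r₂₄ · r₃)) · (p₃ · ((p₆ · (p₁₈ · p₃₀)) · (p₁₂ · (p₂₄ · f 36))))
    ≈⟨ S.trans (solve 6 (λ a b c d p s → a :* (b :* (c :* d)) :* (p :* s) := (d :* p) :* (a :* (b :* (c :* s)))) S.refl
           r₁₂ r₁₈ r₂₄ r₃ p₃ ((p₆ · (p₁₈ · p₃₀)) · (p₁₂ · (p₂₄ · f 36))))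
         (S.*-congˡ (solve 9 (λ a b c x y z u v F → a :* (b :* (c :* ((x :* (y :* z)) :* (u :* (v :* F)))))
           := ((a :* u) :* ((b :* y) :* (c :* v))) :* (F :* (x :* z))) S.refl r₁₂ r₁₈ r₂₄ p₆ p₁₈ p₃₀ p₁₂ p₂₄ (f 36))) ⟩
  (r₃ · p₃) · (((r₁₂ · p₁₂) · ((r₁₈ · p₁₈) · (r₂₄ · p₂₄))) · theta 6 30)
    ≈⟨ S.*-cong (recip-inverseˡ refl) (S.*-congʳ (S.trans
         (S.*-cong (recip-inverseˡ refl) (S.*-cong (recip-inverseˡ refl) (recip-inverseˡ refl)))
         (S.trans (S.*-identityˡ (one · one)) (S.*-identityˡ one)))) ⟩
  one · (one · theta 6 30)
    ≈⟨ S.trans (S.*-identityˡ (one · theta 6 30)) (S.*-identityˡ (theta 6 30)) ⟩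
  theta 6 30 ∎))
  where
  open S-Reasoning
  p₃ p₆ p₁₂ p₁₈ p₂₄ p₃₀ r₃ r₁₂ r₁₈ r₂₄ : Series
  p₃  = poch 3 6
  p₆  = poch 6 36
  p₁₂ = poch 12 36
  p₁₈ = poch 18 36
  p₂₄ = poch 24 36
  p₃₀ = poch 30 36
  r₃  = recip p₃
  r₁₂ = recip p₁₂
  r₁₈ = recip p₁₈
  r₂₄ = recip p₂₄
  f6≐ : f 6 ≐ (p₆ · (p₁₈ · p₃₀)) · (p₁₂ · (p₂₄ · f 36))
  f6≐ = S.trans (f≐poch 6) (S.trans (poch-split₂ 6 6) (S.*-cong (poch-split₃ 6 12)
    (S.trans (poch-split₃ 12 12) (S.*-congˡ (S.*-congˡ (S.sym (f≐poch 36)))))))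

theta-6-30/f3-positive3ˢ : Positive3ˢ (theta 6 30 · recip (f 3))
theta-6-30/f3-positive3ˢ = positive3ˢ-resp theta-6-30/f3
  (·-positive3ˢ refl (recip-poch-nonNegative3ˢ (3∣ 4) (3∣ 12))
    (·-positive3ˢ refl (recip-poch-nonNegative3ˢ (3∣ 6) (3∣ 12))
      (·-positive3ˢ refl (recip-poch-nonNegative3ˢ (3∣ 8) (3∣ 12)) (recip-poch-positive3ˢ (3∣ 2)))))

-- The two eta quotients

f₂²/f₄≐theta : (f 2 · f 2) · recip (f 4) ≐ theta 2 2
f₂²/f₄≐theta = ·-recip refl (S.trans (S.*-cong f2≐ f2≐)
  (solve 2 (λ p F → (p :* F) :* (p :* F) := F :* (p :* p) :* F) S.refl (poch 2 4) (f 4)))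
  where
  f2≐ : f 2 ≐ poch 2 4 · f 4
  f2≐ = S.trans (f≐poch 2) (S.trans (poch-split₂ 2 2) (S.*-congˡ (S.sym (f≐poch 4))))

opaque
  unfolding _·_

  a-2-1-1-unfold : a (0ℤ ∷ + 2 ∷ -[1+ 0 ] ∷ -[1+ 0 ] ∷ [])
    ≐ one · ((f 2 · (f 2 · one)) · ((recip (f 3) · one) · ((recip (f 4) · one) · one)))
  a-2-1-1-unfold = pointwise λ _ → refl

  a-3-1-0-unfold : a (0ℤ ∷ + 3 ∷ -[1+ 0 ] ∷ + 0 ∷ [])
    ≐ one · ((f 2 · (f 2 · (f 2 · one))) · ((recip (f 3) · one) · (one · one)))
  a-3-1-0-unfold = pointwise λ _ → refl

  cubicQuotient-0 : cubicQuotient 0 ≡ 1ℤ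
  cubicQuotient-0 = refl

  cubicQuotient-2 : cubicQuotient 2 ≡ -[1+ 2 ]
  cubicQuotient-2 = refl

U V : Series
U = theta 18 18 · recip (f 3)
V = theta 6 30 · recip (f 3)

a-2-1-1 : a (0ℤ ∷ + 2 ∷ -[1+ 0 ] ∷ -[1+ 0 ] ∷ []) ≐ U ⊕ ⊝ ((q^ 2) · (V ⊕ V))
a-2-1-1 = begin
  a (0ℤ ∷ + 2 ∷ -[1+ 0 ] ∷ -[1+ 0 ] ∷ [])
    ≈⟨ a-2-1-1-unfold ⟩
  one · ((f 2 · (f 2 · one)) · ((recip (f 3) · one) · ((recip (f 4) · one) · one)))
    ≈⟨ solve 3 (λ x r s → con 1 :* ((x :* (x :* con 1)) :* ((r :* con 1) :* ((s :* con 1) :* con 1)))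
         := ((x :* x) :* s) :* r) S.refl (f 2) (recip (f 3)) (recip (f 4)) ⟩
  (f 2 · f 2) · recip (f 4) · recip (f 3)
    ≈⟨ S.*-congʳ (S.trans f₂²/f₄≐theta theta-dissection) ⟩
  (theta 18 18 ⊕ ⊝ (q2 · (theta 6 30 ⊕ theta 6 30))) · recip (f 3)
    ≈⟨ S.distribʳ (recip (f 3)) (theta 18 18) (⊝ (q2 · (theta 6 30 ⊕ theta 6 30))) ⟩
  U ⊕ (⊝ (q2 · (theta 6 30 ⊕ theta 6 30))) · recip (f 3)
    ≈⟨ S.+-congˡ (S.trans (S.sym (-‿distribˡ-* (q2 · (theta 6 30 ⊕ theta 6 30)) (recip (f 3))))
         (S.-‿cong (solve 3 (λ q t r → q :* (t :+ t) :* r := q :* (t :* r :+ t :* r)) S.refl q2 (theta 6 30) (recip (f 3))))) ⟩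
  U ⊕ ⊝ (q2 · (V ⊕ V)) ∎
  where
  open S-Reasoning
  q2 : Series
  q2 = q^ 2

a-2-1-1-at : ∀ n → a (0ℤ ∷ + 2 ∷ -[1+ 0 ] ∷ -[1+ 0 ] ∷ []) n ≡ U n - ((q^ 2) · (V ⊕ V)) n
a-2-1-1-at n = trans (at a-2-1-1 n) (trans (⊕-at U (⊝ ((q^ 2) · (V ⊕ V))) n)
  (cong (_+_ (U n)) (⊝-at ((q^ 2) · (V ⊕ V)) n)))

-- The factor q² moves the support of V to the residue 2, so it never meets the support of U.
q²V-0 : ∀ n → ((q^ 2) · (V ⊕ V)) (n ℕ.* 3) ≡ 0ℤ
q²V-0 zero    = q^-·-< (V ⊕ V) (s≤s z≤n)
q²V-0 (suc n) = trans (q^-·-+ 2 (V ⊕ V) (1 ℕ.+ n ℕ.* 3)) (trans (⊕-at V V (1 ℕ.+ n ℕ.* 3))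
  (cong₂ _+_ (V-1 n) (V-1 n)))
  where
  V-1 : ∀ n → V (1 ℕ.+ n ℕ.* 3) ≡ 0ℤ
  V-1 n = Mod3-1 {Positive} {IsZero} {IsZero} n (theta-6-30/f3-positive3ˢ (1 ℕ.+ n ℕ.* 3))

q²V-1 : ∀ n → ((q^ 2) · (V ⊕ V)) (1 ℕ.+ n ℕ.* 3) ≡ 0ℤ
q²V-1 zero    = q^-·-< (V ⊕ V) (s≤s (s≤s z≤n))
q²V-1 (suc n) = trans (q^-·-+ 2 (V ⊕ V) (2 ℕ.+ n ℕ.* 3)) (trans (⊕-at V V (2 ℕ.+ n ℕ.* 3))
  (cong₂ _+_ (V-2 n) (V-2 n)))
  where
  V-2 : ∀ n → V (2 ℕ.+ n ℕ.* 3) ≡ 0ℤ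
  V-2 n = Mod3-2 {Positive} {IsZero} {IsZero} n (theta-6-30/f3-positive3ˢ (2 ℕ.+ n ℕ.* 3))

Signs : Series → Set
Signs s = ∀ n → (s (n ℕ.* 3) > 0ℤ) × (s (1 ℕ.+ n ℕ.* 3) ≡ 0ℤ) × (s (2 ℕ.+ n ℕ.* 3) < 0ℤ)

a-2-1-1-signs : Signs (a (0ℤ ∷ + 2 ∷ -[1+ 0 ] ∷ -[1+ 0 ] ∷ []))
a-2-1-1-signs n =
    subst (0ℤ <_) (sym (trans (a-2-1-1-at (n ℕ.* 3)) (trans (cong (_-_ (U (n ℕ.* 3))) (q²V-0 n)) (ℤ.+-identityʳ (U (n ℕ.* 3))))))
      (Mod3-0 {Positive} {IsZero} {IsZero} n (U+ (n ℕ.* 3)))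
  , trans (a-2-1-1-at (1 ℕ.+ n ℕ.* 3)) (cong₂ _-_ (Mod3-1 {Positive} {IsZero} {IsZero} n (U+ (1 ℕ.+ n ℕ.* 3))) (q²V-1 n))
  , subst (_< 0ℤ) (sym (trans (a-2-1-1-at (2 ℕ.+ n ℕ.* 3))
        (trans (cong₂ _-_ (Mod3-2 {Positive} {IsZero} {IsZero} n (U+ (2 ℕ.+ n ℕ.* 3)))
            (trans (q^-·-+ 2 (V ⊕ V) (n ℕ.* 3)) (⊕-at V V (n ℕ.* 3))))
          (ℤ.+-identityˡ (- (V (n ℕ.* 3) + V (n ℕ.* 3)))))))
      (ℤ.neg-mono-< (ℤ.+-mono-< V+ V+))
  where
  U+ : Positive3ˢ U
  U+ = theta-18-18/f3-positive3ˢ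
  V+ : 0ℤ < V (n ℕ.* 3)
  V+ = Mod3-0 {Positive} {IsZero} {IsZero} n (theta-6-30/f3-positive3ˢ (n ℕ.* 3))

a-3-1-0 : a (0ℤ ∷ + 3 ∷ -[1+ 0 ] ∷ + 0 ∷ []) ≐ cubicQuotient · (f 6 · recip (f 3))
a-3-1-0 = S.trans a-3-1-0-unfold (S.trans
  (solve 2 (λ x r → con 1 :* ((x :* (x :* (x :* con 1))) :* ((r :* con 1) :* (con 1 :* con 1)))
    := (x :* (x :* x)) :* r) S.refl (f 2) (recip (f 3)))
  (S.trans (S.*-congʳ (S.sym (S.trans (S.*-congˡ (recip-inverseˡ refl)) (S.*-identityʳ (f 2 · (f 2 · f 2))))))
    (solve 4 (λ y r s t → y :* (r :* s) :* t := (y :* r) :* (s :* t)) S.refl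
      (f 2 · (f 2 · f 2)) (recip (f 6)) (f 6) (recip (f 3)))))

-3*-negative : ∀ {x} → 0ℤ < x → -[1+ 2 ] * x < 0ℤ
-3*-negative {+[1+ n ]} _           = -<+
-3*-negative {+ 0}      (+<+ ())

opaque
  unfolding _·_

  -- The pattern of `s` gives weak signs for every summand. Strictness at 3n comes from
  -- `s 0 * t (3n)`, and at 3n + 2 from `s 2 * t (3n)`, the third summand.
  ·-signs : ∀ {s t : Series} → (∀ i → SignPattern i (s i)) → s 0 ≡ 1ℤ → s 2 ≡ -[1+ 2 ] →
            Positive3ˢ t → Signs (s · t)
  ·-signs {s} {t} σ s₀≡1 s₂≡-3 τ n =
      subst (λ b → 0ℤ < b * t (n ℕ.* 3) + sum (tail₁ (n ℕ.* 3))) (sym s₀≡1)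
        (ℤ.+-mono-<-≤ (subst (0ℤ <_) (sym (ℤ.*-identityˡ (t (n ℕ.* 3)))) t+)
          (sum-closed nonNegative-isCone (tail₁ (n ℕ.* 3)) λ i →
            Mod3-0 {NonNegative} {IsZero} {NonPositive} n (term (n ℕ.* 3) (suc (toℕ i)) (toℕ<n i))))
    , sum-closed isZero-isCone (λ (i : Fin (2 ℕ.+ n ℕ.* 3)) → s (toℕ i) * t (1 ℕ.+ n ℕ.* 3 ∸ toℕ i))
        (λ i → Mod3-1 {NonNegative} {IsZero} {NonPositive} n (term (1 ℕ.+ n ℕ.* 3) (toℕ i) (ℕ.s≤s⁻¹ (toℕ<n i))))
    , ℤ.+-mono-≤-< (nonPositive 0 z≤n) (ℤ.+-mono-≤-< (nonPositive 1 (s≤s z≤n))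
        (ℤ.+-mono-<-≤ (subst (λ b → b * t (n ℕ.* 3) < 0ℤ) (sym s₂≡-3) (-3*-negative t+))
          (sum-closed nonPositive-isCone
            (λ (i : Fin (n ℕ.* 3)) → s (3 ℕ.+ toℕ i) * t (2 ℕ.+ n ℕ.* 3 ∸ (3 ℕ.+ toℕ i)))
            λ i → nonPositive (3 ℕ.+ toℕ i) (s≤s (s≤s (toℕ<n i))))))
    where
    tail₁ : ∀ m → Fin m → ℤ
    tail₁ m i = s (suc (toℕ i)) * t (m ∸ suc (toℕ i))
    t+ : 0ℤ < t (n ℕ.* 3)
    t+ = Mod3-0 {Positive} {IsZero} {IsZero} n (τ (n ℕ.* 3))
    term : ∀ m i → i ℕ.≤ m → SignPattern m (s i * t (m ∸ i))
    term = Mod3-term {NonNegative} {IsZero} {NonPositive} signPattern-isCone {s} {t}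
      σ (λ i → positive3⇒nonNegative3 i (τ i))
    nonPositive : ∀ i → i ℕ.≤ 2 ℕ.+ n ℕ.* 3 → s i * t (2 ℕ.+ n ℕ.* 3 ∸ i) ≤ 0ℤ
    nonPositive i i≤m = Mod3-2 {NonNegative} {IsZero} {NonPositive} n (term (2 ℕ.+ n ℕ.* 3) i i≤m)

signs-resp : ∀ {s t} → s ≐ t → Signs t → Signs s
signs-resp s≐t τ n =
    subst (0ℤ <_) (sym (at s≐t (n ℕ.* 3))) (proj₁ (τ n))
  , trans (at s≐t (1 ℕ.+ n ℕ.* 3)) (proj₁ (proj₂ (τ n)))
  , subst (_< 0ℤ) (sym (at s≐t (2 ℕ.+ n ℕ.* 3))) (proj₂ (proj₂ (τ n)))

a-3-1-0-signs : Signs (a (0ℤ ∷ + 3 ∷ -[1+ 0 ] ∷ + 0 ∷ []))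
a-3-1-0-signs = signs-resp a-3-1-0
  (·-signs CubicSign.cubicQuotient-sign cubicQuotient-0 cubicQuotient-2 f6/f3-positive3ˢ)

signs-3n : ∀ {s} → Signs s → ∀ n →
           (s (3 ℕ.* n) > 0ℤ) × (s (3 ℕ.* n ℕ.+ 1) ≡ 0ℤ) × (s (3 ℕ.* n ℕ.+ 2) < 0ℤ)
signs-3n {s} σ n rewrite ℕ.+-comm (3 ℕ.* n) 1 | ℕ.+-comm (3 ℕ.* n) 2 | ℕ.*-comm 3 n = σ n

theorem3p1 : (t₂ t₃ t₄ : ℤ) → (t₂ , t₃ , t₄) ∈ S₂ → (n : ℕ) →
    (a (0ℤ ∷ t₂ ∷ t₃ ∷ t₄ ∷ []) (3 ℕ.* n) > 0ℤ)
    × (a (0ℤ ∷ t₂ ∷ t₃ ∷ t₄ ∷ []) (3 ℕ.* n ℕ.+ 1) ≡ 0ℤ)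
    × (a (0ℤ ∷ t₂ ∷ t₃ ∷ t₄ ∷ []) (3 ℕ.* n ℕ.+ 2) < 0ℤ)
theorem3p1 t₂ t₃ t₄ (here refl)         = signs-3n {a (0ℤ ∷ + 2 ∷ -[1+ 0 ] ∷ -[1+ 0 ] ∷ [])} a-2-1-1-signs
theorem3p1 t₂ t₃ t₄ (there (here refl)) = signs-3n {a (0ℤ ∷ + 3 ∷ -[1+ 0 ] ∷ + 0 ∷ [])} a-3-1-0-signs
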